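{- Let $n\ge 7$. If $G$ and $H$ are graphs on $n$ vertices with the same $(n-3)$-deck, i.e. $\mathcal{D}_{n-3}(G)=\mathcal{D}_{n-3}(H)$, then $G$ is connected if and only if $H$ is connected. (Thus connectedness is $3$-reconstructible for $n$-vertex graphs when $n\ge7$.) Moreover, the threshold on $n$ is sharp: there exist two graphs on $6$ vertices with the same $3$-deck such that one is connected and the other is not.
   Context: All graphs are finite and simple. For a graph $G$, a $k$-card of $G$ is an induced subgraph of $G$ on $k$ vertices, considered up to isomorphism. The $k$-deck $\mathcal{D}_k(G)$ is the multiset of all $k$-cards of $G$ (one for each $k$-element vertex subset). A graph invariant or property is called $l$-reconstructible (for $n$-vertex graphs) if it is determined by the $(n-l)$-deck, i.e. any two $n$-vertex graphs with the same $(n-l)$-deck agree on it. -}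

module Defs where

open import Data.Bool using (Bool; true; false)
open import Data.Fin using (Fin)
open import Data.Fin.Subset using (Subset; _∈_; ∣_∣)
open import Data.Nat using (ℕ)
open import Data.Product using (Σ; Σ-syntax; proj₁)
open import Function.Bundles using (_↔_; module Inverse)
open import Relation.Binary.Construct.Closure.ReflexiveTransitive using (Star)
open import Relation.Binary.PropositionalEquality using (_≡_)

record SimpleGraph (V : Set) : Set where
  field
    adj        : V → V → Bool
    adj-sym    : ∀ u v → adj u v ≡ adj v u
    adj-irrefl : ∀ v → adj v v ≡ false

  Adj : V → V → Set
  Adj u v = adj u v ≡ true

open SimpleGraph public

Graph : ℕ → Set
Graph n = SimpleGraph (Fin n)

record _≅_ {V W : Set} (G : SimpleGraph V) (H : SimpleGraph W) : Set where
  field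
    vertices  : V ↔ W
    preserves : ∀ u v → adj G u v ≡ adj H (Inverse.to vertices u) (Inverse.to vertices v)

-- Any two vertices are joined by a walk.  The graph without vertices counts as
-- connected.
Connected : {V : Set} → SimpleGraph V → Set
Connected G = ∀ u v → Star (Adj G) u v

induced : {V : Set} → SimpleGraph V → (P : V → Set) → SimpleGraph (Σ V P)
induced G P = record
  { adj        = λ u v → adj G (proj₁ u) (proj₁ v)
  ; adj-sym    = λ u v → adj-sym G (proj₁ u) (proj₁ v)
  ; adj-irrefl = λ v → adj-irrefl G (proj₁ v)
  }

KSubset : ℕ → ℕ → Set
KSubset n k = Σ[ S ∈ Subset n ] ∣ S ∣ ≡ k

-- The k-deck of G is the family (card G S) indexed by the k-subsets S.
card : ∀ {n k} (G : Graph n) (S : KSubset n k) → SimpleGraph (Σ[ v ∈ Fin n ] v ∈ proj₁ S)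
card G S = induced G (_∈ proj₁ S)

-- Equality of the k-decks as multisets of isomorphism classes: a bijection
-- between the index sets that matches isomorphic cards, so that each
-- isomorphism class occurs equally often in both families.
record SameDeck {n : ℕ} (k : ℕ) (G H : Graph n) : Set where
  field
    matching : KSubset n k ↔ KSubset n k
    card-iso : ∀ S → card G S ≅ card H (Inverse.to matching S)

{-# OPTIONS --safe #-}

-- Let G be connected, H disconnected, with the same deck of k-cards, k = n − 3.  By
-- Kelly's lemma, a sum over all j-sets of vertices, j ≤ k, of an isomorphism invariant
-- of the induced subgraph has the same value for G and H.  G has two connected
-- k-cards, so some component C of H has n − 1 or n − 2 vertices.
--
-- If |C| = n − 2, sum e(T) + a(R) over the connected R with n − 4 vertices, where T is
-- the complement of R, e(T) its number of edges and a(R) the number of vertices of T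
-- with a neighbour in R.  This sum is determined by the deck.  Every term is at least 4
-- in G, because contracting R leaves a connected graph on five vertices, and at most 4
-- in H.  So equality holds throughout; in C, this means that any two vertices whose
-- removal leaves C connected are adjacent, which forces C to be complete or of maximum
-- degree 2.  In the first case H, and then G, has no induced path on three vertices, so
-- G is complete.  In the second, G has maximum degree 2 and a leaf u, and a(R) ≤ 2 with
-- a(R) ≤ 1 if u ∈ R, whereas a(R) = 2 for all R in H.
--
-- If |C| = n − 1, let b(j) be the number of vertices of degree j in G minus that in H.
-- The deck determines Σ C(deg v , i) for i < k, so Σ b(j) x^j = (1 − x)^k q(x) with q
-- of degree at most 2.  Since 2^k exceeds 2n, q(−1) = 0, and since b(0) = −1 one
-- parameter α is left.  Nonnegativity of the degree counts excludes all α, except α = 0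
-- for n = 7: then G is K₄ with pendant edges at three of its vertices, and H contains a
-- 4-clique and an independent 4-set, which does not fit its degrees.

module Submission where

open import Data.Bool using (Bool; true; false; _∧_; _∨_; not; if_then_else_)
import Data.Bool.Properties as Bool
open import Data.Empty using (⊥; ⊥-elim)
open import Data.Fin using (Fin; zero; suc; #_)
import Data.Fin.Properties as Fin
open import Data.Fin.Subset using (Subset) renaming (∣_∣ to size)
open import Data.Fin.Subset.Properties using (anySubset?)
open import Data.Integer using (ℤ; -[1+_]; 0ℤ; 1ℤ; _+_; _*_; _-_; -_; _≤_; +≤+; -≤+) renaming (+_ to pos)
import Data.Integer.Properties as ℤ
open import Data.Integer.Tactic.RingSolver using (solve-∀)
open import Data.List using (List; []; _∷_; map; _++_; length)
import Data.List.Membership.Propositional as List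
open import Data.List.Relation.Unary.All as All using (All; []; _∷_)
open import Data.List.Relation.Unary.AllPairs using (AllPairs; []; _∷_)
open import Data.List.Relation.Unary.Any using (here; there)
open import Data.Nat as ℕ using (ℕ; zero; suc; z≤n; s≤s; _∸_)
import Data.Nat.Properties as ℕ
open import Data.Product using (_×_; _,_; proj₁; proj₂; Σ-syntax; ∃; ∃₂)
open import Data.Sum using (_⊎_; inj₁; inj₂)
open import Data.Vec as Vec using (Vec; []; _∷_; lookup; tabulate; _[_]≔_; replicate)
import Data.Vec.Properties as Vec
import Data.Vec.Properties.WithK as Vec
open import Function using (_∘_)
open import Function.Bundles using (_⇔_; mk⇔; mk↔ₛ′; module Inverse)
open import Relation.Binary.Construct.Closure.ReflexiveTransitive using (Star; ε; _◅_; _◅◅_)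
open import Relation.Binary.Definitions using (DecidableEquality)
open import Relation.Binary.PropositionalEquality
open import Relation.Nullary using (¬_; Dec; yes; no; does)
open import Relation.Nullary.Decidable using (_×-dec_; _→-dec_; ¬?; decidable-stable; from-yes)
open import Defs

-- Two connected cards suffice because a component of H with exactly n - 3 vertices contains a
-- single card, and a connected card disjoint from it would need 2(n - 3) ≤ n. The set R has n - 4
-- vertices so that R with one further vertex is still a card. Thus a(R) and the edges between R and
-- T are visible in the deck, and e(T) follows by subtraction from the total number of edges. In H,
-- the set T consists of two vertices of C and two outside, with no edge between these pairs. Hence
-- e(T) ≤ 1 + 1, and only the first two can have neighbours in R. In the other case, Σ b(j) C(j , i)
-- is the i-th Taylor coefficient at 1 of Σ b(j) x^j. Its vanishing for all i < k means divisibility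
-- by (1 - x)^k, and since degrees are at most n - 1 = k + 2, the cofactor q has degree at most 2.
-- The value of the product at -1 is a multiple of 2^k, but also a difference of two sums of n
-- signs, hence at most 2n in absolute value. The inequalities 2(n - 3) > n and 2^k > 2n both hold
-- at n = 7, the latter as 16 > 14, and both fail at n = 6.

private variable
  A B : Set
  n : ℕ


-- Integer inequalities and indicators

0≤+ : ∀ {a b} → 0ℤ ≤ a → 0ℤ ≤ b → 0ℤ ≤ a + b
0≤+ = ℤ.+-mono-≤

0≤* : ∀ {a b} → 0ℤ ≤ a → 0ℤ ≤ b → 0ℤ ≤ a * b
0≤* {pos a} {pos b} _ _ = subst (0ℤ ≤_) (ℤ.pos-* a b) (+≤+ z≤n)

gap : ∀ {a b} → a ≤ b → 0ℤ ≤ b - a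
gap = ℤ.i≤j⇒0≤j-i

-- Inequalities are proved by exhibiting the difference of the two sides as an
-- expression that is visibly nonnegative.
≤-from : ∀ {a b e} → 0ℤ ≤ e → e ≡ b - a → a ≤ b
≤-from 0≤e eq = ℤ.0≤i-j⇒j≤i (subst (0ℤ ≤_) eq 0≤e)

absurd-≤ : ∀ {e} → 0ℤ ≤ e → ∀ {m} → e ≡ -[1+ m ] → ⊥
absurd-≤ () refl

⟦_⟧ : Bool → ℤ
⟦ true  ⟧ = 1ℤ
⟦ false ⟧ = 0ℤ

0≤⟦⟧ : ∀ b → 0ℤ ≤ ⟦ b ⟧
0≤⟦⟧ true  = +≤+ z≤n
0≤⟦⟧ false = +≤+ z≤n

⟦⟧≤1 : ∀ b → ⟦ b ⟧ ≤ 1ℤ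
⟦⟧≤1 true  = ℤ.≤-refl
⟦⟧≤1 false = +≤+ z≤n

⟦⟧-∧ : ∀ a b → ⟦ a ∧ b ⟧ ≡ ⟦ a ⟧ * ⟦ b ⟧
⟦⟧-∧ true  true  = refl
⟦⟧-∧ true  false = refl
⟦⟧-∧ false b     = refl

⟦⟧-not : ∀ b → ⟦ not b ⟧ ≡ 1ℤ - ⟦ b ⟧
⟦⟧-not true  = refl
⟦⟧-not false = refl

⟦⟧-idem : ∀ b → ⟦ b ⟧ * ⟦ b ⟧ ≡ ⟦ b ⟧
⟦⟧-idem true  = refl
⟦⟧-idem false = refl

ind : ∀ {P : Set} → Dec P → ℤ
ind P? = ⟦ does P? ⟧

ind-yes : ∀ {P : Set} (P? : Dec P) → P → ind P? ≡ 1ℤ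
ind-yes (yes _) _ = refl
ind-yes (no ¬p) p = ⊥-elim (¬p p)

ind-no : ∀ {P : Set} (P? : Dec P) → ¬ P → ind P? ≡ 0ℤ
ind-no (yes p) ¬p = ⊥-elim (¬p p)
ind-no (no _)  _  = refl

ind-⇔ : ∀ {P Q : Set} (P? : Dec P) (Q? : Dec Q) → (P → Q) → (Q → P) → ind P? ≡ ind Q?
ind-⇔ (yes p) Q? f g = sym (ind-yes Q? (f p))
ind-⇔ (no ¬p) Q? f g = sym (ind-no Q? (¬p ∘ g))

*-congʳ-on : ∀ b {x y} → (b ≡ true → x ≡ y) → ⟦ b ⟧ * x ≡ ⟦ b ⟧ * y
*-congʳ-on true  eq = cong (1ℤ *_) (eq refl)
*-congʳ-on false eq = refl

*-monoʳ-on : ∀ b {x y} → (b ≡ true → x ≤ y) → ⟦ b ⟧ * x ≤ ⟦ b ⟧ * y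
*-monoʳ-on true  x≤y = subst₂ _≤_ (sym (ℤ.*-identityˡ _)) (sym (ℤ.*-identityˡ _)) (x≤y refl)
*-monoʳ-on false _   = ℤ.≤-refl

ind-exchange : ∀ (x y : Bool) {P Q : Set} (P? : Dec P) (Q? : Dec Q) z →
  (x ≡ true → P → y ≡ true × Q) → (y ≡ true → Q → x ≡ true × P) →
  ⟦ x ⟧ * (ind P? * z) ≡ ind Q? * (⟦ y ⟧ * z)
ind-exchange true  y     (yes p) Q? z f g with f refl p
... | refl , q = trans (ℤ.*-identityˡ (1ℤ * z)) (sym (trans (cong (_* (1ℤ * z)) (ind-yes Q? q)) (ℤ.*-identityˡ _)))
ind-exchange x     true  P? (yes q) z f g with g refl q
... | refl , p = trans (ℤ.*-identityˡ _) (trans (cong (_* z) (ind-yes P? p)) (sym (ℤ.*-identityˡ (1ℤ * z))))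
ind-exchange true  true  (no _) (no _) z f g = refl
ind-exchange true  false (no _) Q?     z f g = sym (ℤ.*-zeroʳ (ind Q?))
ind-exchange false true  P?     (no _) z f g = refl
ind-exchange false false P?     Q?     z f g = sym (ℤ.*-zeroʳ (ind Q?))

-- Finite sums

∑ᴸ : List A → (A → ℤ) → ℤ
∑ᴸ []       f = 0ℤ
∑ᴸ (x ∷ xs) f = f x + ∑ᴸ xs f

∑ᴸ-cong : ∀ (xs : List A) {f g} → (∀ x → f x ≡ g x) → ∑ᴸ xs f ≡ ∑ᴸ xs g
∑ᴸ-cong []       eq = refl
∑ᴸ-cong (x ∷ xs) eq = cong₂ _+_ (eq x) (∑ᴸ-cong xs eq)

∑ᴸ-0 : ∀ (xs : List A) → ∑ᴸ xs (λ _ → 0ℤ) ≡ 0ℤ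
∑ᴸ-0 []       = refl
∑ᴸ-0 (x ∷ xs) = trans (ℤ.+-identityˡ _) (∑ᴸ-0 xs)

∑ᴸ-+ : ∀ (xs : List A) f g → ∑ᴸ xs (λ x → f x + g x) ≡ ∑ᴸ xs f + ∑ᴸ xs g
∑ᴸ-+ []       f g = refl
∑ᴸ-+ (x ∷ xs) f g = trans (cong (f x + g x +_) (∑ᴸ-+ xs f g)) (interchange (f x) (g x) _ _)
  where
  interchange : ∀ a b c d → a + b + (c + d) ≡ a + c + (b + d)
  interchange = solve-∀

∑ᴸ-* : ∀ (xs : List A) c f → ∑ᴸ xs (λ x → c * f x) ≡ c * ∑ᴸ xs f
∑ᴸ-* []       c f = sym (ℤ.*-zeroʳ c)
∑ᴸ-* (x ∷ xs) c f = trans (cong (c * f x +_) (∑ᴸ-* xs c f)) (sym (ℤ.*-distribˡ-+ c _ _))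

∑ᴸ-swap : ∀ (xs : List A) (ys : List B) (f : A → B → ℤ) →
  ∑ᴸ xs (λ x → ∑ᴸ ys (f x)) ≡ ∑ᴸ ys (λ y → ∑ᴸ xs (λ x → f x y))
∑ᴸ-swap []       ys f = sym (∑ᴸ-0 ys)
∑ᴸ-swap (x ∷ xs) ys f = trans (cong (∑ᴸ ys (f x) +_) (∑ᴸ-swap xs ys f)) (sym (∑ᴸ-+ ys _ _))

∑ᴸ-nonneg : ∀ (xs : List A) {f} → (∀ x → 0ℤ ≤ f x) → 0ℤ ≤ ∑ᴸ xs f
∑ᴸ-nonneg []       0≤f = ℤ.≤-refl
∑ᴸ-nonneg (x ∷ xs) 0≤f = 0≤+ (0≤f x) (∑ᴸ-nonneg xs 0≤f)

∑ᴸ-++ : ∀ (xs ys : List A) f → ∑ᴸ (xs ++ ys) f ≡ ∑ᴸ xs f + ∑ᴸ ys f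
∑ᴸ-++ []       ys f = sym (ℤ.+-identityˡ _)
∑ᴸ-++ (x ∷ xs) ys f = trans (cong (f x +_) (∑ᴸ-++ xs ys f)) (sym (ℤ.+-assoc (f x) _ _))

∑ᴸ-map : ∀ (g : A → B) (xs : List A) f → ∑ᴸ (map g xs) f ≡ ∑ᴸ xs (f ∘ g)
∑ᴸ-map g []       f = refl
∑ᴸ-map g (x ∷ xs) f = cong (f (g x) +_) (∑ᴸ-map g xs f)

-- The equation `once` says both that the list is complete and that it has no repetitions.
record Enum (A : Set) : Set where
  field
    elems : List A
    _≟_   : DecidableEquality A
    once  : ∀ a → ∑ᴸ elems (λ x → ind (a ≟ x)) ≡ 1ℤ

open Enum ⦃ ... ⦄ public using (_≟_)

abstract

  ∑ : ⦃ E : Enum A ⦄ → (A → ℤ) → ℤ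
  ∑ ⦃ E ⦄ = ∑ᴸ (Enum.elems E)

  ∑-cong : ⦃ E : Enum A ⦄ {f g : A → ℤ} → (∀ x → f x ≡ g x) → ∑ f ≡ ∑ g
  ∑-cong ⦃ E ⦄ = ∑ᴸ-cong (Enum.elems E)

  ∑-+ : ⦃ E : Enum A ⦄ (f g : A → ℤ) → ∑ (λ x → f x + g x) ≡ ∑ f + ∑ g
  ∑-+ ⦃ E ⦄ = ∑ᴸ-+ (Enum.elems E)

  ∑-* : ⦃ E : Enum A ⦄ (c : ℤ) (f : A → ℤ) → ∑ (λ x → c * f x) ≡ c * ∑ f
  ∑-* ⦃ E ⦄ = ∑ᴸ-* (Enum.elems E)

  ∑-0 : ⦃ E : Enum A ⦄ → ∑ {A} (λ _ → 0ℤ) ≡ 0ℤ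
  ∑-0 ⦃ E ⦄ = ∑ᴸ-0 (Enum.elems E)

  ∑-nonneg : ⦃ E : Enum A ⦄ {f : A → ℤ} → (∀ x → 0ℤ ≤ f x) → 0ℤ ≤ ∑ f
  ∑-nonneg ⦃ E ⦄ = ∑ᴸ-nonneg (Enum.elems E)

  ∑-once : ⦃ E : Enum A ⦄ (a : A) → ∑ (λ x → ind (a ≟ x)) ≡ 1ℤ
  ∑-once ⦃ E ⦄ = Enum.once E

  ∑-swap : ⦃ EA : Enum A ⦄ ⦃ EB : Enum B ⦄ (f : A → B → ℤ) →
    ∑ (λ x → ∑ (f x)) ≡ ∑ (λ y → ∑ (λ x → f x y))
  ∑-swap ⦃ EA ⦄ ⦃ EB ⦄ f = ∑ᴸ-swap (Enum.elems EA) (Enum.elems EB) f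

  ∑-witness : ⦃ E : Enum A ⦄ (p : A → Bool) → 1ℤ ≤ ∑ (λ x → ⟦ p x ⟧) → ∃ λ a → p a ≡ true
  ∑-witness {A} ⦃ E ⦄ p = go (Enum.elems E)
    where
    go : ∀ (ys : List A) → 1ℤ ≤ ∑ᴸ ys (λ x → ⟦ p x ⟧) → ∃ λ a → p a ≡ true
    go []       (+≤+ ())
    go (y ∷ ys) 1≤ with p y in eq
    ... | true  = y , eq
    ... | false = go ys (subst (1ℤ ≤_) (ℤ.+-identityˡ _) 1≤)

module _ ⦃ E : Enum A ⦄ where

  ∑-*ʳ : ∀ (f : A → ℤ) c → ∑ (λ x → f x * c) ≡ ∑ f * c
  ∑-*ʳ f c = trans (∑-cong (λ x → ℤ.*-comm (f x) c)) (trans (∑-* c f) (ℤ.*-comm c _))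

  ∑-- : ∀ (f g : A → ℤ) → ∑ (λ x → f x - g x) ≡ ∑ f - ∑ g
  ∑-- f g = trans (∑-+ f (λ x → - g x)) (cong (∑ f +_) ∑-neg)
    where
    ∑-neg : ∑ (λ x → - g x) ≡ - ∑ g
    ∑-neg = trans (∑-cong (λ x → sym (ℤ.-1*i≡-i (g x)))) (trans (∑-* (- 1ℤ) g) (ℤ.-1*i≡-i _))

  ∑-mono : ∀ {f g : A → ℤ} → (∀ x → f x ≤ g x) → ∑ f ≤ ∑ g
  ∑-mono {f} {g} f≤g = ≤-from (∑-nonneg (λ x → gap (f≤g x))) (∑-- g f)

  ∑-δ : ∀ a (f : A → ℤ) → ∑ (λ x → ind (a ≟ x) * f x) ≡ f a
  ∑-δ a f = begin
    ∑ (λ x → ind (a ≟ x) * f x) ≡⟨ ∑-cong same ⟩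
    ∑ (λ x → ind (a ≟ x) * f a) ≡⟨ ∑-*ʳ _ (f a) ⟩
    ∑ (λ x → ind (a ≟ x)) * f a ≡⟨ cong (_* f a) (∑-once a) ⟩
    1ℤ * f a                    ≡⟨ ℤ.*-identityˡ (f a) ⟩
    f a                         ∎
    where
    open ≡-Reasoning
    same : ∀ x → ind (a ≟ x) * f x ≡ ind (a ≟ x) * f a
    same x with a ≟ x
    ... | yes refl = refl
    ... | no  _    = refl

  ∑-pick : ∀ a (f : A → ℤ) → ∑ f ≡ f a + ∑ (λ x → (1ℤ - ind (a ≟ x)) * f x)
  ∑-pick a f = begin
    ∑ f                                                    ≡⟨ ∑-cong (λ x → split (ind (a ≟ x)) (f x)) ⟩
    ∑ (λ x → ind (a ≟ x) * f x + (1ℤ - ind (a ≟ x)) * f x) ≡⟨ ∑-+ _ _ ⟩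
    ∑ (λ x → ind (a ≟ x) * f x) + others                   ≡⟨ cong (_+ others) (∑-δ a f) ⟩
    f a + others                                           ∎
    where
    open ≡-Reasoning
    others = ∑ (λ x → (1ℤ - ind (a ≟ x)) * f x)
    split : ∀ d y → y ≡ d * y + (1ℤ - d) * y
    split = solve-∀

  term≤∑ : ∀ {f : A → ℤ} → (∀ x → 0ℤ ≤ f x) → ∀ a → f a ≤ ∑ f
  term≤∑ {f} 0≤f a = ≤-from (∑-nonneg {f = λ x → (1ℤ - ind (a ≟ x)) * f x}
      (λ x → 0≤* (gap (⟦⟧≤1 (does (a ≟ x)))) (0≤f x)))
    (trans (cancel (f a) _) (cong (_- f a) (sym (∑-pick a f))))
    where
    cancel : ∀ y z → z ≡ y + z - y
    cancel = solve-∀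

  ∑-vanish : ∀ {f : A → ℤ} → (∀ x → 0ℤ ≤ f x) → ∑ f ≤ 0ℤ → ∀ a → f a ≡ 0ℤ
  ∑-vanish 0≤f ∑≤0 a = ℤ.≤-antisym (ℤ.≤-trans (term≤∑ 0≤f a) ∑≤0) (0≤f a)

-- Both sides equal the sum of h over all pairs (a , f a).
∑-reindex : ⦃ _ : Enum A ⦄ ⦃ _ : Enum B ⦄ (p : A → Bool) (q : B → Bool) (f : A → B) (g : B → A) →
  (∀ a → p a ≡ true → q (f a) ≡ true) → (∀ b → q b ≡ true → p (g b) ≡ true) →
  (∀ a → p a ≡ true → g (f a) ≡ a) → (∀ b → q b ≡ true → f (g b) ≡ b) →
  ∀ h → ∑ (λ a → ⟦ p a ⟧ * h (f a)) ≡ ∑ (λ b → ⟦ q b ⟧ * h b)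
∑-reindex ⦃ EA ⦄ ⦃ EB ⦄ p q f g pq qp gf fg h = begin
  ∑ (λ a → ⟦ p a ⟧ * h (f a))
    ≡⟨ ∑-cong (λ a → cong (⟦ p a ⟧ *_) (sym (∑-δ (f a) h))) ⟩
  ∑ (λ a → ⟦ p a ⟧ * ∑ (λ b → ind (f a ≟ b) * h b))
    ≡⟨ ∑-cong (λ a → sym (∑-* ⟦ p a ⟧ _)) ⟩
  ∑ (λ a → ∑ (λ b → ⟦ p a ⟧ * (ind (f a ≟ b) * h b)))
    ≡⟨ ∑-swap _ ⟩
  ∑ (λ b → ∑ (λ a → ⟦ p a ⟧ * (ind (f a ≟ b) * h b)))
    ≡⟨ ∑-cong (λ b → trans (∑-cong (λ a → flip-ind a b)) (∑-δ (g b) (λ _ → ⟦ q b ⟧ * h b))) ⟩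
  ∑ (λ b → ⟦ q b ⟧ * h b) ∎
  where
  open ≡-Reasoning
  flip-ind : ∀ a b → ⟦ p a ⟧ * (ind (f a ≟ b) * h b) ≡ ind (g b ≟ a) * (⟦ q b ⟧ * h b)
  flip-ind a b = ind-exchange (p a) (q b) (f a ≟ b) (g b ≟ a) (h b)
    (λ { pa refl → pq a pa , gf a pa }) (λ { qb refl → qp b qb , fg b qb })

private
  fins : ∀ n → List (Fin n)
  fins zero    = []
  fins (suc n) = zero ∷ map suc (fins n)

  fins-once : (a : Fin n) → ∑ᴸ (fins n) (λ x → ind (a Fin.≟ x)) ≡ 1ℤ
  fins-once {suc n} zero    = cong (1ℤ +_) (trans (∑ᴸ-map suc (fins n) _) (∑ᴸ-0 (fins n)))
  fins-once {suc n} (suc a) = trans (ℤ.+-identityˡ _) (trans (∑ᴸ-map suc (fins n) _) (fins-once a))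

  subsets : ∀ n → List (Subset n)
  subsets zero    = [] ∷ []
  subsets (suc n) = map (false ∷_) (subsets n) ++ map (true ∷_) (subsets n)

  ≡-subset? : DecidableEquality (Subset n)
  ≡-subset? = Vec.≡-dec Bool._≟_

  subsets-once : (a : Subset n) → ∑ᴸ (subsets n) (λ x → ind (≡-subset? a x)) ≡ 1ℤ
  subsets-once []      = refl
  subsets-once {suc n} (b ∷ a) = begin
    ∑ᴸ (subsets (suc n)) (λ x → ind (≡-subset? (b ∷ a) x))
      ≡⟨ ∑ᴸ-++ (map (false ∷_) (subsets n)) _ _ ⟩
    _ ≡⟨ cong₂ _+_ (∑ᴸ-map (false ∷_) (subsets n) _) (∑ᴸ-map (true ∷_) (subsets n) _) ⟩
    ∑ᴸ (subsets n) (λ x → ind (≡-subset? (b ∷ a) (false ∷ x))) +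
    ∑ᴸ (subsets n) (λ x → ind (≡-subset? (b ∷ a) (true ∷ x)))
      ≡⟨ halves b ⟩
    1ℤ ∎
    where
    open ≡-Reasoning
    halves : ∀ b → ∑ᴸ (subsets n) (λ x → ind (≡-subset? (b ∷ a) (false ∷ x))) +
      ∑ᴸ (subsets n) (λ x → ind (≡-subset? (b ∷ a) (true ∷ x))) ≡ 1ℤ
    halves true  = cong₂ _+_ (∑ᴸ-0 (subsets n)) (subsets-once a)
    halves false = cong₂ _+_ (subsets-once a) (∑ᴸ-0 (subsets n))

instance
  Fin-enum : Enum (Fin n)
  Fin-enum = record { elems = fins _ ; _≟_ = Fin._≟_ ; once = fins-once }

  Subset-enum : Enum (Subset n)
  Subset-enum = record { elems = subsets _ ; _≟_ = ≡-subset? ; once = subsets-once }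

abstract

  ∑-empty : ∀ (f : Fin 0 → ℤ) → ∑ f ≡ 0ℤ
  ∑-empty f = refl

  ∑-single : ∀ (f : Subset 0 → ℤ) → ∑ f ≡ f []
  ∑-single f = ℤ.+-identityʳ (f [])

  ∑-suc : ∀ (f : Fin (suc n) → ℤ) → ∑ f ≡ f zero + ∑ (f ∘ suc)
  ∑-suc f = cong (f zero +_) (∑ᴸ-map suc (fins _) f)

  ∑-subset-suc : ∀ (f : Subset (suc n) → ℤ) → ∑ f ≡ ∑ (f ∘ (false ∷_)) + ∑ (f ∘ (true ∷_))
  ∑-subset-suc {n} f = trans (∑ᴸ-++ (map (false ∷_) (subsets n)) _ f)
    (cong₂ _+_ (∑ᴸ-map (false ∷_) (subsets n) f) (∑ᴸ-map (true ∷_) (subsets n) f))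

∑-1 : ∀ n → ∑ {Fin n} (λ _ → 1ℤ) ≡ pos n
∑-1 zero    = ∑-empty _
∑-1 (suc n) = trans (∑-suc {n} (λ _ → 1ℤ)) (cong (1ℤ +_) (∑-1 n))

uip : ∀ {A : Set} {x y : A} (p q : x ≡ y) → p ≡ q
uip refl refl = refl

true≢false : true ≡ false → ⊥
true≢false ()

¬true : ∀ {b} → ¬ b ≡ true → b ≡ false
¬true {true}  ¬b = ⊥-elim (¬b refl)
¬true {false} ¬b = refl

not-false : ∀ {b} → not b ≡ false → b ≡ true
not-false {true} _ = refl

not-true : ∀ {b} → not b ≡ true → b ≡ false
not-true {false} _ = refl

∧-true : ∀ {a b} → a ∧ b ≡ true → a ≡ true × b ≡ true
∧-true {true} {true} _ = refl , refl

does-true : ∀ {P : Set} (P? : Dec P) → does P? ≡ true → P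
does-true (yes p) _ = p

true-does : ∀ {P : Set} (P? : Dec P) → P → does P? ≡ true
true-does (yes _) _ = refl
true-does (no ¬p) p = ⊥-elim (¬p p)

-- Subsets

-- Membership and cardinality are sealed so that Agda can infer sets from them.
abstract

  mem : Subset n → Fin n → Bool
  mem = lookup

  mem≡lookup : ∀ (S : Subset n) v → mem S v ≡ lookup S v
  mem≡lookup S v = refl

  ∣_∣ : Subset n → ℕ
  ∣_∣ = size

  ∣∣≡size : ∀ (S : Subset n) → ∣ S ∣ ≡ size S
  ∣∣≡size S = refl

infix 4 _∈_ _∉_ _⊆_
infixl 6 _⊕_ _⊖_

_∈_ _∉_ : Fin n → Subset n → Set
v ∈ S = mem S v ≡ true
v ∉ S = mem S v ≡ false

_⊆_ : Subset n → Subset n → Set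
R ⊆ S = ∀ v → v ∈ R → v ∈ S

∈-∉ : ∀ (S : Subset n) {v} → v ∈ S → v ∉ S → ⊥
∈-∉ S p q = true≢false (trans (sym p) q)

abstract

  _⊕_ _⊖_ : Subset n → Fin n → Subset n
  S ⊕ v = S [ v ]≔ true
  S ⊖ v = S [ v ]≔ false

  full none : Subset n
  full = replicate _ true
  none = replicate _ false

  collect : (Fin n → Bool) → Subset n
  collect = tabulate

  mem-collect : ∀ (p : Fin n → Bool) v → mem (collect p) v ≡ p v
  mem-collect p v = Vec.lookup∘tabulate p v

  subset-ext : ∀ {R S : Subset n} → (∀ v → mem R v ≡ mem S v) → R ≡ S
  subset-ext {R = R} {S} eq =
    trans (sym (Vec.tabulate∘lookup R)) (trans (Vec.tabulate-cong eq) (Vec.tabulate∘lookup S))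

  ⊕-self : ∀ (S : Subset n) v → v ∈ S ⊕ v
  ⊕-self S v = Vec.lookup∘update v S true

  ⊖-self : ∀ (S : Subset n) v → v ∉ S ⊖ v
  ⊖-self S v = Vec.lookup∘update v S false

  ⊕-other : ∀ (S : Subset n) {u v} → u ≢ v → mem (S ⊕ v) u ≡ mem S u
  ⊕-other S u≢v = Vec.lookup∘update′ u≢v S true

  ⊖-other : ∀ (S : Subset n) {u v} → u ≢ v → mem (S ⊖ v) u ≡ mem S u
  ⊖-other S u≢v = Vec.lookup∘update′ u≢v S false

  ∈-full : ∀ (v : Fin n) → v ∈ full
  ∈-full v = Vec.lookup-replicate v true

  ∉-none : ∀ (v : Fin n) → v ∉ none
  ∉-none v = Vec.lookup-replicate v false

  ∣none∣ : ∀ {n} → ∣ none {n} ∣ ≡ 0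
  ∣none∣ {zero}  = refl
  ∣none∣ {suc n} = ∣none∣ {n}

  ∣full∣ : ∀ {n} → ∣ full {n} ∣ ≡ n
  ∣full∣ {zero}  = refl
  ∣full∣ {suc n} = cong suc (∣full∣ {n})

  ⊕-⊖ : ∀ (S : Subset n) v → v ∉ S → S ⊕ v ⊖ v ≡ S
  ⊕-⊖ S v v∉S = trans (Vec.[]≔-idempotent S v)
    (trans (cong (S [ v ]≔_) (sym v∉S)) (Vec.[]≔-lookup S v))

  ⊖-⊕ : ∀ (S : Subset n) v → v ∈ S → S ⊖ v ⊕ v ≡ S
  ⊖-⊕ S v v∈S = trans (Vec.[]≔-idempotent S v)
    (trans (cong (S [ v ]≔_) (sym v∈S)) (Vec.[]≔-lookup S v))

  ∣⊕∣ : ∀ (S : Subset n) v → v ∉ S → ∣ S ⊕ v ∣ ≡ suc ∣ S ∣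
  ∣⊕∣ (false ∷ S) zero    _   = refl
  ∣⊕∣ (true  ∷ S) (suc v) v∉S = cong suc (∣⊕∣ S v v∉S)
  ∣⊕∣ (false ∷ S) (suc v) v∉S = ∣⊕∣ S v v∉S

  ∣∣≡∑ : ∀ (S : Subset n) → pos ∣ S ∣ ≡ ∑ (λ v → ⟦ mem S v ⟧)
  ∣∣≡∑ []          = sym (∑-empty (λ v → ⟦ lookup [] v ⟧))
  ∣∣≡∑ (true  ∷ S) = trans (cong (1ℤ +_) (∣∣≡∑ S)) (sym (∑-suc (λ v → ⟦ lookup (true ∷ S) v ⟧)))
  ∣∣≡∑ (false ∷ S) = trans (∣∣≡∑ S) (trans (sym (ℤ.+-identityˡ _)) (sym (∑-suc (λ v → ⟦ lookup (false ∷ S) v ⟧))))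

  mem-zero : ∀ b (S : Subset n) → mem (b ∷ S) zero ≡ b
  mem-zero b S = refl

  mem-suc : ∀ b (S : Subset n) v → mem (b ∷ S) (suc v) ≡ mem S v
  mem-suc b S v = refl

  ∣[]∣ : ∣ [] ∣ ≡ 0
  ∣[]∣ = refl

  ∣∷∣-true : ∀ (S : Subset n) → ∣ true ∷ S ∣ ≡ suc ∣ S ∣
  ∣∷∣-true S = refl

  ∣∷∣-false : ∀ (S : Subset n) → ∣ false ∷ S ∣ ≡ ∣ S ∣
  ∣∷∣-false S = refl

∣⊕∣-shift : ∀ (S : Subset n) {v d j} → v ∉ S → suc d ℕ.+ ∣ S ∣ ≡ j → d ℕ.+ ∣ S ⊕ v ∣ ≡ j
∣⊕∣-shift S {v} {d} v∉S eq = trans (cong (d ℕ.+_) (∣⊕∣ S v v∉S)) (trans (ℕ.+-suc d ∣ S ∣) eq)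

∣⊖∣ : ∀ (S : Subset n) v → v ∈ S → suc ∣ S ⊖ v ∣ ≡ ∣ S ∣
∣⊖∣ S v v∈S = trans (sym (∣⊕∣ (S ⊖ v) v (⊖-self S v))) (cong ∣_∣ (⊖-⊕ S v v∈S))

⊕-⊇ : ∀ (S : Subset n) v → S ⊆ S ⊕ v
⊕-⊇ S v u u∈S with u ≟ v
... | yes refl = ⊕-self S v
... | no  u≢v  = trans (⊕-other S u≢v) u∈S

⊕-⊆ : ∀ {R S : Subset n} {v} → R ⊆ S → v ∈ S → R ⊕ v ⊆ S
⊕-⊆ {R = R} {v = v} R⊆S v∈S u u∈ with u ≟ v
... | yes refl = v∈S
... | no  u≢v  = R⊆S u (trans (sym (⊕-other R u≢v)) u∈)

∈-single : ∀ {u v : Fin n} → v ∈ none ⊕ u → v ≡ u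
∈-single {u = u} {v} v∈ with v ≟ u
... | yes v≡u = v≡u
... | no  v≢u = ⊥-elim (∈-∉ none (trans (sym (⊕-other none v≢u)) v∈) (∉-none v))

∣single∣ : ∀ (v : Fin n) → ∣ none ⊕ v ∣ ≡ 1
∣single∣ {n} v = trans (∣⊕∣ none v (∉-none v)) (cong suc (∣none∣ {n}))

single-⊆ : ∀ {S : Subset n} {v} → v ∈ S → none ⊕ v ⊆ S
single-⊆ {S = S} v∈S u u∈ = subst (_∈ S) (sym (∈-single u∈)) v∈S

∈⊖⇒≢ : ∀ (S : Subset n) {u v} → u ∈ S ⊖ v → u ≢ v
∈⊖⇒≢ S p refl = ∈-∉ (S ⊖ _) p (⊖-self S _)

⊖-⊆ : ∀ (S : Subset n) v → S ⊖ v ⊆ S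
⊖-⊆ S v u p = trans (sym (⊖-other S (∈⊖⇒≢ S p))) p

∈-⊖ : ∀ (S : Subset n) {u v} → u ≢ v → u ∈ S → u ∈ S ⊖ v
∈-⊖ S u≢v p = trans (⊖-other S u≢v) p

#-complement : ∀ (S : Subset n) → ∑ (λ v → ⟦ not (mem S v) ⟧) ≡ pos n - pos ∣ S ∣
#-complement {n} S = begin
  ∑ (λ v → ⟦ not (mem S v) ⟧)      ≡⟨ ∑-cong (λ v → ⟦⟧-not (mem S v)) ⟩
  ∑ (λ v → 1ℤ - ⟦ mem S v ⟧)       ≡⟨ ∑-- (λ _ → 1ℤ) _ ⟩
  ∑ {Fin n} (λ _ → 1ℤ) - ∑ (λ v → ⟦ mem S v ⟧) ≡⟨ cong₂ _-_ (∑-1 n) (sym (∣∣≡∑ S)) ⟩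
  pos n - pos ∣ S ∣                   ∎
  where open ≡-Reasoning

-- Decks

-- The maps are total on `Fin n` and constrained only on `S` and `S′`, so that sums over all
-- vertices, weighted by membership, can be reindexed along them.
record Iso (G H : Graph n) (S S′ : Subset n) : Set where
  field
    to from   : Fin n → Fin n
    to-∈      : ∀ {v} → v ∈ S → to v ∈ S′
    from-∈    : ∀ {v} → v ∈ S′ → from v ∈ S
    from-to   : ∀ {v} → v ∈ S → from (to v) ≡ v
    to-from   : ∀ {v} → v ∈ S′ → to (from v) ≡ v
    to-adj    : ∀ {u v} → u ∈ S → v ∈ S → adj G u v ≡ adj H (to u) (to v)

  to-injective : ∀ {u v} → u ∈ S → v ∈ S → to u ≡ to v → u ≡ v
  to-injective u∈S v∈S eq = trans (sym (from-to u∈S)) (trans (cong from eq) (from-to v∈S))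

module _ {G H : Graph n} {S S′ : Subset n} where

  Iso-sym : Iso G H S S′ → Iso H G S′ S
  Iso-sym e = record
    { to = from ; from = to ; to-∈ = from-∈ ; from-∈ = to-∈ ; from-to = to-from ; to-from = from-to
    ; to-adj = λ u∈ v∈ → sym (trans (to-adj (from-∈ u∈) (from-∈ v∈)) (cong₂ (adj H) (to-from u∈) (to-from v∈))) }
    where open Iso e

  Iso-⊖ : (e : Iso G H S S′) → ∀ {v} → v ∈ S → Iso G H (S ⊖ v) (S′ ⊖ Iso.to e v)
  Iso-⊖ e {v} v∈S = record
    { to = to ; from = from
    ; to-∈ = λ u∈ → ∈-⊖ S′ (λ eq → ∈⊖⇒≢ S u∈ (to-injective (⊖-⊆ S v _ u∈) v∈S eq)) (to-∈ (⊖-⊆ S v _ u∈))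
    ; from-∈ = λ {u} u∈ → ∈-⊖ S (λ eq → ∈⊖⇒≢ S′ u∈ (trans (sym (to-from (⊖-⊆ S′ _ _ u∈))) (cong to eq)))
        (from-∈ (⊖-⊆ S′ _ _ u∈))
    ; from-to = λ u∈ → from-to (⊖-⊆ S v _ u∈)
    ; to-from = λ u∈ → to-from (⊖-⊆ S′ _ _ u∈)
    ; to-adj = λ p q → to-adj (⊖-⊆ S v _ p) (⊖-⊆ S v _ q) }
    where open Iso e

record Matching (k : ℕ) (G H : Graph n) : Set where
  field
    to from   : Subset n → Subset n
    to-size   : ∀ S → ∣ S ∣ ≡ k → ∣ to S ∣ ≡ k
    from-size : ∀ S → ∣ S ∣ ≡ k → ∣ from S ∣ ≡ k
    from-to   : ∀ S → ∣ S ∣ ≡ k → from (to S) ≡ S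
    to-from   : ∀ S → ∣ S ∣ ≡ k → to (from S) ≡ S
    iso       : ∀ S → ∣ S ∣ ≡ k → Iso G H S (to S)

Matching-sym : ∀ {k} {G H : Graph n} → Matching k G H → Matching k H G
Matching-sym m = record
  { to = from ; from = to ; to-size = from-size ; from-size = to-size ; from-to = to-from ; to-from = from-to
  ; iso = λ S p → Iso-sym (subst (Iso _ _ (from S)) (to-from S p) (iso (from S) (from-size S p))) }
  where open Matching m

-- Turns a map on a decidable subtype into a total one. The choice of `default` is immaterial, since
-- `Iso` and `Matching` say nothing outside the given set; `irr` makes the choice of membership
-- proof immaterial too.
module Extend {A : Set} {P : A → Set} (P? : ∀ a → Dec (P a)) (irr : ∀ {a} (p q : P a) → p ≡ q)
  {B : Set} (f : Σ[ a ∈ A ] P a → B) (default : A → B) where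

  extend : A → B
  extend a with P? a
  ... | yes p = f (a , p)
  ... | no  _ = default a

  extend-on : ∀ {a} (p : P a) → extend a ≡ f (a , p)
  extend-on {a} p with P? a
  ... | yes p′ = cong (λ q → f (a , q)) (irr p′ p)
  ... | no ¬p  = ⊥-elim (¬p p)

card-iso⇒Iso : ∀ {k} {G H : Graph n} (S S′ : KSubset n k) → card G S ≅ card H S′ → Iso G H (proj₁ S) (proj₁ S′)
card-iso⇒Iso {n} {G = G} {H} (S , _) (S′ , _) e = record
  { to = F.extend ; from = B.extend
  ; to-∈ = λ p → subst (_∈ S′) (sym (F.extend-on p)) (∈-of (I.to (_ , at p)))
  ; from-∈ = λ p → subst (_∈ S) (sym (B.extend-on p)) (∈-of (I.from (_ , at p)))
  ; from-to = λ {v} p → begin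
      B.extend (F.extend v)                       ≡⟨ cong B.extend (F.extend-on p) ⟩
      B.extend (proj₁ (I.to (v , at p)))         ≡⟨ B.extend-on (∈-of (I.to (v , at p))) ⟩
      proj₁ (I.from (_ , at (∈-of (I.to (v , at p))))) ≡⟨ cong (proj₁ ∘ I.from) (at-∈-of _) ⟩
      proj₁ (I.from (I.to (v , at p)))           ≡⟨ cong proj₁ (I.strictlyInverseʳ (v , at p)) ⟩
      v ∎
  ; to-from = λ {v} p → begin
      F.extend (B.extend v)                       ≡⟨ cong F.extend (B.extend-on p) ⟩
      F.extend (proj₁ (I.from (v , at p)))       ≡⟨ F.extend-on (∈-of (I.from (v , at p))) ⟩
      proj₁ (I.to (_ , at (∈-of (I.from (v , at p))))) ≡⟨ cong (proj₁ ∘ I.to) (at-∈-of _) ⟩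
      proj₁ (I.to (I.from (v , at p)))           ≡⟨ cong proj₁ (I.strictlyInverseˡ (v , at p)) ⟩
      v ∎
  ; to-adj = λ p q → trans (_≅_.preserves e (_ , at p) (_ , at q))
      (cong₂ (adj H) (sym (F.extend-on p)) (sym (F.extend-on q)))
  }
  where
  open ≡-Reasoning
  module I = Inverse (_≅_.vertices e)
  at : ∀ {R : Subset n} {v} → v ∈ R → R Vec.[ v ]= true
  at {R} {v} p = Vec.lookup⇒[]= v R (trans (sym (mem≡lookup R v)) p)
  ∈-of : ∀ {R : Subset n} → (x : Σ[ v ∈ Fin n ] R Vec.[ v ]= true) → proj₁ x ∈ R
  ∈-of (_ , p) = trans (mem≡lookup _ _) (Vec.[]=⇒lookup p)
  at-∈-of : ∀ {R : Subset n} (x : Σ[ v ∈ Fin n ] R Vec.[ v ]= true) → (proj₁ x , at (∈-of x)) ≡ x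
  at-∈-of (v , p) = cong (v ,_) (Vec.[]=-irrelevant _ p)
  forward : Σ[ v ∈ Fin n ] v ∈ S → Fin n
  forward (v , p) = proj₁ (I.to (v , at p))
  backward : Σ[ v ∈ Fin n ] v ∈ S′ → Fin n
  backward (v , p) = proj₁ (I.from (v , at p))
  module F = Extend (λ v → mem S v Bool.≟ true) uip forward (λ v → v)
  module B = Extend (λ v → mem S′ v Bool.≟ true) uip backward (λ v → v)

SameDeck⇒Matching : ∀ {k} {G H : Graph n} → SameDeck k G H → Matching k G H
SameDeck⇒Matching {n} {k} {G} {H} d = record
  { to = F.extend ; from = B.extend
  ; to-size = λ S p → trans (cong ∣_∣ (F.extend-on {S} p)) (sized (M.to (S , sz p)))
  ; from-size = λ S p → trans (cong ∣_∣ (B.extend-on {S} p)) (sized (M.from (S , sz p)))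
  ; from-to = λ S p → trans (cong B.extend (F.extend-on p))
      (trans (B.extend-on (sized (M.to (S , sz p))))
      (trans (cong (proj₁ ∘ M.from) (sz-sized (M.to (S , sz p)))) (cong proj₁ (M.strictlyInverseʳ (S , sz p)))))
  ; to-from = λ S p → trans (cong F.extend (B.extend-on p))
      (trans (F.extend-on (sized (M.from (S , sz p))))
      (trans (cong (proj₁ ∘ M.to) (sz-sized (M.from (S , sz p)))) (cong proj₁ (M.strictlyInverseˡ (S , sz p)))))
  ; iso = λ S p → subst (Iso G H S) (sym (F.extend-on p))
      (card-iso⇒Iso (S , sz p) (M.to (S , sz p)) (SameDeck.card-iso d (S , sz p)))
  }
  where
  module M = Inverse (SameDeck.matching d)
  sz : ∀ {S : Subset n} → ∣ S ∣ ≡ k → size S ≡ k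
  sz {S} p = trans (sym (∣∣≡size S)) p
  sized : (x : KSubset n k) → ∣ proj₁ x ∣ ≡ k
  sized (S , p) = trans (∣∣≡size S) p
  sz-sized : (x : KSubset n k) → (proj₁ x , sz (sized x)) ≡ x
  sz-sized (S , p) = cong (S ,_) (uip _ p)
  forward backward : Σ[ S ∈ Subset n ] ∣ S ∣ ≡ k → Subset n
  forward  (S , p) = proj₁ (M.to (S , sz p))
  backward (S , p) = proj₁ (M.from (S , sz p))
  module F = Extend (λ (S : Subset n) → ∣ S ∣ ℕ.≟ k) uip forward (λ S → S)
  module B = Extend (λ (S : Subset n) → ∣ S ∣ ℕ.≟ k) uip backward (λ S → S)

-- Kelly's lemma

∑[_] : ℕ → (Subset n → ℤ) → ℤ
∑[ j ] F = ∑ (λ S → ind (∣ S ∣ ℕ.≟ j) * F S)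

∑[]-cong : ∀ j {F F′ : Subset n → ℤ} → (∀ S → ∣ S ∣ ≡ j → F S ≡ F′ S) → ∑[ j ] F ≡ ∑[ j ] F′
∑[]-cong j eq = ∑-cong (λ S → *-congʳ-on (does (∣ S ∣ ℕ.≟ j)) (λ p → eq S (does-true (∣ S ∣ ℕ.≟ j) p)))

-- Pairs `v ∈ S` with `S` of size `suc j` correspond to pairs `v ∉ R` with `R` of size `j`, through
-- `S ⊖ v` and `R ⊕ v`.
∑[]-toggle : ∀ j (Q : Subset n → Fin n → ℤ) →
  ∑[ suc j ] (λ S → ∑ (λ v → ⟦ mem S v ⟧ * Q (S ⊖ v) v)) ≡
  ∑[ j ] (λ R → ∑ (λ v → ⟦ not (mem R v) ⟧ * Q R v))
∑[]-toggle {n} j Q = begin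
  ∑[ suc j ] (λ S → ∑ (λ v → ⟦ mem S v ⟧ * Q (S ⊖ v) v))
    ≡⟨ ∑-cong (λ S → trans (sym (∑-* (ind (∣ S ∣ ℕ.≟ suc j)) (λ v → ⟦ mem S v ⟧ * Q (S ⊖ v) v)))
         (∑-cong (λ v → merge (does (∣ S ∣ ℕ.≟ suc j)) (mem S v) (Q (S ⊖ v) v)))) ⟩
  ∑ (λ S → ∑ (λ v → ⟦ p v S ⟧ * Q (S ⊖ v) v))
    ≡⟨ ∑-swap (λ S v → ⟦ p v S ⟧ * Q (S ⊖ v) v) ⟩
  ∑ (λ v → ∑ (λ S → ⟦ p v S ⟧ * Q (S ⊖ v) v))
    ≡⟨ ∑-cong (λ v → ∑-reindex (p v) (q v) (_⊖ v) (_⊕ v) (pq v) (qp v)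
         (λ S pS → ⊖-⊕ S v (proj₂ (∧-true {does (∣ S ∣ ℕ.≟ suc j)} pS)))
             (λ R qR → ⊕-⊖ R v (not-true (proj₂ (∧-true {does (∣ R ∣ ℕ.≟ j)} qR))))
         (λ R → Q R v)) ⟩
  ∑ (λ v → ∑ (λ R → ⟦ q v R ⟧ * Q R v))
    ≡⟨ ∑-swap (λ v R → ⟦ q v R ⟧ * Q R v) ⟩
  ∑ (λ R → ∑ (λ v → ⟦ q v R ⟧ * Q R v))
    ≡⟨ ∑-cong (λ R → trans (∑-cong (λ v → sym (merge (does (∣ R ∣ ℕ.≟ j)) (not (mem R v)) (Q R v))))
         (∑-* (ind (∣ R ∣ ℕ.≟ j)) (λ v → ⟦ not (mem R v) ⟧ * Q R v))) ⟩
  ∑[ j ] (λ R → ∑ (λ v → ⟦ not (mem R v) ⟧ * Q R v)) ∎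
  where
  open ≡-Reasoning
  p q : Fin n → Subset n → Bool
  p v S = does (∣ S ∣ ℕ.≟ suc j) ∧ mem S v
  q v R = does (∣ R ∣ ℕ.≟ j) ∧ not (mem R v)
  merge : ∀ a b z → ⟦ a ⟧ * (⟦ b ⟧ * z) ≡ ⟦ a ∧ b ⟧ * z
  merge a b z = trans (sym (ℤ.*-assoc ⟦ a ⟧ ⟦ b ⟧ z)) (cong (_* z) (sym (⟦⟧-∧ a b)))
  pq : ∀ v S → p v S ≡ true → q v (S ⊖ v) ≡ true
  pq v S pS with ∧-true {does (∣ S ∣ ℕ.≟ suc j)} pS
  ... | s , v∈S = cong₂ _∧_
    (true-does (∣ S ⊖ v ∣ ℕ.≟ j) (ℕ.suc-injective (trans (∣⊖∣ S v v∈S) (does-true (∣ S ∣ ℕ.≟ suc j) s))))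
    (cong not (⊖-self S v))
  qp : ∀ v R → q v R ≡ true → p v (R ⊕ v) ≡ true
  qp v R qR with ∧-true {does (∣ R ∣ ℕ.≟ j)} qR
  ... | s , v∉R = cong₂ _∧_
    (true-does (∣ R ⊕ v ∣ ℕ.≟ suc j) (trans (∣⊕∣ R v (not-true v∉R)) (cong suc (does-true (∣ R ∣ ℕ.≟ j) s))))
    (⊕-self R v)

Invariant : (Graph n → Subset n → ℤ) → Set
Invariant {n} F = ∀ {G H : Graph n} {S S′} → Iso G H S S′ → F G S ≡ F H S′

-- A statistic of a set together with one vertex outside it, read off from the card spanned by both.
-- The vertex is the distinguished one of that card.
PointedInvariant : (Graph n → Subset n → Fin n → ℤ) → Set
PointedInvariant {n} Q = ∀ {G H : Graph n} {S S′} (e : Iso G H S S′) {v} → v ∈ S →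
  Q G (S ⊖ v) v ≡ Q H (S′ ⊖ Iso.to e v) (Iso.to e v)

∑-Iso : ∀ {G H : Graph n} {S S′} (e : Iso G H S S′) {g h : Fin n → ℤ} → (∀ {v} → v ∈ S → g v ≡ h (Iso.to e v)) →
  ∑ (λ v → ⟦ mem S v ⟧ * g v) ≡ ∑ (λ v → ⟦ mem S′ v ⟧ * h v)
∑-Iso {S = S} {S′} e {g} {h} eq = trans (∑-cong (λ v → *-congʳ-on (mem S v) eq))
  (∑-reindex (mem S) (mem S′) to from (λ _ → to-∈) (λ _ → from-∈) (λ _ → from-to) (λ _ → to-from) h)
  where open Iso e

pointed-sum : ∀ {Q : Graph n → Subset n → Fin n → ℤ} → PointedInvariant Q →
  Invariant (λ G S → ∑ (λ v → ⟦ mem S v ⟧ * Q G (S ⊖ v) v))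
pointed-sum Q-inv e = ∑-Iso e (Q-inv e)

module _ {k : ℕ} {G H : Graph n} (m : Matching k G H) where

  private
    top : ∀ {F} → Invariant F → ∑[ k ] (F G) ≡ ∑[ k ] (F H)
    top {F} inv = trans
      (∑[]-cong k (λ S p → inv (Matching.iso m S p)))
      (∑-reindex sz sz to from (λ S p → true-does (∣ to S ∣ ℕ.≟ k) (to-size S (has-size S p)))
        (λ S p → true-does (∣ from S ∣ ℕ.≟ k) (from-size S (has-size S p)))
        (λ S p → from-to S (has-size S p)) (λ S p → to-from S (has-size S p)) (F H))
      where
      open Matching m
      sz : Subset n → Bool
      sz S = does (∣ S ∣ ℕ.≟ k)
      has-size : ∀ S → sz S ≡ true → ∣ S ∣ ≡ k
      has-size S p = does-true (∣ S ∣ ℕ.≟ k) p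

    -- Every `j`-set lies in n - j sets of size `suc j`. So n - j times the sum over `j`-sets is a
    -- sum over `suc j`-sets of another invariant, and the induction on the distance `d` to `k` ends
    -- at the cards themselves.
    descend : k ℕ.≤ n → ∀ {F} → Invariant F → ∀ d j → d ℕ.+ j ≡ k → ∑[ j ] (F G) ≡ ∑[ j ] (F H)
    descend k≤n {F} inv zero    j refl = top inv
    -- The factor is n - j, written as a successor so that it can be cancelled.
    descend k≤n {F} inv (suc d) j eq   = ℤ.*-cancelˡ-≡ (pos (suc (n ∸ suc j))) _ _
      (trans (sym (scaled G)) (trans (descend k≤n (pointed-sum {Q = λ X R _ → F X R} F-pointed) d (suc j)
          (trans (ℕ.+-suc d j) eq)) (scaled H)))
      where
      open ≡-Reasoning
      F-pointed : PointedInvariant (λ G R _ → F G R)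
      F-pointed e v∈S = inv (Iso-⊖ e v∈S)
      j<n : suc j ℕ.≤ n
      j<n = ℕ.≤-trans (subst (suc j ℕ.≤_) eq (s≤s (ℕ.m≤n+m j d))) k≤n
      remaining : pos n - pos j ≡ pos (suc (n ∸ suc j))
      remaining = trans (cong (λ x → pos x - pos j) (sym (ℕ.m+[n∸m]≡n j<n))) (cancel (pos j) (pos (n ∸ suc j)))
        where
        cancel : ∀ x y → 1ℤ + (x + y) - x ≡ 1ℤ + y
        cancel = solve-∀
      scaled : ∀ X → ∑[ suc j ] (λ S → ∑ (λ v → ⟦ mem S v ⟧ * F X (S ⊖ v))) ≡ pos (suc (n ∸ suc j)) * ∑[ j ] (F X)
      scaled X = begin
        ∑[ suc j ] (λ S → ∑ (λ v → ⟦ mem S v ⟧ * F X (S ⊖ v)))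
          ≡⟨ ∑[]-toggle j (λ R _ → F X R) ⟩
        ∑[ j ] (λ R → ∑ (λ v → ⟦ not (mem R v) ⟧ * F X R))
          ≡⟨ ∑[]-cong j (λ R p → trans (∑-*ʳ (λ v → ⟦ not (mem R v) ⟧) (F X R))
               (cong (_* F X R) (trans (#-complement R) (trans (cong (λ x → pos n - pos x) p) remaining)))) ⟩
        ∑[ j ] (λ R → pos (suc (n ∸ suc j)) * F X R)
          ≡⟨ ∑-cong (λ R → commute (ind (∣ R ∣ ℕ.≟ j)) (pos (suc (n ∸ suc j))) (F X R)) ⟩
        ∑ (λ R → pos (suc (n ∸ suc j)) * (ind (∣ R ∣ ℕ.≟ j) * F X R))
          ≡⟨ ∑-* (pos (suc (n ∸ suc j))) (λ R → ind (∣ R ∣ ℕ.≟ j) * F X R) ⟩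
        pos (suc (n ∸ suc j)) * ∑[ j ] (F X) ∎
        where
        commute : ∀ x y z → x * (y * z) ≡ y * (x * z)
        commute = solve-∀

  kelly : k ℕ.≤ n → ∀ {F} → Invariant F → ∀ {j} → j ℕ.≤ k → ∑[ j ] (F G) ≡ ∑[ j ] (F H)
  kelly k≤n inv {j} j≤k = descend k≤n inv (k ∸ j) j (ℕ.m∸n+n≡m j≤k)

  -- The set and the outside vertex together occupy `suc j` vertices, which is why `suc j`, not `j`,
  -- is bounded by `k`.
  kelly-pointed : k ℕ.≤ n → ∀ {Q : Graph n → Subset n → Fin n → ℤ} → PointedInvariant Q → ∀ {j} → suc j ℕ.≤ k →
    ∑[ j ] (λ R → ∑ (λ v → ⟦ not (mem R v) ⟧ * Q G R v)) ≡ ∑[ j ] (λ R → ∑ (λ v → ⟦ not (mem R v) ⟧ * Q H R v))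
  kelly-pointed k≤n {Q} Q-inv {j} j<k =
    trans (sym (∑[]-toggle j (Q G))) (trans (kelly k≤n (pointed-sum {Q = Q} Q-inv) j<k) (∑[]-toggle j (Q H)))

∑[]-nonneg : ∀ j {F : Subset n → ℤ} → (∀ R → ∣ R ∣ ≡ j → 0ℤ ≤ F R) → 0ℤ ≤ ∑[ j ] F
∑[]-nonneg j {F} 0≤F = ∑-nonneg (λ R → subst (_≤ ind (∣ R ∣ ℕ.≟ j) * F R) (ℤ.*-zeroʳ (ind (∣ R ∣ ℕ.≟ j)))
  (*-monoʳ-on (does (∣ R ∣ ℕ.≟ j)) {0ℤ} {F R} (λ p → 0≤F R (does-true (∣ R ∣ ℕ.≟ j) p))))

∑[]-vanish : ∀ j {F : Subset n → ℤ} → (∀ R → ∣ R ∣ ≡ j → 0ℤ ≤ F R) → ∑[ j ] F ≤ 0ℤ → ∀ R → ∣ R ∣ ≡ j → F R ≡ 0ℤ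
∑[]-vanish j {F} 0≤F ∑≤0 R sz = begin
  F R                          ≡⟨ sym (ℤ.*-identityˡ (F R)) ⟩
  1ℤ * F R                     ≡⟨ cong (_* F R) (sym (ind-yes (∣ R ∣ ℕ.≟ j) sz)) ⟩
  ind (∣ R ∣ ℕ.≟ j) * F R      ≡⟨ ∑-vanish (λ S → subst (_≤ ind (∣ S ∣ ℕ.≟ j) * F S) (ℤ.*-zeroʳ (ind (∣ S ∣ ℕ.≟ j)))
                                    (*-monoʳ-on (does (∣ S ∣ ℕ.≟ j)) {0ℤ} {F S}
                                        (λ p → 0≤F S (does-true (∣ S ∣ ℕ.≟ j) p)))) ∑≤0 R ⟩
  0ℤ                           ∎
  where open ≡-Reasoning

-- Inclusion and cardinality

∈? : ∀ (v : Fin n) S → Dec (v ∈ S)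
∈? v S = mem S v Bool.≟ true

∉? : ∀ (v : Fin n) S → Dec (v ∉ S)
∉? v S = mem S v Bool.≟ false

¬∈⇒∉ : ∀ {v : Fin n} S → ¬ v ∈ S → v ∉ S
¬∈⇒∉ S = ¬true

¬∉⇒∈ : ∀ {v : Fin n} S → ¬ v ∉ S → v ∈ S
¬∉⇒∈ {v = v} S ¬p with mem S v
... | true  = refl
... | false = ⊥-elim (¬p refl)

⊆-size : ∀ {R S : Subset n} → R ⊆ S → ∣ R ∣ ℕ.≤ ∣ S ∣
⊆-size {R = R} {S} R⊆S = ℤ.drop‿+≤+ (subst₂ _≤_ (sym (∣∣≡∑ R)) (sym (∣∣≡∑ S)) (∑-mono le))
  where
  le : ∀ v → ⟦ mem R v ⟧ ≤ ⟦ mem S v ⟧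
  le v with mem R v in eq
  ... | true  rewrite R⊆S v eq = ℤ.≤-refl
  ... | false = 0≤⟦⟧ (mem S v)

size≤n : ∀ (S : Subset n) → ∣ S ∣ ℕ.≤ n
size≤n S = subst (∣ S ∣ ℕ.≤_) ∣full∣ (⊆-size {R = S} (λ v _ → ∈-full v))

∃-outside : ∀ (R S : Subset n) → ∣ R ∣ ℕ.< ∣ S ∣ → ∃ λ v → v ∈ S × v ∉ R
∃-outside R S lt with Fin.any? (λ v → ∈? v S ×-dec ∉? v R)
... | yes p = p
... | no ¬p = ⊥-elim (ℕ.<⇒≱ lt (⊆-size {R = S} (λ v v∈S → ¬∉⇒∈ R (λ v∉R → ¬p (v , v∈S , v∉R)))))

⊆-antisym-size : ∀ {R S : Subset n} → R ⊆ S → ∣ S ∣ ℕ.≤ ∣ R ∣ → S ⊆ R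
⊆-antisym-size {R = R} {S} R⊆S le v v∈S = ¬∉⇒∈ R λ v∉R →
  ℕ.<⇒≱ (lt v∉R) le
  where
  lt : v ∉ R → suc ∣ R ∣ ℕ.≤ ∣ S ∣
  lt v∉R = subst (ℕ._≤ ∣ S ∣) (∣⊕∣ R v v∉R) (⊆-size {R = R ⊕ v} (⊕-⊆ R⊆S v∈S))

⊆-antisym : ∀ {R S : Subset n} → R ⊆ S → S ⊆ R → R ≡ S
⊆-antisym {R = R} {S} f g = subset-ext eq
  where
  eq : ∀ v → mem R v ≡ mem S v
  eq v with mem R v in r | mem S v in s
  ... | true  | true  = refl
  ... | false | false = refl
  ... | true  | false = ⊥-elim (∈-∉ S (f v r) s)
  ... | false | true  = ⊥-elim (∈-∉ R (g v s) r)

-- Connected vertex sets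

module _ (G : Graph n) where

  NoEdge : Subset n → Subset n → Set
  NoEdge S B = ∀ u v → u ∈ S → u ∈ B → v ∈ S → v ∉ B → adj G u v ≡ false

  Disconnects : Subset n → Subset n → Set
  Disconnects S B = (∃ λ u → u ∈ S × u ∈ B) × (∃ λ v → v ∈ S × v ∉ B) × NoEdge S B

  Disconn : Subset n → Set
  Disconn S = ∃ (Disconnects S)

  -- Phrased through separations instead of walks: failure of connectedness hands over a separating
  -- set, and deciding it is a finite search. The empty set counts as connected.
  Conn : Subset n → Set
  Conn S = ¬ Disconn S

  abstract

    disconn? : ∀ S → Dec (Disconn S)
    disconn? S = anySubset? λ B →
      Fin.any? (λ u → ∈? u S ×-dec ∈? u B) ×-dec
      (Fin.any? (λ v → ∈? v S ×-dec ∉? v B) ×-dec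
      Fin.all? (λ u → Fin.all? (λ v →
        ∈? u S →-dec (∈? u B →-dec (∈? v S →-dec (∉? v B →-dec (adj G u v Bool.≟ false)))))))

    conn? : ∀ S → Dec (Conn S)
    conn? S = ¬? (disconn? S)

  Closed : Subset n → Set
  Closed C = ∀ u v → u ∈ C → v ∉ C → adj G u v ≡ false

module _ {G : Graph n} where

  ¬conn⇒disconn : ∀ {S} → ¬ Conn G S → Disconn G S
  ¬conn⇒disconn {S} = decidable-stable (disconn? G S)

  crossing : ∀ {S} → Conn G S → ∀ B {u v} → u ∈ S → u ∈ B → v ∈ S → v ∉ B →
    ∃₂ λ p q → (p ∈ S × p ∈ B) × (q ∈ S × q ∉ B) × adj G p q ≡ true
  crossing {S} c B {u} {v} u∈S u∈B v∈S v∉B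
    with Fin.any? (λ p → Fin.any? (λ q → (∈? p S ×-dec ∈? p B) ×-dec
        ((∈? q S ×-dec ∉? q B) ×-dec (adj G p q Bool.≟ true))))
  ... | yes e = e
  ... | no ¬e = ⊥-elim (c (B , (u , u∈S , u∈B) , (v , v∈S , v∉B) ,
    λ p q p∈S p∈B q∈S q∉B → ¬true (λ pq → ¬e (p , q , (p∈S , p∈B) , (q∈S , q∉B) , pq))))

  -- By complementing, only separations with the given vertex w on the inner side
  -- have to be excluded.
  conn-from : ∀ {S w} → w ∈ S → (∀ B y → w ∈ B → y ∈ S → y ∉ B → NoEdge G S B → ⊥) → Conn G S
  conn-from {S} {w} w∈S excl (B , (u , u∈S , u∈B) , (v , v∈S , v∉B) , sep) with ∈? w B
  ... | yes w∈B = excl B v w∈B v∈S v∉B sep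
  ... | no  w∉B = excl B′ u (trans (mem-collect (not ∘ mem B) w) (cong not (¬true w∉B))) u∈S
        (trans (mem-collect (not ∘ mem B) u) (cong not u∈B)) sep′
    where
    B′ = collect (not ∘ mem B)
    sep′ : NoEdge G S B′
    sep′ p q p∈S p∈B′ q∈S q∉B′ = trans (adj-sym G p q) (sep q p q∈S
      (not-false (trans (sym (mem-collect (not ∘ mem B) q)) q∉B′)) p∈S
      (not-true (trans (sym (mem-collect (not ∘ mem B) p)) p∈B′)))

  conn-single : ∀ u → Conn G (none ⊕ u)
  conn-single u = conn-from (⊕-self none u) λ B y u∈B y∈S y∉B _ → ∈-∉ B u∈B (subst (_∉ B) (∈-single y∈S) y∉B)

  conn-⊕ : ∀ {S u} → Conn G S → u ∈ S → ∀ v → adj G u v ≡ true → Conn G (S ⊕ v)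
  conn-⊕ {S} {u} c u∈S v uv = conn-from (⊕-⊇ S v u u∈S) excl
    where
    excl : ∀ B y → u ∈ B → y ∈ S ⊕ v → y ∉ B → NoEdge G (S ⊕ v) B → ⊥
    excl B y u∈B y∈ y∉B sep with y ≟ v
    ... | yes refl = true≢false (trans (sym uv) (sep u y (⊕-⊇ S v u u∈S) u∈B (⊕-self S v) y∉B))
    ... | no  y≢v  = c (B , (u , u∈S , u∈B) , (y , trans (sym (⊕-other S y≢v)) y∈ , y∉B) ,
          λ p q p∈S p∈B q∈S q∉B → sep p q (⊕-⊇ S v p p∈S) p∈B (⊕-⊇ S v q q∈S) q∉B)

  conn-∪ : ∀ {R S U : Subset n} {w} → Conn G R → Conn G S → w ∈ R → w ∈ S →
    R ⊆ U → S ⊆ U → (∀ x → x ∈ U → x ∈ R ⊎ x ∈ S) → Conn G U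
  conn-∪ {R} {S} {U} {w} cR cS w∈R w∈S R⊆U S⊆U cover = conn-from (R⊆U w w∈R) excl
    where
    excl : ∀ B y → w ∈ B → y ∈ U → y ∉ B → NoEdge G U B → ⊥
    excl B y w∈B y∈U y∉B sep with cover y y∈U
    ... | inj₁ y∈R = cR (B , (w , w∈R , w∈B) , (y , y∈R , y∉B) ,
          λ p q p∈ p∈B q∈ q∉B → sep p q (R⊆U p p∈) p∈B (R⊆U q q∈) q∉B)
    ... | inj₂ y∈S = cS (B , (w , w∈S , w∈B) , (y , y∈S , y∉B) ,
          λ p q p∈ p∈B q∈ q∉B → sep p q (S⊆U p p∈) p∈B (S⊆U q q∈) q∉B)

  conn-star : ∀ {S p} → p ∈ S → (∀ v → v ∈ S → v ≢ p → adj G p v ≡ true) → Conn G S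
  conn-star {S} {p} p∈S near = conn-from p∈S λ B y p∈B y∈S y∉B sep →
    true≢false (trans (sym (near y y∈S (λ { refl → ∈-∉ B p∈B y∉B }))) (sep p y p∈S p∈B y∈S y∉B))

  -- While `A` is smaller than `S`, some edge inside `S` leaves it, and the far end of that edge is
  -- added; `d` counts the vertices still to come. This supplies connected sets of any prescribed
  -- size.
  grow : ∀ {S} → Conn G S → ∀ {A u} → A ⊆ S → Conn G A → u ∈ A → ∀ {j} → ∣ A ∣ ℕ.≤ j → j ℕ.≤ ∣ S ∣ →
    ∃ λ A′ → A ⊆ A′ × A′ ⊆ S × Conn G A′ × ∣ A′ ∣ ≡ j
  grow {S} cS {A} A⊆S cA u∈A {j} A≤j j≤S = go (j ∸ ∣ A ∣) A⊆S cA u∈A (ℕ.m∸n+n≡m A≤j)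
    where
    go : ∀ d {A u} → A ⊆ S → Conn G A → u ∈ A → d ℕ.+ ∣ A ∣ ≡ j →
      ∃ λ A′ → A ⊆ A′ × A′ ⊆ S × Conn G A′ × ∣ A′ ∣ ≡ j
    go zero    {A} A⊆S cA u∈A eq = A , (λ _ p → p) , A⊆S , cA , eq
    go (suc d) {A} {u} A⊆S cA u∈A eq
      with ∃-outside A S (ℕ.≤-trans (subst (suc ∣ A ∣ ℕ.≤_) eq (s≤s (ℕ.m≤n+m ∣ A ∣ d))) j≤S)
    ... | v , v∈S , v∉A with crossing cS A (A⊆S u u∈A) u∈A v∈S v∉A
    ... | p , q , (p∈S , p∈A) , (q∈S , q∉A) , pq
      with go d {A ⊕ q} (⊕-⊆ A⊆S q∈S) (conn-⊕ cA p∈A q pq) (⊕-self A q) (∣⊕∣-shift A q∉A eq)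
    ... | A′ , A⊆A′ , rest = A′ , (λ x x∈A → A⊆A′ x (⊕-⊇ A q x x∈A)) , rest

  -- Far ends of edges leaving `S` are added until no edge leaves; `d` is the number of vertices
  -- outside, so the process stops.
  component : ∀ {S u} → Conn G S → u ∈ S → ∃ λ C → S ⊆ C × Conn G C × Closed G C
  component {S} cS u∈S = go (n ∸ ∣ S ∣) cS u∈S (ℕ.m∸n+n≡m (size≤n S))
    where
    go : ∀ d {S u} → Conn G S → u ∈ S → d ℕ.+ ∣ S ∣ ≡ n → ∃ λ C → S ⊆ C × Conn G C × Closed G C
    go d {S} {u} cS u∈S eq
      with Fin.any? (λ p → Fin.any? (λ q → ∈? p S ×-dec (∉? q S ×-dec (adj G p q Bool.≟ true))))
    ... | no ¬e = S , (λ _ p → p) , cS , λ p q p∈S q∉S → ¬true (λ pq → ¬e (p , q , p∈S , q∉S , pq))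
    go zero {S} cS u∈S eq | yes (p , q , p∈S , q∉S , pq) =
      ⊥-elim (ℕ.<⇒≱ (ℕ.≤-reflexive (trans (cong suc (sym eq)) (sym (∣⊕∣ S q q∉S)))) (size≤n (S ⊕ q)))
    go (suc d) {S} cS u∈S eq | yes (p , q , p∈S , q∉S , pq)
      with go d {S ⊕ q} (conn-⊕ cS p∈S q pq) (⊕-self S q) (∣⊕∣-shift S q∉S eq)
    ... | C , S⊆C , rest = C , (λ x x∈S → S⊆C x (⊕-⊇ S q x x∈S)) , rest

  conn⊆closed : ∀ {S C} → Conn G S → Closed G C → ∀ {u} → u ∈ S → u ∈ C → S ⊆ C
  conn⊆closed {S} {C} cS closed u∈S u∈C v v∈S = ¬∉⇒∈ C excl
    where
    excl : v ∉ C → ⊥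
    excl v∉C with crossing cS C u∈S u∈C v∈S v∉C
    ... | p , q , (_ , p∈C) , (_ , q∉C) , pq = true≢false (trans (sym pq) (closed p q p∈C q∉C))

  Connected⇒Conn : Connected G → Conn G full
  Connected⇒Conn c (B , (u , _ , u∈B) , (v , _ , v∉B) , sep) = walk (c u v) u∈B
    where
    walk : ∀ {u} → Star (Adj G) u v → u ∈ B → ⊥
    walk ε u∈B = ∈-∉ B u∈B v∉B
    walk {u} (_◅_ {j = w} uw rest) u∈B with ∈? w B
    ... | yes w∈B = walk rest w∈B
    ... | no  w∉B = true≢false (trans (sym uw) (sep u w (∈-full u) u∈B (∈-full w) (¬true w∉B)))

  -- The vertices known to be reachable from `u` accumulate along crossing edges. The invariant n ≤
  -- `d` + |A| means that when the fuel `d` is spent, every vertex has been reached.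
  Conn⇒Connected : Conn G full → Connected G
  Conn⇒Connected c u v = go n reach-single (⊕-self none u)
      (ℕ.≤-trans (ℕ.m≤n⇒m≤n+o 1 ℕ.≤-refl) (ℕ.≤-reflexive (cong (n ℕ.+_) (sym (∣single∣ u)))))
    where
    Reached : Subset n → Set
    Reached A = ∀ x → x ∈ A → Star (Adj G) u x
    reach-⊕ : ∀ {A p q} → Reached A → p ∈ A → adj G p q ≡ true → Reached (A ⊕ q)
    reach-⊕ {A} {p} {q} r p∈A pq x x∈ with x ≟ q
    ... | yes refl = r p p∈A ◅◅ (pq ◅ ε)
    ... | no  x≢q  = r x (trans (sym (⊕-other A x≢q)) x∈)
    reach-single : Reached (none ⊕ u)
    reach-single x x∈ = subst (Star (Adj G) u) (sym (∈-single x∈)) ε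
    go : ∀ d {A} → Reached A → u ∈ A → n ℕ.≤ d ℕ.+ ∣ A ∣ → Star (Adj G) u v
    go d {A} r u∈A le with ∈? v A
    ... | yes v∈A = r v v∈A
    go zero {A} r u∈A le | no v∉A =
      r v (⊆-antisym-size {R = A} {full} (λ x _ → ∈-full x) (subst (ℕ._≤ ∣ A ∣) (sym ∣full∣) le) v (∈-full v))
    go (suc d) {A} r u∈A le | no v∉A with crossing c A (∈-full u) u∈A (∈-full v) (¬true v∉A)
    ... | p , q , (_ , p∈A) , (_ , q∉A) , pq = go d {A ⊕ q} (reach-⊕ {A} r p∈A pq) (⊕-⊇ A q u u∈A)
      (subst (n ℕ.≤_) (sym (trans (cong (d ℕ.+_) (∣⊕∣ A q q∉A)) (ℕ.+-suc d ∣ A ∣))) le)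

  -- A connected set grown inside `K` from `w` to one vertex less than `K` misses exactly one
  -- vertex, which is the `a` sought. The vertex `y` guarantees that `w` alone is not too large.
  noncut : ∀ {K w y} → Conn G K → w ∈ K → y ∈ K → y ≢ w → ∃ λ a → a ∈ K × a ≢ w × Conn G (K ⊖ a)
  noncut {K} {w} {y} cK w∈K y∈K y≢w
    with grow cK {none ⊕ w} (single-⊆ w∈K) (conn-single w) (⊕-self none w) {∣ K ⊖ y ∣}
           (⊆-size {R = none ⊕ w} (single-⊆ (∈-⊖ K (y≢w ∘ sym) w∈K))) (⊆-size {R = K ⊖ y} (⊖-⊆ K y))
  ... | D , w⊆D , D⊆K , cD , ∣D∣ with ∃-outside D K
      (subst (suc ∣ D ∣ ℕ.≤_) (trans (cong suc ∣D∣) (∣⊖∣ K y y∈K)) ℕ.≤-refl)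
  ... | a , a∈K , a∉D = a , a∈K , (λ { refl → ∈-∉ D (w⊆D a (⊕-self none a)) a∉D }) , subst (Conn G) D≡ cD
    where
    D⊆ : D ⊆ K ⊖ a
    D⊆ x x∈D = ∈-⊖ K (λ { refl → ∈-∉ D x∈D a∉D }) (D⊆K x x∈D)
    D≡ : D ≡ K ⊖ a
    D≡ = ⊆-antisym D⊆ (⊆-antisym-size {R = D} {K ⊖ a} D⊆
      (ℕ.≤-reflexive (ℕ.suc-injective (trans (∣⊖∣ K a a∈K) (sym (trans (cong suc ∣D∣) (∣⊖∣ K y y∈K)))))))

  -- `K` is one side of the cut vertex `w` together with `w` itself. It is connected: vertices of
  -- `K` separated from `w` within `K` have no edges to the other side either, so they would be
  -- separated from `w` in all of `Z`.
  module Side {Z w} (cZ : Conn G Z) (w∈Z : w ∈ Z) (s : Fin n → Bool)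
    (nocross : ∀ p q → p ∈ Z ⊖ w → s p ≡ true → q ∈ Z ⊖ w → s q ≡ false → adj G p q ≡ false) where

    inside? : Fin n → Bool
    inside? x = mem Z x ∧ (s x ∨ does (x ≟ w))

    K : Subset n
    K = collect inside?

    K-in : ∀ x → x ∈ Z → s x ≡ true → x ∈ K
    K-in x x∈Z sx = trans (mem-collect inside? x) (cong₂ (λ a b → a ∧ (b ∨ does (x ≟ w))) x∈Z sx)

    K-w : w ∈ K
    K-w = trans (mem-collect inside? w) (cong₂ _∧_ w∈Z
      (trans (cong (s w ∨_) (true-does (w ≟ w) refl)) (Bool.∨-zeroʳ (s w))))

    K-out : ∀ x → x ∈ K → x ∈ Z × (x ≡ w ⊎ s x ≡ true)
    K-out x x∈K with ∧-true {mem Z x} (trans (sym (mem-collect inside? x)) x∈K)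
    ... | x∈Z , r with s x | x ≟ w
    ...   | true  | _      = x∈Z , inj₂ refl
    ...   | false | yes eq = x∈Z , inj₁ eq

    K-conn : Conn G K
    K-conn = conn-from K-w excl
      where
      excl : ∀ B y → w ∈ B → y ∈ K → y ∉ B → NoEdge G K B → ⊥
      excl B y w∈B y∈K y∉B sep = finish (crossing cZ far (proj₁ (K-out y y∈K))
          (trans (mem-collect far? y) (cong₂ (λ a b → a ∧ not b) y∈K y∉B)) w∈Z
          (trans (mem-collect far? w) (trans (cong (λ b → mem K w ∧ not b) w∈B) (Bool.∧-zeroʳ (mem K w)))))
        where
        far? : Fin n → Bool
        far? x = mem K x ∧ not (mem B x)
        far : Subset n
        far = collect far?
        finish : (∃₂ λ p q → (p ∈ Z × p ∈ far) × (q ∈ Z × q ∉ far) × adj G p q ≡ true) → ⊥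
        finish (p , q , (p∈Z , p∈far) , (q∈Z , q∉far) , pq) = case (∈? q K)
          where
          p∈K×p∉B = ∧-true {mem K p} (trans (sym (mem-collect far? p)) p∈far)
          p∈K = proj₁ p∈K×p∉B
          p∉B : p ∉ B
          p∉B = not-true (proj₂ p∈K×p∉B)
          p≢w : p ≢ w
          p≢w refl = ∈-∉ B w∈B p∉B
          sp : p ≡ w ⊎ s p ≡ true → s p ≡ true
          sp (inj₁ p≡w) = ⊥-elim (p≢w p≡w)
          sp (inj₂ eq)  = eq
          case : Dec (q ∈ K) → ⊥
          case (yes q∈K) = true≢false (trans (sym pq) (trans (adj-sym G p q) (sep q p q∈K q∈B p∈K p∉B)))
            where
            q∈B : q ∈ B
            q∈B = not-false (trans (sym (cong (_∧ not (mem B q)) q∈K)) (trans (sym (mem-collect far? q)) q∉far))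
          case (no q∉K) = true≢false (trans (sym pq)
            (nocross p q (∈-⊖ Z p≢w p∈Z) (sp (proj₂ (K-out p p∈K)))
              (∈-⊖ Z (λ { refl → q∉K K-w }) q∈Z) (¬true (λ sq → q∉K (K-in q q∈Z sq)))))

  -- If w is a cut vertex of G[Z], each of the two sides together with w has a
  -- non-cut vertex other than w.
  cut-pair : ∀ {Z w} → Conn G Z → w ∈ Z → Disconn G (Z ⊖ w) →
    ∃₂ λ a b → a ∈ Z ⊖ w × b ∈ Z ⊖ w × a ≢ b × adj G a b ≡ false × Conn G (Z ⊖ a ⊖ b)
  cut-pair {Z} {w} cZ w∈Z (A , (a₀ , a₀∈ , a₀∈A) , (b₀ , b₀∈ , b₀∉A) , sep) =
    combine (noncut {K₁.K} K₁.K-conn K₁.K-w (K₁.K-in a₀ (⊖-⊆ Z w a₀ a₀∈) a₀∈A) (∈⊖⇒≢ Z a₀∈))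
            (noncut {K₂.K} K₂.K-conn K₂.K-w (K₂.K-in b₀ (⊖-⊆ Z w b₀ b₀∈) (cong not b₀∉A)) (∈⊖⇒≢ Z b₀∈))
    where
    module K₁ = Side {Z} {w} cZ w∈Z (mem A) (λ p q p∈ sp q∈ sq → sep p q p∈ sp q∈ sq)
    module K₂ = Side {Z} {w} cZ w∈Z (not ∘ mem A)
      (λ p q p∈ sp q∈ sq → trans (adj-sym G p q) (sep q p q∈ (not-false sq) p∈ (not-true sp)))
    combine : (∃ λ a → a ∈ K₁.K × a ≢ w × Conn G (K₁.K ⊖ a)) → (∃ λ b → b ∈ K₂.K × b ≢ w × Conn G (K₂.K ⊖ b)) →
      ∃₂ λ a b → a ∈ Z ⊖ w × b ∈ Z ⊖ w × a ≢ b × adj G a b ≡ false × Conn G (Z ⊖ a ⊖ b)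
    combine (a , a∈K , a≢w , c₁) (b , b∈K , b≢w , c₂) = a , b , a∈ , b∈ ,
      a≢b , sep a b a∈ a∈A b∈ b∉A ,
      -- Without `a` and `b`, the set `Z` is the union of two connected sets that share `w`.
      conn-∪ {K₁.K ⊖ a} {K₂.K ⊖ b} c₁ c₂ (∈-⊖ K₁.K (a≢w ∘ sym) K₁.K-w) (∈-⊖ K₂.K (b≢w ∘ sym) K₂.K-w) sub₁ sub₂ cover
      where
      a∈ : a ∈ Z ⊖ w
      a∈ = ∈-⊖ Z a≢w (proj₁ (K₁.K-out a a∈K))
      b∈ : b ∈ Z ⊖ w
      b∈ = ∈-⊖ Z b≢w (proj₁ (K₂.K-out b b∈K))
      resolve : ∀ {x : Fin n} {P : Set} → x ≢ w → x ≡ w ⊎ P → P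
      resolve x≢w (inj₁ x≡w) = ⊥-elim (x≢w x≡w)
      resolve x≢w (inj₂ p)   = p
      a∈A : a ∈ A
      a∈A = resolve a≢w (proj₂ (K₁.K-out a a∈K))
      b∉A : b ∉ A
      b∉A = not-true (resolve b≢w (proj₂ (K₂.K-out b b∈K)))
      a≢b : a ≢ b
      a≢b refl = ∈-∉ A a∈A b∉A
      b∉K₁ : ∀ {x} → x ∈ K₁.K → x ≢ b
      b∉K₁ {x} x∈ refl = ∈-∉ A (resolve b≢w (proj₂ (K₁.K-out x x∈))) b∉A
      a∉K₂ : ∀ {x} → x ∈ K₂.K → x ≢ a
      a∉K₂ {x} x∈ refl = ∈-∉ A a∈A (not-true (resolve a≢w (proj₂ (K₂.K-out x x∈))))
      sub₁ : K₁.K ⊖ a ⊆ Z ⊖ a ⊖ b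
      sub₁ x x∈ = ∈-⊖ (Z ⊖ a) (b∉K₁ x∈K) (∈-⊖ Z (∈⊖⇒≢ K₁.K x∈) (proj₁ (K₁.K-out x x∈K)))
        where x∈K = ⊖-⊆ K₁.K a x x∈
      sub₂ : K₂.K ⊖ b ⊆ Z ⊖ a ⊖ b
      sub₂ x x∈ = ∈-⊖ (Z ⊖ a) (∈⊖⇒≢ K₂.K x∈) (∈-⊖ Z (a∉K₂ x∈K) (proj₁ (K₂.K-out x x∈K)))
        where x∈K = ⊖-⊆ K₂.K b x x∈
      cover : ∀ x → x ∈ Z ⊖ a ⊖ b → x ∈ K₁.K ⊖ a ⊎ x ∈ K₂.K ⊖ b
      cover x x∈ = by (∈? x A)
        where
        x∈Za = ⊖-⊆ (Z ⊖ a) b x x∈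
        by : Dec (x ∈ A) → x ∈ K₁.K ⊖ a ⊎ x ∈ K₂.K ⊖ b
        by (yes x∈A) = inj₁ (∈-⊖ K₁.K (∈⊖⇒≢ Z x∈Za) (K₁.K-in x (⊖-⊆ Z a x x∈Za) x∈A))
        by (no x∉A)  = inj₂ (∈-⊖ K₂.K (∈⊖⇒≢ (Z ⊖ a) x∈) (K₂.K-in x (⊖-⊆ Z a x x∈Za) (cong not (¬true x∉A))))

conn-Iso : ∀ {G H : Graph n} {S S′} → Iso G H S S′ → Conn G S → Conn H S′
conn-Iso {G = G} {H} {S} {S′} e c (B , (u , u∈ , u∈B) , (v , v∈ , v∉B) , sep) =
  c (B₀ , (from u , from-∈ u∈ , trans (mem-collect f (from u)) (trans (cong (mem B) (to-from u∈)) u∈B)) ,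
    (from v , from-∈ v∈ , trans (mem-collect f (from v)) (trans (cong (mem B) (to-from v∈)) v∉B)) ,
    λ p q p∈ p∈B q∈ q∉B → trans (to-adj p∈ q∈)
      (sep (to p) (to q) (to-∈ p∈) (trans (sym (mem-collect f p)) p∈B) (to-∈ q∈) (trans (sym (mem-collect f q)) q∉B)))
  where
  open Iso e
  f = λ x → mem B (to x)
  B₀ = collect f

_⊆?_ : ∀ (R S : Subset n) → Dec (R ⊆ S)
R ⊆? S = Fin.all? (λ v → ∈? v R →-dec ∈? v S)

-- Binomial moments of the degrees

binom : ℕ → ℕ → ℤ
binom _       zero    = 1ℤ
binom zero    (suc i) = 0ℤ
binom (suc d) (suc i) = binom d i + binom d (suc i)

binom-1 : ∀ d → binom d 1 ≡ pos d
binom-1 zero    = refl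
binom-1 (suc d) = cong (1ℤ +_) (binom-1 d)

-- Splitting by whether `Q` contains the first vertex turns the recursion for `∑` into Pascal's
-- rule.
subset-count : ∀ (N : Subset n) i → ∑[ i ] (λ Q → ind (Q ⊆? N)) ≡ binom ∣ N ∣ i
subset-count [] i = trans (∑-single (λ Q → ind (∣ Q ∣ ℕ.≟ i) * ind (Q ⊆? []))) (by i)
  where
  by : ∀ i → ind (∣ [] ∣ ℕ.≟ i) * ind ([] ⊆? []) ≡ binom ∣ [] ∣ i
  by i rewrite ∣[]∣ with i
  ... | zero  = cong (1ℤ *_) (ind-yes ([] ⊆? []) (λ ()))
  ... | suc _ = refl
subset-count (b ∷ N) i = trans (∑-subset-suc _) (by b i)
  where
  open ≡-Reasoning
  tail⊆ : ∀ {c d} {Q N : Subset n} → c Vec.∷ Q ⊆ d ∷ N → Q ⊆ N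
  tail⊆ {n} {c} {d} {Q} {N} sub v v∈Q = trans (sym (mem-suc d N v)) (sub (suc v) (trans (mem-suc c Q v) v∈Q))
  cons⊆ : ∀ {c d} {Q N : Subset n} → (c ≡ true → d ≡ true) → Q ⊆ N → c Vec.∷ Q ⊆ d ∷ N
  cons⊆ {n} {c} {d} {Q} {N} imp sub zero    p = trans (mem-zero d N) (imp (trans (sym (mem-zero c Q)) p))
  cons⊆ {n} {c} {d} {Q} {N} imp sub (suc v) p = trans (mem-suc d N v) (sub v (trans (sym (mem-suc c Q v)) p))
  outer : ∀ b i → ∑ (λ Q → ind (∣ false ∷ Q ∣ ℕ.≟ i) * ind ((false ∷ Q) ⊆? (b ∷ N))) ≡ binom ∣ N ∣ i
  outer b i = trans (∑-cong (λ Q → cong₂ _*_ (cong (λ s → ind (s ℕ.≟ i)) (∣∷∣-false Q))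
    (ind-⇔ ((false ∷ Q) ⊆? (b ∷ N)) (Q ⊆? N) tail⊆ (cons⊆ (λ ()))))) (subset-count N i)
  by : ∀ b i → ∑ (λ Q → ind (∣ false ∷ Q ∣ ℕ.≟ i) * ind ((false ∷ Q) ⊆? (b ∷ N))) +
    ∑ (λ Q → ind (∣ true ∷ Q ∣ ℕ.≟ i) * ind ((true ∷ Q) ⊆? (b ∷ N))) ≡ binom ∣ b ∷ N ∣ i
  by false i = trans (cong₂ _+_ (outer false i) (trans (∑-cong λ Q → trans (cong (ind (∣ true ∷ Q ∣ ℕ.≟ i) *_)
      (ind-no ((true ∷ Q) ⊆? (false ∷ N)) (λ sub → true≢false
          (trans (sym (sub zero (mem-zero true Q))) (mem-zero false N)))))
      (ℤ.*-zeroʳ (ind (∣ true ∷ Q ∣ ℕ.≟ i)))) ∑-0))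
    (trans (ℤ.+-identityʳ _) (cong (λ s → binom s i) (sym (∣∷∣-false N))))
  by true zero = trans (cong₂ _+_ (outer true zero) (trans (∑-cong λ Q →
      cong (λ s → ind (s ℕ.≟ zero) * ind ((true ∷ Q) ⊆? (true ∷ N))) (∣∷∣-true Q)) ∑-0))
      refl
  by true (suc i) = begin
    _ ≡⟨ cong₂ _+_ (outer true (suc i)) (∑-cong (λ Q → cong₂ _*_
           (trans (cong (λ s → ind (s ℕ.≟ suc i)) (∣∷∣-true Q))
               (ind-⇔ (suc ∣ Q ∣ ℕ.≟ suc i) (∣ Q ∣ ℕ.≟ i) ℕ.suc-injective (cong suc)))
           (ind-⇔ ((true ∷ Q) ⊆? (true ∷ N)) (Q ⊆? N) tail⊆ (cons⊆ (λ _ → refl))))) ⟩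
    binom d (suc i) + ∑[ i ] (λ Q → ind (Q ⊆? N)) ≡⟨ cong (binom d (suc i) +_) (subset-count N i) ⟩
    binom d (suc i) + binom d i                   ≡⟨ ℤ.+-comm (binom d (suc i)) (binom d i) ⟩
    binom (suc d) (suc i)                         ≡⟨ cong (λ s → binom s (suc i)) (sym (∣∷∣-true N)) ⟩
    binom ∣ true ∷ N ∣ (suc i)                    ∎
    where d = ∣ N ∣

nbrs : Graph n → Fin n → Subset n
nbrs G v = collect (adj G v)

deg : Graph n → Fin n → ℕ
deg G v = ∣ nbrs G v ∣

deg≡∑ : ∀ (G : Graph n) v → pos (deg G v) ≡ ∑ (λ w → ⟦ adj G v w ⟧)
deg≡∑ G v = trans (∣∣≡∑ (nbrs G v)) (∑-cong (λ w → cong ⟦_⟧ (mem-collect (adj G v) w)))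

∈-nbrs : ∀ (G : Graph n) {v w} → adj G v w ≡ true → w ∈ nbrs G v
∈-nbrs G {v} {w} p = trans (mem-collect (adj G v) w) p

nbrs-∈ : ∀ (G : Graph n) {v w} → w ∈ nbrs G v → adj G v w ≡ true
nbrs-∈ G {v} {w} p = trans (sym (mem-collect (adj G v) w)) p

-- Both sides count stars with centre `v` and leaf set `R`. The condition `v ∉ R` is automatic, as
-- no vertex is its own neighbour, but it is what makes the left side a pointed statistic.
moment-sum : ∀ (G : Graph n) i →
  ∑[ i ] (λ R → ∑ (λ v → ⟦ not (mem R v) ⟧ * ind (R ⊆? nbrs G v))) ≡ ∑ (λ v → binom (deg G v) i)
moment-sum {n} G i = begin
  ∑[ i ] (λ R → ∑ (λ v → ⟦ not (mem R v) ⟧ * ind (R ⊆? nbrs G v)))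
    ≡⟨ ∑-cong (λ R → trans (cong (ind (∣ R ∣ ℕ.≟ i) *_) (∑-cong (λ v → outside R v)))
         (sym (∑-* (ind (∣ R ∣ ℕ.≟ i)) (λ v → ind (R ⊆? nbrs G v))))) ⟩
  ∑ (λ R → ∑ (λ v → ind (∣ R ∣ ℕ.≟ i) * ind (R ⊆? nbrs G v)))
    ≡⟨ ∑-swap (λ R v → ind (∣ R ∣ ℕ.≟ i) * ind (R ⊆? nbrs G v)) ⟩
  ∑ (λ v → ∑[ i ] (λ R → ind (R ⊆? nbrs G v)))
    ≡⟨ ∑-cong (λ v → subset-count (nbrs G v) i) ⟩
  ∑ (λ v → binom (deg G v) i) ∎
  where
  open ≡-Reasoning
  outside : ∀ R v → ⟦ not (mem R v) ⟧ * ind (R ⊆? nbrs G v) ≡ ind (R ⊆? nbrs G v)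
  outside R v with mem R v in eq
  ... | false = ℤ.*-identityˡ _
  ... | true  = sym (ind-no (R ⊆? nbrs G v) (λ sub →
    true≢false (trans (sym (nbrs-∈ G (sub v eq))) (adj-irrefl G v))))

-- Edge statistics of a vertex set and its complement

Attached : Graph n → Subset n → Fin n → Set
Attached G R s = ∃ λ w → w ∈ R × adj G s w ≡ true

abstract

  attached? : ∀ (G : Graph n) R s → Dec (Attached G R s)
  attached? G R s = Fin.any? (λ w → ∈? w R ×-dec (adj G s w Bool.≟ true))

#attached : Graph n → Subset n → ℤ
#attached G R = ∑ (λ s → ⟦ not (mem R s) ⟧ * ind (attached? G R s))

degIn degOut : Graph n → Subset n → Fin n → ℤ
degIn  G R v = ∑ (λ w → ⟦ mem R w ⟧ * ⟦ adj G v w ⟧)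
degOut G R v = ∑ (λ w → ⟦ not (mem R w) ⟧ * ⟦ adj G v w ⟧)

-- Ordered pairs: inner and outer count every edge twice.
inner outer boundary : Graph n → Subset n → ℤ
inner    G R = ∑ (λ v → ⟦ mem R v ⟧ * degIn G R v)
outer    G R = ∑ (λ v → ⟦ not (mem R v) ⟧ * degOut G R v)
boundary G R = ∑ (λ v → ⟦ not (mem R v) ⟧ * degIn G R v)

degsum : Graph n → ℤ
degsum G = ∑ (λ v → pos (deg G v))

deg-split : ∀ (G : Graph n) R v → pos (deg G v) ≡ degIn G R v + degOut G R v
deg-split G R v = trans (deg≡∑ G v) (trans (∑-cong (λ w → halves (mem R w) ⟦ adj G v w ⟧)) (∑-+ _ _))
  where
  halves : ∀ b x → x ≡ ⟦ b ⟧ * x + ⟦ not b ⟧ * x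
  halves true  = one
    where
    one : ∀ x → x ≡ 1ℤ * x + 0ℤ * x
    one = solve-∀
  halves false = one
    where
    one : ∀ x → x ≡ 0ℤ * x + 1ℤ * x
    one = solve-∀

boundary-sym : ∀ (G : Graph n) R → ∑ (λ v → ⟦ mem R v ⟧ * degOut G R v) ≡ boundary G R
boundary-sym G R = begin
  ∑ (λ v → ⟦ mem R v ⟧ * degOut G R v)
    ≡⟨ ∑-cong (λ v → sym (∑-* ⟦ mem R v ⟧ _)) ⟩
  ∑ (λ v → ∑ (λ w → ⟦ mem R v ⟧ * (⟦ not (mem R w) ⟧ * ⟦ adj G v w ⟧)))
    ≡⟨ ∑-swap (λ v w → ⟦ mem R v ⟧ * (⟦ not (mem R w) ⟧ * ⟦ adj G v w ⟧)) ⟩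
  ∑ (λ w → ∑ (λ v → ⟦ mem R v ⟧ * (⟦ not (mem R w) ⟧ * ⟦ adj G v w ⟧)))
    ≡⟨ ∑-cong (λ w → trans (∑-cong (λ v → trans (exchange ⟦ mem R v ⟧ ⟦ not (mem R w) ⟧ ⟦ adj G v w ⟧)
         (cong (λ a → ⟦ not (mem R w) ⟧ * (⟦ mem R v ⟧ * ⟦ a ⟧)) (adj-sym G v w)))) (∑-* ⟦ not (mem R w) ⟧ _)) ⟩
  boundary G R ∎
  where
  open ≡-Reasoning
  exchange : ∀ x y z → x * (y * z) ≡ y * (x * z)
  exchange = solve-∀

degsum-inside : ∀ (G : Graph n) R → ∑ (λ v → ⟦ mem R v ⟧ * pos (deg G v)) ≡ inner G R + boundary G R
degsum-inside G R = trans (∑-cong (λ v → trans (cong (⟦ mem R v ⟧ *_) (deg-split G R v))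
    (ℤ.*-distribˡ-+ ⟦ mem R v ⟧ _ _)))
  (trans (∑-+ _ _) (cong (inner G R +_) (boundary-sym G R)))

degsum-outside : ∀ (G : Graph n) R → ∑ (λ v → ⟦ not (mem R v) ⟧ * pos (deg G v)) ≡ boundary G R + outer G R
degsum-outside G R = trans (∑-cong (λ v → trans (cong (⟦ not (mem R v) ⟧ *_) (deg-split G R v))
    (ℤ.*-distribˡ-+ ⟦ not (mem R v) ⟧ _ _)))
  (∑-+ _ _)

∑-halves : ∀ (R : Subset n) (f : Fin n → ℤ) → ∑ f ≡ ∑ (λ v → ⟦ mem R v ⟧ * f v) + ∑ (λ v → ⟦ not (mem R v) ⟧ * f v)
∑-halves R f = trans (∑-cong (λ v → trans (halves ⟦ mem R v ⟧ (f v))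
    (cong (λ x → ⟦ mem R v ⟧ * f v + x * f v) (sym (⟦⟧-not (mem R v))))))
  (∑-+ _ _)
  where
  halves : ∀ a x → x ≡ a * x + (1ℤ - a) * x
  halves = solve-∀

degsum-split : ∀ (G : Graph n) R → degsum G ≡ inner G R + boundary G R + (boundary G R + outer G R)
degsum-split G R = trans (∑-halves R (λ v → pos (deg G v))) (cong₂ _+_ (degsum-inside G R) (degsum-outside G R))

private
  ⊆-to-Iso : ∀ {G H : Graph n} {S S′} (e : Iso G H S S′) {v} → v ∈ S →
    S ⊖ v ⊆ nbrs G v → S′ ⊖ Iso.to e v ⊆ nbrs H (Iso.to e v)
  ⊆-to-Iso {G = G} {H} {S} {S′} e {v} v∈S sub x x∈ = ∈-nbrs H (trans
      (sym (trans (E.to-adj v∈S (⊖-⊆ S v _ (D.from-∈ x∈))) (cong (adj H (E.to v)) (D.to-from x∈))))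
      (nbrs-∈ G (sub (E.from x) (D.from-∈ x∈))))
    where
    module E = Iso e
    module D = Iso (Iso-⊖ e v∈S)

  ⊆-from-Iso : ∀ {G H : Graph n} {S S′} (e : Iso G H S S′) {v} → v ∈ S →
    S′ ⊖ Iso.to e v ⊆ nbrs H (Iso.to e v) → S ⊖ v ⊆ nbrs G v
  ⊆-from-Iso {G = G} {H} {S} e {v} v∈S sub x x∈ = ∈-nbrs G (trans
      (E.to-adj v∈S (⊖-⊆ S v x x∈)) (nbrs-∈ H (sub (E.to x) (D.to-∈ x∈))))
    where
    module E = Iso e
    module D = Iso (Iso-⊖ e v∈S)

  adj-⊖ : ∀ {G H : Graph n} {S S′} (e : Iso G H S S′) {v} → v ∈ S → ∀ {w} → w ∈ S ⊖ v →
    adj G v w ≡ adj H (Iso.to e v) (Iso.to e w)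
  adj-⊖ {S = S} e {v} v∈S {w} w∈ = Iso.to-adj e v∈S (⊖-⊆ S v w w∈)

  nbrs-pointed : PointedInvariant {n} (λ G R v → ind (R ⊆? nbrs G v))
  nbrs-pointed e v∈S = ind-⇔ (_ ⊆? _) (_ ⊆? _) (⊆-to-Iso e v∈S) (⊆-from-Iso e v∈S)

  degIn-pointed : PointedInvariant {n} degIn
  degIn-pointed e v∈S = ∑-Iso (Iso-⊖ e v∈S) (λ w∈ → cong ⟦_⟧ (adj-⊖ e v∈S w∈))

  attached-pointed : PointedInvariant {n} (λ G R v → ind (attached? G R v))
  attached-pointed {G = G} {H} {S} {S′} e {v} v∈S = ind-⇔ (attached? G (S ⊖ v) v) (attached? H (S′ ⊖ E.to v) (E.to v))
    (λ { (w , w∈ , vw) → E.to w , D.to-∈ w∈ , trans (sym (adj-⊖ e v∈S w∈)) vw })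
    (λ { (w , w∈ , vw) → E.from w , D.from-∈ w∈ ,
       trans (adj-⊖ e v∈S (D.from-∈ w∈)) (trans (cong (adj H (E.to v)) (D.to-from w∈)) vw) })
    where
    module E = Iso e
    module D = Iso (Iso-⊖ e v∈S)

  conn-invariant : Invariant {n} (λ G R → ind (conn? G R))
  conn-invariant {G = G} {H} {S} {S′} e = ind-⇔ (conn? G S) (conn? H S′) (conn-Iso e) (conn-Iso (Iso-sym e))

  inner-invariant : Invariant {n} inner
  inner-invariant e = ∑-Iso e (λ v∈ → ∑-Iso e (λ w∈ → cong ⟦_⟧ (Iso.to-adj e v∈ w∈)))

module _ {k} {G H : Graph n} (m : Matching k G H) (k≤n : k ℕ.≤ n) where

  moments : ∀ {i} → suc i ℕ.≤ k → ∑ (λ v → binom (deg G v) i) ≡ ∑ (λ v → binom (deg H v) i)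
  moments {i} i<k = trans (sym (moment-sum G i))
    (trans (kelly-pointed m k≤n {λ G R v → ind (R ⊆? nbrs G v)} nbrs-pointed i<k) (moment-sum H i))

  conn-count : ∀ {j} → j ℕ.≤ k → ∑[ j ] (λ R → ind (conn? G R)) ≡ ∑[ j ] (λ R → ind (conn? H R))
  conn-count = kelly m k≤n {λ G R → ind (conn? G R)} conn-invariant

  private
    -- The indicator of connectedness depends on `R` alone, so it can be moved under the sum over
    -- `s`, where its product with `Q` is again a pointed invariant.
    weighted : (Q : Graph n → Subset n → Fin n → ℤ) → PointedInvariant Q → ∀ {j} → suc j ℕ.≤ k →
      ∑[ j ] (λ R → ind (conn? G R) * ∑ (λ s → ⟦ not (mem R s) ⟧ * Q G R s)) ≡
      ∑[ j ] (λ R → ind (conn? H R) * ∑ (λ s → ⟦ not (mem R s) ⟧ * Q H R s))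
    weighted Q inv {j} j<k = trans (∑-cong (λ R → cong (ind (∣ R ∣ ℕ.≟ j) *_) (push G R)))
      (trans (kelly-pointed m k≤n {λ G R s → ind (conn? G R) * Q G R s}
        (λ e v∈S → cong₂ _*_ (conn-invariant (Iso-⊖ e v∈S)) (inv e v∈S)) j<k)
      (∑-cong (λ R → cong (ind (∣ R ∣ ℕ.≟ j) *_) (sym (push H R)))))
      where
      exchange : ∀ x y z → x * (y * z) ≡ y * (x * z)
      exchange = solve-∀
      push : ∀ X R → ind (conn? X R) * ∑ (λ s → ⟦ not (mem R s) ⟧ * Q X R s) ≡
        ∑ (λ s → ⟦ not (mem R s) ⟧ * (ind (conn? X R) * Q X R s))
      push X R = trans (sym (∑-* (ind (conn? X R)) _))
        (∑-cong (λ s → exchange (ind (conn? X R)) ⟦ not (mem R s) ⟧ (Q X R s)))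

  attached-count : ∀ {j} → suc j ℕ.≤ k →
    ∑[ j ] (λ R → ind (conn? G R) * #attached G R) ≡ ∑[ j ] (λ R → ind (conn? H R) * #attached H R)
  attached-count = weighted (λ G R s → ind (attached? G R s)) attached-pointed

  degsum-eq : 2 ℕ.≤ k → degsum G ≡ degsum H
  degsum-eq 2≤k = trans (∑-cong (λ v → sym (binom-1 (deg G v))))
      (trans (moments {1} 2≤k) (∑-cong (λ v → binom-1 (deg H v))))

  -- The edges outside R are those that do not meet R, hence determined by the deck.
  outer-count : 2 ℕ.≤ k → ∀ {j} → suc j ℕ.≤ k →
    ∑[ j ] (λ R → ind (conn? G R) * outer G R) ≡ ∑[ j ] (λ R → ind (conn? H R) * outer H R)
  outer-count 2≤k {j} j<k = trans (expand G) (trans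
    (cong₂ _-_ (cong₂ _-_ (cong₂ _*_ (degsum-eq 2≤k) (conn-count (ℕ.≤-trans (ℕ.n≤1+n j) j<k)))
      (kelly m k≤n {λ G R → ind (conn? G R) * inner G R}
        (λ e → cong₂ _*_ (conn-invariant e) (inner-invariant e)) (ℕ.≤-trans (ℕ.n≤1+n j) j<k)))
      (cong (pos 2 *_) (weighted degIn degIn-pointed j<k)))
    (sym (expand H)))
    where
    open ≡-Reasoning
    solve-outer : ∀ w c M i b o → M ≡ i + b + (b + o) → w * (c * o) ≡ M * (w * c) - w * (c * i) - pos 2 *
        (w * (c * b))
    solve-outer w c M i b o refl = ring w c i b o
      where
      ring : ∀ w c i b o → w * (c * o) ≡ (i + b + (b + o)) * (w * c) - w * (c * i) - pos 2 * (w * (c * b))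
      ring = solve-∀
    expand : ∀ X → ∑[ j ] (λ R → ind (conn? X R) * outer X R) ≡
      degsum X * ∑[ j ] (λ R → ind (conn? X R)) - ∑[ j ] (λ R → ind (conn? X R) * inner X R)
        - pos 2 * ∑[ j ] (λ R → ind (conn? X R) * boundary X R)
    expand X = trans (∑-cong (λ R → solve-outer (ind (∣ R ∣ ℕ.≟ j)) (ind (conn? X R)) (degsum X) (inner X R)
        (boundary X R) (outer X R)
        (degsum-split X R)))
      (trans (∑-- _ _) (cong₂ _-_ (trans (∑-- _ _)
          (cong (_- ∑[ j ] (λ R → ind (conn? X R) * inner X R)) (∑-* (degsum X) _)))
        (∑-* (pos 2) _)))

-- Lower bounds for numbers of edges

-- The quadratic form of the adjacency matrix; `inner` and `outer` are its values at the indicator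
-- vectors of a set and of its complement.
quad : Graph n → (Fin n → ℤ) → ℤ
quad G m = ∑ (λ v → m v * ∑ (λ w → m w * ⟦ adj G v w ⟧))

quad-δ : ∀ (G : Graph n) {m m′ : Fin n → ℤ} a → (∀ v → m′ v ≡ m v + ind (a ≟ v)) →
  quad G m′ ≡ quad G m + pos 2 * ∑ (λ w → m w * ⟦ adj G a w ⟧)
quad-δ {n} G {m} {m′} a eq = begin
  quad G m′
    ≡⟨ ∑-cong (λ v → cong₂ _*_ (eq v) (row v)) ⟩
  ∑ (λ v → (m v + ind (a ≟ v)) * (r v + ⟦ adj G a v ⟧))
    ≡⟨ ∑-cong (λ v → expand (m v) (ind (a ≟ v)) (r v) ⟦ adj G a v ⟧) ⟩
  ∑ (λ v → (m v * r v + m v * ⟦ adj G a v ⟧) + ind (a ≟ v) * (r v + ⟦ adj G a v ⟧))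
    ≡⟨ trans (∑-+ _ _) (cong₂ _+_ (∑-+ _ _) (∑-δ a (λ v → r v + ⟦ adj G a v ⟧))) ⟩
  (quad G m + r a) + (r a + ⟦ adj G a a ⟧)
    ≡⟨ cong (λ b → (quad G m + r a) + (r a + ⟦ b ⟧)) (adj-irrefl G a) ⟩
  (quad G m + r a) + (r a + 0ℤ)
    ≡⟨ collect2 (quad G m) (r a) ⟩
  quad G m + pos 2 * r a ∎
  where
  open ≡-Reasoning
  r : Fin n → ℤ
  r v = ∑ (λ w → m w * ⟦ adj G v w ⟧)
  row : ∀ v → ∑ (λ w → m′ w * ⟦ adj G v w ⟧) ≡ r v + ⟦ adj G a v ⟧
  row v = trans (∑-cong (λ w → trans (cong (_* ⟦ adj G v w ⟧) (eq w))
      (ℤ.*-distribʳ-+ ⟦ adj G v w ⟧ (m w) (ind (a ≟ w)))))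
    (trans (∑-+ _ _) (cong (r v +_) (trans (∑-δ a (λ w → ⟦ adj G v w ⟧)) (cong ⟦_⟧ (adj-sym G v a)))))
  expand : ∀ x d y z → (x + d) * (y + z) ≡ (x * y + x * z) + d * (y + z)
  expand = solve-∀
  collect2 : ∀ q x → (q + x) + (x + 0ℤ) ≡ q + pos 2 * x
  collect2 = solve-∀

⊕-weight : ∀ (R : Subset n) {a} → a ∉ R → ∀ v → ⟦ mem (R ⊕ a) v ⟧ ≡ ⟦ mem R v ⟧ + ind (a ≟ v)
⊕-weight R {a} a∉R v with a ≟ v
... | yes refl = trans (cong ⟦_⟧ (⊕-self R a)) (cong (λ b → ⟦ b ⟧ + 1ℤ) (sym a∉R))
... | no a≢v   = trans (cong ⟦_⟧ (⊕-other R (a≢v ∘ sym))) (sym (ℤ.+-identityʳ _))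

⊕-coweight : ∀ (R : Subset n) {a} → a ∉ R → ∀ v → ⟦ not (mem R v) ⟧ ≡ ⟦ not (mem (R ⊕ a) v) ⟧ + ind (a ≟ v)
⊕-coweight R {a} a∉R v with a ≟ v
... | yes refl = trans (cong (λ b → ⟦ not b ⟧) a∉R) (cong (λ b → ⟦ not b ⟧ + 1ℤ) (sym (⊕-self R a)))
... | no a≢v   = trans (cong (λ b → ⟦ not b ⟧) (sym (⊕-other R (a≢v ∘ sym)))) (sym (ℤ.+-identityʳ _))

0≤weighted : ∀ {A : Set} ⦃ _ : Enum A ⦄ (p : A → Bool) {f : A → ℤ} → (∀ a → 0ℤ ≤ f a) → 0ℤ ≤ ∑ (λ a → ⟦ p a ⟧ * f a)
0≤weighted p 0≤f = ∑-nonneg (λ a → 0≤* (0≤⟦⟧ (p a)) (0≤f a))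

degIn-pos : ∀ (G : Graph n) R {v w} → w ∈ R → adj G v w ≡ true → 1ℤ ≤ degIn G R v
degIn-pos G R {v} {w} w∈R vw = subst (_≤ degIn G R v) (cong₂ (λ a b → ⟦ a ⟧ * ⟦ b ⟧) w∈R vw)
  (term≤∑ (λ x → 0≤* (0≤⟦⟧ (mem R x)) (0≤⟦⟧ (adj G v x))) w)

-- Contracting a nonempty set R leaves a connected graph on the complement and
-- one more vertex, so it has at least as many edges as the complement has vertices.
contraction-edges : ∀ {G : Graph n} → Conn G full → ∀ {R u} → u ∈ R →
  pos 2 * (pos n - pos ∣ R ∣) ≤ outer G R + pos 2 * #attached G R
contraction-edges {n} {G} c {R} u∈R = go (n ∸ ∣ R ∣) u∈R (ℕ.m∸n+n≡m (size≤n R))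
  where
  go : ∀ d {R u} → u ∈ R → d ℕ.+ ∣ R ∣ ≡ n → pos 2 * (pos n - pos ∣ R ∣) ≤ outer G R + pos 2 * #attached G R
  go zero {R} u∈R eq = ℤ.≤-trans (ℤ.≤-reflexive (trans (cong (λ x → pos 2 * (pos n - pos x)) eq) (vanish (pos n))))
    (0≤+ (0≤weighted (not ∘ mem R) (λ v → 0≤weighted (not ∘ mem R) (λ w → 0≤⟦⟧ (adj G v w))))
      (0≤* {pos 2} (+≤+ z≤n) (0≤weighted (not ∘ mem R) (λ s → 0≤⟦⟧ (does (attached? G R s))))))
    where
    vanish : ∀ x → pos 2 * (x - x) ≡ 0ℤ
    vanish = solve-∀
  go (suc d) {R} {u} u∈R eq with ∃-outside R full
      (subst (suc ∣ R ∣ ℕ.≤_) (trans eq (sym ∣full∣)) (s≤s (ℕ.m≤n+m ∣ R ∣ d)))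
  ... | v , _ , v∉R with crossing {G = G} c R (∈-full u) u∈R (∈-full v) v∉R
  -- Let `a` have x neighbours outside `R ⊕ a`. Absorbing `a` costs x edges of the complement and
  -- the attached vertex `a`, while at most x vertices become newly attached. So the bound drops by
  -- at least one edge, and the complement by one vertex.
  ... | p , a , (_ , p∈R) , (_ , a∉R) , pa = ≤-from (0≤+ (gap IH) (0≤* {pos 2} (+≤+ z≤n) (gap att)))
      (solve-gap (pos n) (pos ∣ R ∣) (pos ∣ R′ ∣) (outer G R) (outer G R′) (#attached G R) (#attached G R′) x
        (cong pos (∣⊕∣ R a a∉R)) (quad-δ G {λ v → ⟦ not (mem R′ v) ⟧} {λ v → ⟦ not (mem R v) ⟧} a (⊕-coweight R a∉R)))
    where
    R′ = R ⊕ a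
    x : ℤ
    x = ∑ (λ w → ⟦ not (mem R′ w) ⟧ * ⟦ adj G a w ⟧)
    IH : pos 2 * (pos n - pos ∣ R′ ∣) ≤ outer G R′ + pos 2 * #attached G R′
    IH = go d (⊕-self R a) (∣⊕∣-shift R a∉R eq)
    near : ∀ s → ind (attached? G R′ s) ≤ ind (attached? G R s) + ⟦ adj G a s ⟧
    near s with attached? G R′ s | attached? G R s
    ... | no _  | a? = 0≤+ (0≤⟦⟧ (does a?)) (0≤⟦⟧ (adj G a s))
    ... | yes _ | yes _ = ≤-from (0≤⟦⟧ (adj G a s)) (cancel ⟦ adj G a s ⟧)
      where
      cancel : ∀ y → y ≡ 1ℤ + y - 1ℤ
      cancel = solve-∀
    ... | yes (w , w∈R′ , sw) | no ¬att with w ≟ a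
    ...   | yes refl = ℤ.≤-reflexive (cong (λ b → 0ℤ + ⟦ b ⟧) (sym (trans (adj-sym G a s) sw)))
    ...   | no  w≢a  = ⊥-elim (¬att (w , trans (sym (⊕-other R w≢a)) w∈R′ , sw))
    old : #attached G R ≡ ∑ (λ s → ⟦ not (mem R′ s) ⟧ * ind (attached? G R s)) + 1ℤ
    old = trans (∑-cong (λ s → trans (cong (_* ind (attached? G R s)) (⊕-coweight R a∉R s))
        (ℤ.*-distribʳ-+ (ind (attached? G R s)) ⟦ not (mem R′ s) ⟧ (ind (a ≟ s)))))
      (trans (∑-+ _ _) (cong (∑ (λ s → ⟦ not (mem R′ s) ⟧ * ind (attached? G R s)) +_)
        (trans (∑-δ a (λ s → ind (attached? G R s)))
            (ind-yes (attached? G R a) (p , p∈R , trans (adj-sym G a p) pa)))))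
    att : #attached G R′ ≤ (#attached G R - 1ℤ) + x
    att = subst (#attached G R′ ≤_) (trans
        (∑-cong (λ s → ℤ.*-distribˡ-+ ⟦ not (mem R′ s) ⟧ (ind (attached? G R s)) ⟦ adj G a s ⟧)) (trans (∑-+ _ _)
        (cong (_+ x) (shift (∑ (λ s → ⟦ not (mem R′ s) ⟧ * ind (attached? G R s))) (#attached G R) old))))
      (∑-mono (λ s → *-monoʳ-on (not (mem R′ s)) {ind (attached? G R′ s)} {ind (attached? G R s) + ⟦ adj G a s ⟧}
          (λ _ → near s)))
      where
      shift : ∀ y z → z ≡ y + 1ℤ → y ≡ z - 1ℤ
      shift y z refl = ring y
        where
        ring : ∀ y → y ≡ y + 1ℤ - 1ℤ
        ring = solve-∀
    solve-gap : ∀ N r r′ o o′ t t′ x → r′ ≡ 1ℤ + r → o ≡ o′ + pos 2 * x →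
      (o′ + pos 2 * t′ - pos 2 * (N - r′)) + pos 2 * ((t - 1ℤ) + x - t′) ≡ o + pos 2 * t - pos 2 * (N - r)
    solve-gap N r r′ o o′ t t′ x refl refl = ring N r o′ t t′ x
      where
      ring : ∀ N r o′ t t′ x → (o′ + pos 2 * t′ - pos 2 * (N - (1ℤ + r))) + pos 2 * ((t - 1ℤ) + x - t′) ≡
          (o′ + pos 2 * x) + pos 2 * t - pos 2 * (N - r)
      ring = solve-∀

∃-other : ∀ (K : Subset n) w → 2 ℕ.≤ ∣ K ∣ → ∃ λ y → y ∈ K × y ≢ w
∃-other {n} K w 2≤K = y , proj₁ (proj₂ out) , λ y≡w →
    ∈-∉ (none ⊕ w) (⊕-self none w) (subst (_∉ none ⊕ w) y≡w (proj₂ (proj₂ out)))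
  where
  out : ∃ λ v → v ∈ K × v ∉ none ⊕ w
  out = ∃-outside (none ⊕ w) K (subst (ℕ._< ∣ K ∣) (sym (∣single∣ w)) 2≤K)
  y = proj₁ out

removable : ∀ {G : Graph n} {K w} → Conn G K → w ∈ K → 2 ℕ.≤ ∣ K ∣ →
  ∃₂ λ a p → a ∈ K × a ≢ w × Conn G (K ⊖ a) × p ∈ K ⊖ a × adj G a p ≡ true
removable {n} {G} {K} {w} cK w∈K 2≤K = attach (noncut {G = G} cK w∈K (proj₁ (proj₂ other)) (proj₂ (proj₂ other)))
  where
  other = ∃-other K w 2≤K
  attach : (∃ λ a → a ∈ K × a ≢ w × Conn G (K ⊖ a)) →
    ∃₂ λ a p → a ∈ K × a ≢ w × Conn G (K ⊖ a) × p ∈ K ⊖ a × adj G a p ≡ true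
  attach (a , a∈K , a≢w , c) = edge (crossing {G = G} cK (K ⊖ a) w∈K (∈-⊖ K (a≢w ∘ sym) w∈K) a∈K (⊖-self K a))
    where
    edge : (∃₂ λ p q → (p ∈ K × p ∈ K ⊖ a) × (q ∈ K × q ∉ K ⊖ a) × adj G p q ≡ true) →
      ∃₂ λ a p → a ∈ K × a ≢ w × Conn G (K ⊖ a) × p ∈ K ⊖ a × adj G a p ≡ true
    edge (p , q , (_ , p∈) , (q∈K , q∉) , pq) = a , p , a∈K , a≢w , c , p∈ ,
        trans (adj-sym G a p) (subst (λ q → adj G p q ≡ true) q≡a pq)
      where
      q≡a : q ≡ a
      q≡a with q ≟ a
      ... | yes eq = eq
      ... | no ≢a  = ⊥-elim (∈-∉ (K ⊖ a) (∈-⊖ K ≢a q∈K) q∉)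

inner-⊖ : ∀ (G : Graph n) K {a} → a ∈ K → inner G K ≡ inner G (K ⊖ a) + pos 2 * degIn G (K ⊖ a) a
inner-⊖ G K {a} a∈K = trans (cong (inner G) (sym (⊖-⊕ K a a∈K)))
  (quad-δ G {λ v → ⟦ mem (K ⊖ a) v ⟧} {λ v → ⟦ mem (K ⊖ a ⊕ a) v ⟧} a (⊕-weight (K ⊖ a) (⊖-self K a)))

-- Peel off a non-cut vertex other than `w`: it has a neighbour in what remains, so at least one
-- edge goes with it. The factor 2 is there because `inner` counts ordered pairs.
tree-edges : ∀ {G : Graph n} s {K w} → Conn G K → w ∈ K → ∣ K ∣ ≡ suc s → pos 2 * pos s ≤ inner G K
tree-edges {n} {G} zero {K} cK w∈K eq = 0≤weighted (mem K) (λ v → 0≤weighted (mem K) (λ w → 0≤⟦⟧ (adj G v w)))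
tree-edges {n} {G} (suc s) {K} {w} cK w∈K eq = step
    (removable {G = G} cK w∈K (subst (2 ℕ.≤_) (sym eq) (s≤s (s≤s z≤n))))
  where
  solve-gap : ∀ s i i′ d → i ≡ i′ + pos 2 * d → (i′ - pos 2 * s) + pos 2 * (d - 1ℤ) ≡ i - pos 2 * (1ℤ + s)
  solve-gap s i i′ d refl = ring s i′ d
    where
    ring : ∀ s i′ d → (i′ - pos 2 * s) + pos 2 * (d - 1ℤ) ≡ (i′ + pos 2 * d) - pos 2 * (1ℤ + s)
    ring = solve-∀
  step : (∃₂ λ a p → a ∈ K × a ≢ w × Conn G (K ⊖ a) × p ∈ K ⊖ a × adj G a p ≡ true) → pos 2 * pos (suc s) ≤ inner G K
  step (a , p , a∈K , a≢w , c , p∈ , ap) = ≤-from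
    (0≤+ (gap IH) (0≤* {pos 2} (+≤+ z≤n) (gap (degIn-pos G (K ⊖ a) p∈ ap))))
    (solve-gap (pos s) (inner G K) (inner G (K ⊖ a)) (degIn G (K ⊖ a) a) (inner-⊖ G K a∈K))
    where
    IH : pos 2 * pos s ≤ inner G (K ⊖ a)
    IH = tree-edges {G = G} s c (∈-⊖ K (a≢w ∘ sym) w∈K) (ℕ.suc-injective (trans (∣⊖∣ K a a∈K) eq))

#attached≤boundary : ∀ (G : Graph n) R → #attached G R ≤ boundary G R
#attached≤boundary G R = ∑-mono (λ s → *-monoʳ-on (not (mem R s)) {ind (attached? G R s)} (λ _ → le s))
  where
  le : ∀ s → ind (attached? G R s) ≤ degIn G R s
  le s with attached? G R s
  ... | yes (w , w∈R , sw) = degIn-pos G R w∈R sw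
  ... | no _ = 0≤weighted (mem R) (λ w → 0≤⟦⟧ (adj G s w))

pairs : ∀ (p : Fin n → Bool) → ∑ (λ v → ⟦ p v ⟧ * ∑ (λ w → ⟦ p w ⟧ * (1ℤ - ind (v ≟ w)))) ≡
  ∑ (λ v → ⟦ p v ⟧) * ∑ (λ v → ⟦ p v ⟧) - ∑ (λ v → ⟦ p v ⟧)
pairs p = trans (∑-cong (λ v → trans (cong (⟦ p v ⟧ *_) (row v))
    (trans (expand ⟦ p v ⟧ t) (cong (λ z → ⟦ p v ⟧ * t - z) (⟦⟧-idem (p v))))))
  (trans (∑-- _ _) (cong (_- t) (∑-*ʳ _ t)))
  where
  t = ∑ (λ v → ⟦ p v ⟧)
  expand : ∀ x t → x * (t - x) ≡ x * t - x * x
  expand = solve-∀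
  move : ∀ x d → x * (1ℤ - d) ≡ x - d * x
  move = solve-∀
  row : ∀ v → ∑ (λ w → ⟦ p w ⟧ * (1ℤ - ind (v ≟ w))) ≡ t - ⟦ p v ⟧
  row v = trans (∑-cong (λ w → move ⟦ p w ⟧ (ind (v ≟ w))))
      (trans (∑-- _ _) (cong (λ z → t - z) (∑-δ v (λ w → ⟦ p w ⟧))))

adj≤≢ : ∀ (G : Graph n) v w → ⟦ adj G v w ⟧ ≤ 1ℤ - ind (v ≟ w)
adj≤≢ G v w with v ≟ w
... | yes refl = ℤ.≤-reflexive (cong ⟦_⟧ (adj-irrefl G v))
... | no  _    = ⟦⟧≤1 (adj G v w)

inner≤ : ∀ (G : Graph n) R {s} → ∣ R ∣ ≡ s → inner G R ≤ pos s * pos s - pos s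
inner≤ G R sz = ℤ.≤-trans (∑-mono (λ v → *-monoʳ-on (mem R v) {degIn G R v} (λ _ →
    ∑-mono (λ w → *-monoʳ-on (mem R w) {⟦ adj G v w ⟧} (λ _ → adj≤≢ G v w)))))
  (ℤ.≤-reflexive (trans (pairs (mem R)) (cong (λ t → t * t - t) (trans (sym (∣∣≡∑ R)) (cong pos sz)))))

deg≤-from : ∀ (G : Graph n) v (f : Fin n → ℤ) {d} → (∀ w → ⟦ adj G v w ⟧ ≤ f w) → ∑ f ≤ pos d → deg G v ℕ.≤ d
deg≤-from G v f le ∑≤ = ℤ.drop‿+≤+ (ℤ.≤-trans (ℤ.≤-reflexive (deg≡∑ G v)) (ℤ.≤-trans (∑-mono le) ∑≤))

extend-to : ∀ (A : Subset n) {k} → ∣ A ∣ ℕ.≤ k → k ℕ.≤ n → ∃ λ S → A ⊆ S × ∣ S ∣ ≡ k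
extend-to {n} A {k} A≤k k≤n = go (k ∸ ∣ A ∣) A (ℕ.m∸n+n≡m A≤k)
  where
  go : ∀ d (A : Subset n) → d ℕ.+ ∣ A ∣ ≡ k → ∃ λ S → A ⊆ S × ∣ S ∣ ≡ k
  go zero    A eq = A , (λ _ p → p) , eq
  go (suc d) A eq with ∃-outside A full
      (ℕ.≤-trans (subst (suc ∣ A ∣ ℕ.≤_) eq (s≤s (ℕ.m≤n+m ∣ A ∣ d))) (subst (k ℕ.≤_) (sym ∣full∣) k≤n))
  ... | v , _ , v∉A with go d (A ⊕ v) (∣⊕∣-shift A v∉A eq)
  ... | S , sub , sz = S , (λ x x∈A → sub x (⊕-⊇ A v x x∈A)) , sz

-- A component with all but two vertices

module TwoMissing {j} {G H : Graph n} (m : Matching (suc j) G H) (n≡ : n ≡ 4 ℕ.+ j) (3≤j : 3 ℕ.≤ j)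
  (cG : Conn G full) {C : Subset n} (cC : Conn H C) (closed : Closed H C) (∣C∣ : ∣ C ∣ ≡ 2 ℕ.+ j) where

  private
    k≤n : suc j ℕ.≤ n
    k≤n = subst (suc j ℕ.≤_) (sym n≡) (ℕ.m≤n+m (suc j) 3)

    2≤k : 2 ℕ.≤ suc j
    2≤k = s≤s (ℕ.≤-trans (s≤s z≤n) 3≤j)

    nonempty : ∀ R → ∣ R ∣ ≡ j → ∃ λ u → u ∈ R
    nonempty R sz with ∃-outside none R (subst₂ ℕ._<_ (sym (∣none∣ {n})) (sym sz) (ℕ.≤-trans (s≤s z≤n) 3≤j))
    ... | u , u∈R , _ = u , u∈R

    into-C : ∀ {u v} → u ∈ C → adj H u v ≡ true → v ∈ C
    into-C {u} {v} u∈C uv = ¬∉⇒∈ C (λ v∉C → true≢false (trans (sym uv) (closed u v u∈C v∉C)))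

    outside-C : ∀ {u v} → u ∉ C → adj H u v ≡ true → v ∉ C
    outside-C {u} {v} u∉C uv = ¬∈⇒∉ C (λ v∈C → ∈-∉ C (into-C v∈C (trans (adj-sym H v u) uv)) u∉C)

    few-outside : ∀ {a b c} → a ∉ C → b ∉ C → c ∉ C → a ≢ b → a ≢ c → b ≢ c → ⊥
    few-outside {a} {b} {c} a∉ b∉ c∉ a≢b a≢c b≢c = ℕ.<⇒≱ (s≤s ℕ.≤-refl)
      (subst₂ ℕ._≤_ sz n≡ (size≤n (C ⊕ a ⊕ b ⊕ c)))
      where
      b∉′ : b ∉ C ⊕ a
      b∉′ = trans (⊕-other C (a≢b ∘ sym)) b∉
      c∉′ : c ∉ C ⊕ a ⊕ b
      c∉′ = trans (⊕-other (C ⊕ a) (b≢c ∘ sym)) (trans (⊕-other C (a≢c ∘ sym)) c∉)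
      sz : ∣ C ⊕ a ⊕ b ⊕ c ∣ ≡ 5 ℕ.+ j
      sz = trans (∣⊕∣ (C ⊕ a ⊕ b) c c∉′) (cong suc
          (trans (∣⊕∣ (C ⊕ a) b b∉′) (cong suc (trans (∣⊕∣ C a a∉) (cong suc ∣C∣)))))

    co-C : ∑ (λ v → ⟦ not (mem C v) ⟧) ≡ pos 2
    co-C = trans (#-complement C) (trans (cong₂ (λ a b → pos a - pos b) n≡ ∣C∣) (ring (pos j)))
      where
      ring : ∀ x → pos 4 + x - (pos 2 + x) ≡ pos 2
      ring = solve-∀

    -- A connected set avoiding `C` would have to fit into the two vertices outside, but `j` is at
    -- least 3.
    R⊆C : ∀ R → ∣ R ∣ ≡ j → Conn H R → R ⊆ C
    R⊆C R sz cR with Fin.any? (λ u → ∈? u R ×-dec ∈? u C)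
    ... | yes (u , u∈R , u∈C) = conn⊆closed {G = H} cR closed u∈R u∈C
    ... | no ¬meet = ⊥-elim (ℕ.<⇒≱ (ℕ.≤-trans (s≤s (s≤s (s≤s z≤n))) 3≤j)
        (ℤ.drop‿+≤+ (ℤ.≤-trans (ℤ.≤-reflexive (trans (cong pos (sym sz)) (∣∣≡∑ R)))
          (ℤ.≤-trans (∑-mono le) (ℤ.≤-reflexive co-C)))))
      where
      le : ∀ v → ⟦ mem R v ⟧ ≤ ⟦ not (mem C v) ⟧
      le v with mem R v in r | mem C v in c
      ... | true  | true  = ⊥-elim (¬meet (v , r , c))
      ... | true  | false = ℤ.≤-refl
      ... | false | b     = 0≤⟦⟧ (not b)

    -- `D` consists of the two vertices of `C` outside `R`. Together with the two vertices outside
    -- `C` it makes up the complement of `R`.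
    module Rest (R : Subset n) (sz : ∣ R ∣ ≡ j) (cR : Conn H R) where

      D : Subset n
      D = collect (λ v → mem C v ∧ not (mem R v))

      D-mem : ∀ v → mem D v ≡ mem C v ∧ not (mem R v)
      D-mem v = mem-collect (λ v → mem C v ∧ not (mem R v)) v

      D-weight : ∀ v → ⟦ mem D v ⟧ ≡ ⟦ mem C v ⟧ - ⟦ mem R v ⟧
      D-weight v with mem R v in r
      ... | true  = trans (cong ⟦_⟧ (trans (D-mem v)
          (trans (cong (λ b → mem C v ∧ not b) r) (Bool.∧-zeroʳ (mem C v)))))
                      (sym (cong (λ b → ⟦ b ⟧ - 1ℤ) (R⊆C R sz cR v r)))
      ... | false = trans (cong ⟦_⟧ (trans (D-mem v)
          (trans (cong (λ b → mem C v ∧ not b) r) (Bool.∧-identityʳ (mem C v)))))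
                      (sym (ℤ.+-identityʳ _))

      ∑D : ∑ (λ v → ⟦ mem D v ⟧) ≡ pos 2
      ∑D = trans (∑-cong D-weight) (trans (∑-- _ _)
          (trans (cong₂ _-_ (trans (sym (∣∣≡∑ C)) (cong pos ∣C∣)) (trans (sym (∣∣≡∑ R)) (cong pos sz)))
        (ring (pos j))))
        where
        ring : ∀ x → pos 2 + x - x ≡ pos 2
        ring = solve-∀

      ∣D∣ : ∣ D ∣ ≡ 2
      ∣D∣ = ℤ.+-injective (trans (∣∣≡∑ D) ∑D)

      inner-D≤2 : inner H D ≤ pos 2
      inner-D≤2 = inner≤ H D ∣D∣

      attached≤2 : #attached H R ≤ pos 2
      attached≤2 = ℤ.≤-trans (∑-mono le) (ℤ.≤-reflexive ∑D)
        where
        le : ∀ s → ⟦ not (mem R s) ⟧ * ind (attached? H R s) ≤ ⟦ mem D s ⟧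
        le s with attached? H R s
        ... | no _ = ℤ.≤-trans (ℤ.≤-reflexive (ℤ.*-zeroʳ ⟦ not (mem R s) ⟧)) (0≤⟦⟧ (mem D s))
        ... | yes (w , w∈R , sw) = ℤ.≤-reflexive (trans (ℤ.*-identityʳ _) (cong ⟦_⟧ (sym (trans (D-mem s)
              (cong (_∧ not (mem R s)) (into-C (R⊆C R sz cR w w∈R) (trans (adj-sym H w s) sw)))))))

      -- No edge joins D to the two vertices outside C.
      outer≤ : outer H R ≤ inner H D + pos 2
      outer≤ = ℤ.≤-trans (∑-mono rows) (ℤ.≤-reflexive (trans (∑-+ _ _)
          (cong (inner H D +_) (trans (pairs (λ v → not (mem C v))) (cong (λ t → t * t - t) co-C)))))
        where
        cell : ∀ v w → ⟦ not (mem R v) ⟧ * (⟦ not (mem R w) ⟧ * ⟦ adj H v w ⟧) ≤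
          ⟦ mem D v ⟧ * (⟦ mem D w ⟧ * ⟦ adj H v w ⟧) + ⟦ not (mem C v) ⟧ * (⟦ not (mem C w) ⟧ * (1ℤ - ind (v ≟ w)))
        cell v w rewrite D-mem v | D-mem w = go (mem R v) (mem R w) (mem C v) (mem C w) refl refl
          where
          a = ⟦ adj H v w ⟧
          0≤RHS : ∀ rv rw cv cw → 0ℤ ≤ ⟦ cv ∧ not rv ⟧ * (⟦ cw ∧ not rw ⟧ * a) + ⟦ not cv ⟧ *
              (⟦ not cw ⟧ * (1ℤ - ind (v ≟ w)))
          0≤RHS rv rw cv cw = 0≤+ (0≤* (0≤⟦⟧ (cv ∧ not rv)) (0≤* (0≤⟦⟧ (cw ∧ not rw)) (0≤⟦⟧ (adj H v w))))
            (0≤* (0≤⟦⟧ (not cv)) (0≤* (0≤⟦⟧ (not cw)) (gap (⟦⟧≤1 (does (v ≟ w))))))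
          eq₁ : ∀ a d → 1ℤ * (1ℤ * a) + 0ℤ * (0ℤ * d) ≡ a
          eq₁ = solve-∀
          eq₂ : ∀ a d → 0ℤ * (0ℤ * a) + 1ℤ * (1ℤ * d) ≡ d
          eq₂ = solve-∀
          one : ∀ a → 1ℤ * (1ℤ * a) ≡ a
          one = solve-∀
          go : ∀ rv rw cv cw → mem C v ≡ cv → mem C w ≡ cw → ⟦ not rv ⟧ * (⟦ not rw ⟧ * a) ≤
            ⟦ cv ∧ not rv ⟧ * (⟦ cw ∧ not rw ⟧ * a) + ⟦ not cv ⟧ * (⟦ not cw ⟧ * (1ℤ - ind (v ≟ w)))
          go true  rw    cv    cw    _ _ = 0≤RHS true rw cv cw
          go false true  cv    cw    _ _ = 0≤RHS false true cv cw
          go false false true  true  _ _ = ℤ.≤-reflexive (trans (one a) (sym (eq₁ a (1ℤ - ind (v ≟ w)))))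
          go false false false false _ _ = subst₂ _≤_ (sym (one a)) (sym (eq₂ a (1ℤ - ind (v ≟ w)))) (adj≤≢ H v w)
          go false false true  false p q = ℤ.≤-trans (ℤ.≤-reflexive (trans (one a) (cong ⟦_⟧ (closed v w p q))))
              (0≤RHS false false true false)
          go false false false true  p q = ℤ.≤-trans
              (ℤ.≤-reflexive (trans (one a) (cong ⟦_⟧ (trans (adj-sym H v w) (closed w v q p)))))
              (0≤RHS false false false true)
        rows : ∀ v → ⟦ not (mem R v) ⟧ * degOut H R v ≤
          ⟦ mem D v ⟧ * degIn H D v + ⟦ not (mem C v) ⟧ * ∑ (λ w → ⟦ not (mem C w) ⟧ * (1ℤ - ind (v ≟ w)))
        rows v = subst₂ _≤_ (∑-* ⟦ not (mem R v) ⟧ _)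
          (trans (∑-+ _ _) (cong₂ _+_ (∑-* ⟦ mem D v ⟧ _) (∑-* ⟦ not (mem C v) ⟧ _))) (∑-mono (cell v))

    -- Twice the amount by which e(T) + a(R) exceeds 4: `outer` already counts each edge twice, and
    -- 8 is twice the size of the complement of `R`.
    excess : Graph n → Subset n → ℤ
    excess X R = outer X R + pos 2 * #attached X R - pos 8

    G-excess : ∀ R → ∣ R ∣ ≡ j → 0ℤ ≤ excess G R
    G-excess R sz = subst (λ t → 0ℤ ≤ outer G R + pos 2 * #attached G R - t)
      (trans (cong₂ (λ a b → pos 2 * (pos a - pos b)) n≡ sz) (ring (pos j)))
      (gap (contraction-edges {G = G} cG (proj₂ (nonempty R sz))))
      where
      ring : ∀ x → pos 2 * (pos 4 + x - x) ≡ pos 8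
      ring = solve-∀

    excess-sum : ∑[ j ] (λ R → ind (conn? G R) * excess G R) ≡ ∑[ j ] (λ R → ind (conn? H R) * excess H R)
    excess-sum = trans (split G) (trans (cong₂ _-_ (cong₂ _+_ (outer-count m k≤n 2≤k ℕ.≤-refl)
        (cong (pos 2 *_) (attached-count m k≤n ℕ.≤-refl))) (cong (pos 8 *_) (conn-count m k≤n (ℕ.n≤1+n j))))
            (sym (split H)))
      where
      expand : ∀ w c o t → w * (c * (o + pos 2 * t - pos 8)) ≡ w * (c * o) + pos 2 * (w * (c * t)) - pos 8 * (w * c)
      expand = solve-∀
      split : ∀ X → ∑[ j ] (λ R → ind (conn? X R) * excess X R) ≡
        ∑[ j ] (λ R → ind (conn? X R) * outer X R) + pos 2 * ∑[ j ] (λ R → ind (conn? X R) * #attached X R)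
          - pos 8 * ∑[ j ] (λ R → ind (conn? X R))
      split X = trans (∑-cong (λ R → expand (ind (∣ R ∣ ℕ.≟ j)) (ind (conn? X R)) (outer X R) (#attached X R)))
        (trans (∑-- _ _) (cong₂ _-_ (trans (∑-+ _ _)
            (cong (∑[ j ] (λ R → ind (conn? X R) * outer X R) +_) (∑-* (pos 2) _)))
          (∑-* (pos 8) _)))

    conn-case : ∀ (X : Graph n) R {x} → (Conn X R → 0ℤ ≤ x) → 0ℤ ≤ ind (conn? X R) * x
    conn-case X R {x} 0≤x with conn? X R
    ... | yes c = subst (0ℤ ≤_) (sym (ℤ.*-identityˡ x)) (0≤x c)
    ... | no  _ = ℤ.≤-refl

    conn-value : ∀ (X : Graph n) R {x} → Conn X R → ind (conn? X R) * x ≡ 0ℤ → x ≡ 0ℤ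
    conn-value X R {x} c eq = trans (sym (ℤ.*-identityˡ x)) (trans (cong (_* x) (sym (ind-yes (conn? X R) c))) eq)

    -- Splits the negated excess into the slacks of `outer≤`, `inner-D≤2` and `attached≤2`, so that
    -- zero excess makes all three tight.
    bounds : ∀ (R : Subset n) (sz : ∣ R ∣ ≡ j) (cR : Conn H R) → let open Rest R sz cR in
      - excess H R ≡ ((inner H D + pos 2) - outer H R) + (pos 2 - inner H D) + pos 2 * (pos 2 - #attached H R)
    bounds R sz cR = ring (outer H R) (#attached H R) (inner H (Rest.D R sz cR))
      where
      ring : ∀ o t i → - (o + pos 2 * t - pos 8) ≡ ((i + pos 2) - o) + (pos 2 - i) + pos 2 * (pos 2 - t)
      ring = solve-∀

    H-excess : ∀ R → ∣ R ∣ ≡ j → Conn H R → 0ℤ ≤ - excess H R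
    H-excess R sz cR = subst (0ℤ ≤_) (sym (bounds R sz cR))
      (0≤+ (0≤+ (gap outer≤) (gap inner-D≤2)) (0≤* {pos 2} (+≤+ z≤n) (gap attached≤2)))
      where open Rest R sz cR

    -- The sums for `G` and `H` agree, the former is nonnegative and the latter has no positive
    -- term; so every term for `H` vanishes.
    tight : ∀ R → ∣ R ∣ ≡ j → Conn H R → - excess H R ≡ 0ℤ
    tight R sz cR = conn-value H R cR (∑[]-vanish j {λ R → ind (conn? H R) * - excess H R}
      (λ R sz → conn-case H R (H-excess R sz)) negative R sz)
      where
      negate : ∀ w c x → w * (c * - x) ≡ -[1+ 0 ] * (w * (c * x))
      negate = solve-∀
      sum : ∑[ j ] (λ R → ind (conn? H R) * - excess H R) ≡ -[1+ 0 ] * ∑[ j ] (λ R → ind (conn? G R) * excess G R)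
      sum = trans (∑-cong (λ R → negate (ind (∣ R ∣ ℕ.≟ j)) (ind (conn? H R)) (excess H R)))
        (trans (∑-* -[1+ 0 ] _) (cong (-[1+ 0 ] *_) (sym excess-sum)))
      negative : ∑[ j ] (λ R → ind (conn? H R) * - excess H R) ≤ 0ℤ
      negative = ≤-from (∑[]-nonneg j {λ R → ind (conn? G R) * excess G R}
          (λ R sz → conn-case G R (λ _ → G-excess R sz)))
        (trans (ring _) (cong (λ z → 0ℤ - z) (sym sum)))
        where
        ring : ∀ x → x ≡ 0ℤ - -[1+ 0 ] * x
        ring = solve-∀

    -- The other two slacks are nonnegative and all three add up to zero, so the slack of
    -- `inner-D≤2` is not positive. The next lemma isolates the slack of `attached≤2` in the same
    -- way.
    inner-D : ∀ R (sz : ∣ R ∣ ≡ j) (cR : Conn H R) → pos 2 ≤ inner H (Rest.D R sz cR)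
    inner-D R sz cR = ≤-from (0≤+ (gap outer≤) (0≤* {pos 2} (+≤+ z≤n) (gap attached≤2)))
      (solve-gap (outer H R) (#attached H R) (inner H D) (tight R sz cR))
      where
      open Rest R sz cR
      solve-gap : ∀ o t i → - (o + pos 2 * t - pos 8) ≡ 0ℤ → ((i + pos 2) - o) + pos 2 * (pos 2 - t) ≡ i - pos 2
      solve-gap o t i eq = trans (ring o t i) (trans (cong (i - pos 2 +_) eq) (ℤ.+-identityʳ _))
        where
        ring : ∀ o t i → ((i + pos 2) - o) + pos 2 * (pos 2 - t) ≡ (i - pos 2) + - (o + pos 2 * t - pos 8)
        ring = solve-∀

    two-attached : ∀ R → ∣ R ∣ ≡ j → Conn H R → #attached H R ≡ pos 2
    two-attached R sz cR = ℤ.≤-antisym attached≤2 (ℤ.*-cancelˡ-≤-pos (pos 2) (#attached H R) (pos 2)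
      (≤-from (0≤+ (gap outer≤) (gap inner-D≤2)) (solve-gap (outer H R) (#attached H R) (inner H D) (tight R sz cR))))
      where
      open Rest R sz cR
      solve-gap : ∀ o t i → - (o + pos 2 * t - pos 8) ≡ 0ℤ → ((i + pos 2) - o) + (pos 2 - i) ≡ pos 2 * t - pos 2 * pos
          2
      solve-gap o t i eq = trans (ring o t i) (trans (cong (pos 2 * t - pos 4 +_) eq) (ℤ.+-identityʳ _))
        where
        ring : ∀ o t i → ((i + pos 2) - o) + (pos 2 - i) ≡ (pos 2 * t - pos 4) + - (o + pos 2 * t - pos 8)
        ring = solve-∀

    -- For `R = C ⊖ v ⊖ w` the set `D` is {v, w}, and tightness demands an edge inside it. All
    -- structure of `C` is derived from this fact.
    pair-adjacent : ∀ {v w} → v ∈ C → w ∈ C → v ≢ w → Conn H (C ⊖ v ⊖ w) → adj H v w ≡ true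
    pair-adjacent {v} {w} v∈C w∈C v≢w cR = by (adj H v w Bool.≟ true)
      where
      R = C ⊖ v ⊖ w
      w∈ : w ∈ C ⊖ v
      w∈ = ∈-⊖ C (v≢w ∘ sym) w∈C
      sz : ∣ R ∣ ≡ j
      sz = ℕ.suc-injective (ℕ.suc-injective (trans (cong suc (∣⊖∣ (C ⊖ v) w w∈)) (trans (∣⊖∣ C v v∈C) ∣C∣)))
      open Rest R sz cR
      D-only : ∀ x → x ∈ D → x ≡ v ⊎ x ≡ w
      D-only x x∈D with x ≟ v | x ≟ w
      ... | yes eq | _      = inj₁ eq
      ... | no _   | yes eq = inj₂ eq
      ... | no x≢v | no x≢w with ∧-true {mem C x} (trans (sym (D-mem x)) x∈D)
      ...   | x∈C , x∉R = ⊥-elim (∈-∉ R (∈-⊖ (C ⊖ v) x≢w (∈-⊖ C x≢v x∈C)) (not-true x∉R))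
      by : Dec (adj H v w ≡ true) → adj H v w ≡ true
      by (yes vw) = vw
      by (no ¬vw) = ⊥-elim (absurd (subst (pos 2 ≤_) none-inside (inner-D R sz cR)))
        where
        absurd : ¬ pos 2 ≤ 0ℤ
        absurd (+≤+ ())
        no-edge : ∀ {x y} → x ≡ v ⊎ x ≡ w → y ≡ v ⊎ y ≡ w → adj H x y ≡ false
        no-edge (inj₁ refl) (inj₁ refl) = adj-irrefl H v
        no-edge (inj₁ refl) (inj₂ refl) = ¬true ¬vw
        no-edge (inj₂ refl) (inj₁ refl) = trans (adj-sym H w v) (¬true ¬vw)
        no-edge (inj₂ refl) (inj₂ refl) = adj-irrefl H w
        none-inside : inner H D ≡ 0ℤ
        none-inside = trans (∑-cong (λ x → trans (*-congʳ-on (mem D x) {degIn H D x} {0ℤ} (λ x∈D →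
            trans (∑-cong (λ y → trans (*-congʳ-on (mem D y) {⟦ adj H x y ⟧} {0ℤ} (λ y∈D →
              cong ⟦_⟧ (no-edge (D-only x x∈D) (D-only y y∈D)))) (ℤ.*-zeroʳ ⟦ mem D y ⟧))) ∑-0))
                  (ℤ.*-zeroʳ ⟦ mem D x ⟧))) ∑-0

    -- A cut vertex would provide, by `cut-pair`, two nonadjacent vertices whose removal keeps `C`
    -- connected.
    conn-⊖ : ∀ {v} → v ∈ C → Conn H (C ⊖ v)
    conn-⊖ {v} v∈C disc = contradict (cut-pair {G = H} cC v∈C disc)
      where
      contradict : (∃₂ λ a b → a ∈ C ⊖ v × b ∈ C ⊖ v × a ≢ b × adj H a b ≡ false × Conn H (C ⊖ a ⊖ b)) → ⊥
      contradict (a , b , a∈ , b∈ , a≢b , ab , c) =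
        true≢false (trans (sym (pair-adjacent (⊖-⊆ C v a a∈) (⊖-⊆ C v b b∈) a≢b c)) ab)

    -- By `pair-adjacent`, `w` is a cut vertex of `Z = C ⊖ v`, so `cut-pair` gives nonadjacent `a`
    -- and `b` with `Z ⊖ a ⊖ b` connected. But `C ⊖ a ⊖ b` is disconnected, again by
    -- `pair-adjacent`. Hence `v` has no neighbour in `Z ⊖ a ⊖ b`, which leaves only `a` and `b`.
    low-degree : ∀ {v w} → v ∈ C → w ∈ C → v ≢ w → adj H v w ≡ false → deg H v ℕ.≤ 2
    low-degree {v} {w} v∈C w∈C v≢w vw = bound (cut-pair {G = H} (conn-⊖ v∈C) w∈Z (¬conn⇒disconn {G = H}
        (λ c → true≢false (trans (sym (pair-adjacent v∈C w∈C v≢w c)) vw))))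
      where
      Z = C ⊖ v
      w∈Z : w ∈ Z
      w∈Z = ∈-⊖ C (v≢w ∘ sym) w∈C
      bound : (∃₂ λ a b → a ∈ Z ⊖ w × b ∈ Z ⊖ w × a ≢ b × adj H a b ≡ false × Conn H (Z ⊖ a ⊖ b)) → deg H v ℕ.≤ 2
      bound (a , b , a∈ , b∈ , a≢b , ab , c) = deg≤-from H v (λ x → ind (a ≟ x) + ind (b ≟ x)) le
          (ℤ.≤-reflexive (trans (∑-+ _ _) (cong₂ _+_ (∑-once a) (∑-once b))))
        where
        a∈Z = ⊖-⊆ Z w a a∈
        b∈Z = ⊖-⊆ Z w b b∈
        restore : Z ⊖ a ⊖ b ⊕ v ≡ C ⊖ a ⊖ b
        restore = subset-ext eq
          where
          eq : ∀ x → mem (Z ⊖ a ⊖ b ⊕ v) x ≡ mem (C ⊖ a ⊖ b) x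
          eq x with x ≟ v
          ... | yes refl = trans (⊕-self (Z ⊖ a ⊖ b) x)
              (sym (∈-⊖ (C ⊖ a) (∈⊖⇒≢ C b∈Z ∘ sym) (∈-⊖ C (∈⊖⇒≢ C a∈Z ∘ sym) v∈C)))
          ... | no x≢v with x ≟ b
          ...   | yes refl = trans (⊕-other (Z ⊖ a ⊖ x) x≢v) (trans (⊖-self (Z ⊖ a) x) (sym (⊖-self (C ⊖ a) x)))
          ...   | no x≢b with x ≟ a
          ...     | yes refl = trans (⊕-other (Z ⊖ x ⊖ b) x≢v) (trans (⊖-other (Z ⊖ x) x≢b) (trans (⊖-self Z x)
                      (sym (trans (⊖-other (C ⊖ x) x≢b) (⊖-self C x)))))
          ...     | no x≢a = trans (⊕-other (Z ⊖ a ⊖ b) x≢v)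
              (trans (⊖-other (Z ⊖ a) x≢b) (trans (⊖-other Z x≢a) (trans (⊖-other C x≢v)
                      (sym (trans (⊖-other (C ⊖ a) x≢b) (⊖-other C x≢a))))))
        disconnected : ¬ Conn H (C ⊖ a ⊖ b)
        disconnected c′ = true≢false (trans (sym (pair-adjacent (⊖-⊆ C v a a∈Z) (⊖-⊆ C v b b∈Z) a≢b c′)) ab)
        le : ∀ x → ⟦ adj H v x ⟧ ≤ ind (a ≟ x) + ind (b ≟ x)
        le x with adj H v x in vx
        ... | false = 0≤+ (0≤⟦⟧ (does (a ≟ x))) (0≤⟦⟧ (does (b ≟ x)))
        ... | true with a ≟ x | b ≟ x
        ...   | yes _  | yes _  = +≤+ (s≤s z≤n)
        ...   | yes _  | no _   = ℤ.≤-refl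
        ...   | no _   | yes _  = ℤ.≤-refl
        ...   | no a≢x | no b≢x = ⊥-elim (disconnected (subst (Conn H) restore
                (conn-⊕ {G = H} c (∈-⊖ (Z ⊖ a) (b≢x ∘ sym) (∈-⊖ Z (a≢x ∘ sym) (∈-⊖ C x≢v (into-C v∈C vx)))) v
                    (trans (adj-sym H x v) vx))))
          where
          x≢v : x ≢ v
          x≢v refl = true≢false (trans (sym vx) (adj-irrefl H x))

    extend-card : ∀ (A : Subset n) → ∣ A ∣ ℕ.≤ 3 → ∃ λ S → A ⊆ S × ∣ S ∣ ≡ suc j
    extend-card A le = extend-to A (ℕ.≤-trans le (ℕ.m≤n⇒m≤1+n 3≤j)) k≤n

    triple : Fin n → Fin n → Fin n → Subset n
    triple a b c = none ⊕ a ⊕ b ⊕ c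

    ∣⊕∣≤ : ∀ (S : Subset n) v → ∣ S ⊕ v ∣ ℕ.≤ suc ∣ S ∣
    ∣⊕∣≤ S v with mem S v in eq
    ... | false = ℕ.≤-reflexive (∣⊕∣ S v eq)
    ... | true  = ℕ.m≤n⇒m≤1+n (⊆-size {R = S ⊕ v} {S} (⊕-⊆ (λ _ x∈ → x∈) eq))

    triple≤3 : ∀ a b c → ∣ triple a b c ∣ ℕ.≤ 3
    triple≤3 a b c = ℕ.≤-trans (∣⊕∣≤ (none ⊕ a ⊕ b) c)
        (s≤s (ℕ.≤-trans (∣⊕∣≤ (none ⊕ a) b) (s≤s (ℕ.≤-trans (∣⊕∣≤ none a)
      (s≤s (ℕ.≤-reflexive (∣none∣ {n})))))))

    triple-∈ : ∀ a b c → a ∈ triple a b c × b ∈ triple a b c × c ∈ triple a b c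
    triple-∈ a b c = ⊕-⊇ (none ⊕ a ⊕ b) c a (⊕-⊇ (none ⊕ a) b a (⊕-self none a)) ,
      ⊕-⊇ (none ⊕ a ⊕ b) c b (⊕-self (none ⊕ a) b) , ⊕-self (none ⊕ a ⊕ b) c

    module Complete (complete : ∀ s t → s ∈ C → t ∈ C → s ≢ t → adj H s t ≡ true) where

      -- A card containing the path carries it to `H`. There its middle vertex lies either in the
      -- complete `C`, which joins the two ends, or outside, where there is no room for three
      -- vertices.
      no-path : ∀ {a b c} → adj G a b ≡ true → adj G b c ≡ true → a ≢ c → adj G a c ≡ true
      no-path {a} {b} {c} ab bc a≢c = image (extend-card (triple a b c) (triple≤3 a b c))
        where
        image : (∃ λ S → triple a b c ⊆ S × ∣ S ∣ ≡ suc j) → adj G a c ≡ true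
        image (S , sub , sz) = trans (to-adj a∈ c∈) (by (∈? (to b) C))
          where
          open Iso (Matching.iso m S sz)
          a∈ = sub a (proj₁ (triple-∈ a b c))
          b∈ = sub b (proj₁ (proj₂ (triple-∈ a b c)))
          c∈ = sub c (proj₂ (proj₂ (triple-∈ a b c)))
          ba′ : adj H (to b) (to a) ≡ true
          ba′ = trans (sym (to-adj b∈ a∈)) (trans (adj-sym G b a) ab)
          bc′ : adj H (to b) (to c) ≡ true
          bc′ = trans (sym (to-adj b∈ c∈)) bc
          a≢c′ : to a ≢ to c
          a≢c′ eq = a≢c (to-injective a∈ c∈ eq)
          loop : ∀ {x y} → adj H x y ≡ true → x ≢ y
          loop xy refl = true≢false (trans (sym xy) (adj-irrefl H _))
          by : Dec (to b ∈ C) → adj H (to a) (to c) ≡ true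
          by (yes b′∈C) = complete (to a) (to c) (into-C b′∈C ba′) (into-C b′∈C bc′) a≢c′
          by (no  b′∉C) = ⊥-elim (few-outside (¬true b′∉C) (outside-C (¬true b′∉C) ba′) (outside-C (¬true b′∉C) bc′)
            (loop ba′) (loop bc′) a≢c′)

      -- If the closed neighbourhood `ball` of `u` missed a vertex, an edge would leave it, and with
      -- `u` that edge would form an induced path on three vertices.
      G-complete : ∀ u v → u ≢ v → adj G u v ≡ true
      G-complete u v u≢v = by (∈? v ball)
        where
        ball = nbrs G u ⊕ u
        by : Dec (v ∈ ball) → adj G u v ≡ true
        by (yes v∈ball) = nbrs-∈ G (trans (sym (⊕-other (nbrs G u) (u≢v ∘ sym))) v∈ball)
        by (no v∉ball) = ⊥-elim (go (crossing {G = G} cG ball (∈-full u) (⊕-self (nbrs G u) u) (∈-full v)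
            (¬true v∉ball)))
          where
          go : (∃₂ λ p q → (p ∈ full × p ∈ ball) × (q ∈ full × q ∉ ball) × adj G p q ≡ true) → ⊥
          go (p , q , (_ , p∈ball) , (_ , q∉ball) , pq) with p ≟ u
          ... | yes refl = ∈-∉ ball (⊕-⊇ (nbrs G p) p q (∈-nbrs G pq)) q∉ball
          ... | no p≢u = ∈-∉ ball (⊕-⊇ (nbrs G u) u q
              (∈-nbrs G (no-path (nbrs-∈ G (trans (sym (⊕-other (nbrs G u) p≢u)) p∈ball)) pq u≢q))) q∉ball
            where
            u≢q : u ≢ q
            u≢q refl = ∈-∉ ball (⊕-self (nbrs G u) u) q∉ball

      impossible : ⊥
      impossible = go (∃-outside C full (subst₂ ℕ._<_ (sym ∣C∣) (sym (trans ∣full∣ n≡))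
          (s≤s (s≤s (s≤s (ℕ.n≤1+n j))))))
                      (∃-outside none C (subst₂ ℕ._<_ (sym (∣none∣ {n})) (sym ∣C∣) (s≤s z≤n)))
        where
        go : (∃ λ x → x ∈ full × x ∉ C) → (∃ λ c → c ∈ C × c ∉ none) → ⊥
        -- The repeated entry makes the triple the nonadjacent pair {c, x}; a card of `H` containing
        -- it has a complete counterpart in `G`.
        go (x , _ , x∉C) (c , c∈C , _) = image (extend-card (triple c c x) (triple≤3 c c x))
          where
          image : (∃ λ S → triple c c x ⊆ S × ∣ S ∣ ≡ suc j) → ⊥
          image (S , sub , sz) = true≢false (trans (sym (trans (to-adj c∈ x∈) (G-complete (to c) (to x) distinct)))
              (closed c x c∈C x∉C))
            where
            open Iso (Matching.iso (Matching-sym m) S sz)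
            c∈ = sub c (proj₁ (triple-∈ c c x))
            x∈ = sub x (proj₂ (proj₂ (triple-∈ c c x)))
            distinct : to c ≢ to x
            distinct eq = ∈-∉ C (subst (_∈ C) (to-injective c∈ x∈ eq) c∈C) x∉C

    module Cycle (low : ∀ v → v ∈ C → deg H v ℕ.≤ 2) where

      outside≤1 : ∀ v → v ∉ C → deg H v ℕ.≤ 1
      outside≤1 v v∉C = deg≤-from H v (λ w → ⟦ not (mem C w) ⟧ - ind (v ≟ w)) le
        (ℤ.≤-reflexive (trans (∑-- _ _) (cong₂ _-_ co-C (∑-once v))))
        where
        le : ∀ w → ⟦ adj H v w ⟧ ≤ ⟦ not (mem C w) ⟧ - ind (v ≟ w)
        le w with v ≟ w
        ... | yes refl = ℤ.≤-reflexive (trans (cong ⟦_⟧ (adj-irrefl H v)) (sym (cong (λ b → ⟦ not b ⟧ - 1ℤ) v∉C)))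
        ... | no  _ with adj H v w in vw
        ...   | false = ℤ.≤-trans (0≤⟦⟧ (not (mem C w))) (ℤ.≤-reflexive (sym (ℤ.+-identityʳ _)))
        ...   | true  = ℤ.≤-reflexive (sym (cong (λ b → ⟦ not b ⟧ - 0ℤ) (outside-C v∉C vw)))

      H≤2 : ∀ v → deg H v ℕ.≤ 2
      H≤2 v with mem C v in eq
      ... | true  = low v eq
      ... | false = ℕ.m≤n⇒m≤1+n (outside≤1 v eq)

      binom-nonneg : ∀ d i → 0ℤ ≤ binom d i
      binom-nonneg d       zero    = +≤+ z≤n
      binom-nonneg zero    (suc i) = +≤+ z≤n
      binom-nonneg (suc d) (suc i) = 0≤+ (binom-nonneg d i) (binom-nonneg d (suc i))

      low-binom : ∀ d → d ℕ.≤ 2 → binom d 3 ≡ 0ℤ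
      low-binom 0 _ = refl
      low-binom 1 _ = refl
      low-binom 2 _ = refl
      low-binom (suc (suc (suc d))) (s≤s (s≤s ()))

      binom-low : ∀ d → binom d 3 ≡ 0ℤ → d ℕ.≤ 2
      binom-low 0 _ = z≤n
      binom-low 1 _ = s≤s z≤n
      binom-low 2 _ = s≤s (s≤s z≤n)
      binom-low (suc (suc (suc d))) eq = ⊥-elim (absurd (subst (1ℤ ≤_) eq (positive d)))
        where
        absurd : ¬ 1ℤ ≤ 0ℤ
        absurd (+≤+ ())
        positive : ∀ d → 1ℤ ≤ binom (3 ℕ.+ d) 3
        positive zero    = ℤ.≤-refl
        positive (suc d) = ℤ.≤-trans (positive d)
            (≤-from (binom-nonneg (3 ℕ.+ d) 2) (ring (binom (3 ℕ.+ d) 2) (binom (3 ℕ.+ d) 3)))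
          where
          ring : ∀ x y → x ≡ x + y - y
          ring = solve-∀

      -- The number of stars with three leaves is zero in `H`, hence in `G`. Such stars have four
      -- vertices and so fit into a card.
      G≤2 : ∀ v → deg G v ℕ.≤ 2
      G≤2 v = binom-low (deg G v) (∑-vanish (λ v → binom-nonneg (deg G v) 3)
        (ℤ.≤-reflexive (trans (moments m k≤n (s≤s 3≤j)) (trans (∑-cong (λ v → low-binom (deg H v) (H≤2 v))) ∑-0))) v)

      -- The degree sum of `H` is at most 2(j + 2) + 2, which is less than 2n = 2(j + 4).
      leaf : ∃ λ u → deg G u ℕ.≤ 1
      leaf with Fin.any? (λ u → deg G u ℕ.≤? 1)
      ... | yes u = u
      ... | no ¬u = ⊥-elim (absurd-≤ (0≤+ (gap lower) (gap upper))
          (solve-gap (degsum G) (degsum H) (pos j) (degsum-eq m k≤n 2≤k)))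
        where
        lower : pos 2 * (pos 4 + pos j) ≤ degsum G
        lower = subst (_≤ degsum G) (trans (∑-* (pos 2) (λ _ → 1ℤ)) (cong (pos 2 *_) (trans (∑-1 n) (cong pos n≡))))
          (∑-mono {f = λ _ → pos 2 * 1ℤ} (λ v → +≤+ (ℕ.≰⇒> (λ le → ¬u (v , le)))))
        upper : degsum H ≤ pos 2 * (pos 2 + pos j) + pos 2
        upper = ℤ.≤-trans (∑-mono {g = λ v → pos 2 * ⟦ mem C v ⟧ + ⟦ not (mem C v) ⟧} le)
          (ℤ.≤-reflexive (trans (∑-+ _ _) (cong₂ _+_
              (trans (∑-* (pos 2) _) (cong (pos 2 *_) (trans (sym (∣∣≡∑ C)) (cong pos ∣C∣)))) co-C)))
          where
          le : ∀ v → pos (deg H v) ≤ pos 2 * ⟦ mem C v ⟧ + ⟦ not (mem C v) ⟧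
          le v with mem C v in eq
          ... | true  = +≤+ (low v eq)
          ... | false = +≤+ (outside≤1 v eq)
        solve-gap : ∀ g h x → g ≡ h → (g - pos 2 * (pos 4 + x)) + (pos 2 * (pos 2 + x) + pos 2 - h) ≡ -[1+ 1 ]
        solve-gap g h x refl = ring g x
          where
          ring : ∀ g x → (g - pos 2 * (pos 4 + x)) + (pos 2 * (pos 2 + x) + pos 2 - g) ≡ -[1+ 1 ]
          ring = solve-∀

      -- Attached vertices are at most as many as boundary edges. Their number is the degree sum
      -- over `R` minus twice the edges inside, and a connected `R` has at least j - 1 of these. So
      -- `s` is the amount by which the degree sum falls short of 2j.
      #attached≤ : ∀ R s → ∣ R ∣ ≡ j → Conn G R → ∑ (λ v → ⟦ mem R v ⟧ * pos (deg G v)) ≤ pos 2 * pos j - s →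
          #attached G R ≤ pos 2 - s
      #attached≤ R s sz cR degs = ≤-from (0≤+ (0≤+ (gap (#attached≤boundary G R)) (gap degs)) (gap tree))
          (solve-gap (#attached G R) (boundary G R) (inner G R) _ (pos j) s (degsum-inside G R))
        where
        tree : pos 2 * (pos j - 1ℤ) ≤ inner G R
        tree = subst (λ x → pos 2 * x ≤ inner G R) (pred (ℕ.≤-trans (s≤s z≤n) 3≤j))
          (tree-edges {G = G} (j ∸ 1) cR (proj₂ (nonempty R sz))
              (trans sz (sym (ℕ.m+[n∸m]≡n (ℕ.≤-trans (s≤s z≤n) 3≤j)))))
          where
          pred : 1 ℕ.≤ j → pos (j ∸ 1) ≡ pos j - 1ℤ
          pred (s≤s {n = i} _) = ring (pos i)
            where
            ring : ∀ x → x ≡ 1ℤ + x - 1ℤ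
            ring = solve-∀
        solve-gap : ∀ t b i d x s → d ≡ i + b → (b - t) + (pos 2 * x - s - d) + (i - pos 2 * (x - 1ℤ)) ≡ pos 2 - s - t
        solve-gap t b i d x s refl = ring t b i x s
          where
          ring : ∀ t b i x s → (b - t) + (pos 2 * x - s - (i + b)) + (i - pos 2 * (x - 1ℤ)) ≡ pos 2 - s - t
          ring = solve-∀

      degs≤ : ∀ R → ∣ R ∣ ≡ j → ∑ (λ v → ⟦ mem R v ⟧ * pos (deg G v)) ≤ pos 2 * pos j - 0ℤ
      degs≤ R sz = ℤ.≤-trans (∑-mono (λ v → *-monoʳ-on (mem R v) {pos (deg G v)} {pos 2} (λ _ → +≤+ (G≤2 v))))
        (ℤ.≤-reflexive (trans (∑-*ʳ (λ v → ⟦ mem R v ⟧) (pos 2))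
            (trans (cong (_* pos 2) (trans (sym (∣∣≡∑ R)) (cong pos sz))) (ring (pos j)))))
        where
        ring : ∀ x → x * pos 2 ≡ pos 2 * x - 0ℤ
        ring = solve-∀

      degs< : ∀ R → ∣ R ∣ ≡ j → ∀ {u} → u ∈ R → deg G u ℕ.≤ 1 → ∑ (λ v → ⟦ mem R v ⟧ * pos (deg G v)) ≤ pos 2 * pos j
          - 1ℤ
      degs< R sz {u} u∈R du = ℤ.≤-trans (∑-mono {g = λ v → ⟦ mem R v ⟧ * pos 2 - ind (u ≟ v)} le)
        (ℤ.≤-reflexive (trans (∑-- _ _) (cong₂ _-_ (trans (∑-*ʳ (λ v → ⟦ mem R v ⟧) (pos 2))
          (trans (cong (_* pos 2) (trans (sym (∣∣≡∑ R)) (cong pos sz))) (ℤ.*-comm (pos j) (pos 2)))) (∑-once u))))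
        where
        le : ∀ v → ⟦ mem R v ⟧ * pos (deg G v) ≤ ⟦ mem R v ⟧ * pos 2 - ind (u ≟ v)
        le v with u ≟ v
        ... | yes refl rewrite u∈R = ℤ.≤-trans (ℤ.≤-reflexive (ℤ.*-identityˡ _)) (+≤+ du)
        ... | no  _ = ℤ.≤-trans (*-monoʳ-on (mem R v) {pos (deg G v)} {pos 2} (λ _ → +≤+ (G≤2 v)))
            (ℤ.≤-reflexive (sym (ℤ.+-identityʳ _)))

      impossible : ⊥
      impossible = go leaf
        where
        -- The defect is determined by the deck and zero for `H`; for `G` its terms are nonnegative,
        -- and a connected `R` around the leaf contributes at least 1.
        defect : Graph n → ℤ
        defect X = ∑[ j ] (λ R → ind (conn? X R) * (pos 2 - #attached X R))
        expand : ∀ w c t → w * (c * (pos 2 - t)) ≡ pos 2 * (w * c) - w * (c * t)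
        expand = solve-∀
        split : ∀ X → defect X ≡ pos 2 * ∑[ j ] (λ R → ind (conn? X R)) - ∑[ j ]
            (λ R → ind (conn? X R) * #attached X R)
        split X = trans (∑-cong (λ R → expand (ind (∣ R ∣ ℕ.≟ j)) (ind (conn? X R)) (#attached X R)))
          (trans (∑-- _ _) (cong (_- ∑[ j ] (λ R → ind (conn? X R) * #attached X R)) (∑-* (pos 2) _)))
        H-zero : defect H ≡ 0ℤ
        H-zero = trans (∑[]-cong j (λ R sz → zero-on R sz (conn? H R)))
            (trans (∑-cong (λ R → ℤ.*-zeroʳ (ind (∣ R ∣ ℕ.≟ j)))) ∑-0)
          where
          zero-on : ∀ R → ∣ R ∣ ≡ j → (c? : Dec (Conn H R)) → ind c? * (pos 2 - #attached H R) ≡ 0ℤ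
          zero-on R sz (yes c) = cong (λ t → 1ℤ * (pos 2 - t)) (two-attached R sz c)
          zero-on R sz (no _)  = refl
        G-zero : defect G ≡ 0ℤ
        G-zero = trans (split G) (trans (cong₂ _-_ (cong (pos 2 *_) (conn-count m k≤n (ℕ.n≤1+n j)))
            (attached-count m k≤n ℕ.≤-refl))
          (trans (sym (split H)) H-zero))
        go : (∃ λ u → deg G u ℕ.≤ 1) → ⊥
        go (u , du) = use (grow {G = G} cG {none ⊕ u} (λ x _ → ∈-full x) (conn-single {G = G} u) (⊕-self none u) {j}
            (subst (ℕ._≤ j) (sym (∣single∣ u)) (ℕ.≤-trans (s≤s z≤n) 3≤j))
            (subst (j ℕ.≤_) (sym (trans ∣full∣ n≡)) (ℕ.m≤n+m j 4)))
          where
          use : (∃ λ R → none ⊕ u ⊆ R × R ⊆ full × Conn G R × ∣ R ∣ ≡ j) → ⊥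
          use (R , u⊆R , _ , cR , sz) = absurd-≤ (gap (#attached≤ R 1ℤ sz cR (degs< R sz (u⊆R u (⊕-self none u)) du)))
            (solve-gap (#attached G R) (conn-value G R cR
                (∑[]-vanish j {λ R → ind (conn? G R) * (pos 2 - #attached G R)}
              (λ R sz → conn-case G R (λ c → gap (#attached≤ R 0ℤ sz c (degs≤ R sz))))
              (ℤ.≤-reflexive G-zero) R sz)))
            where
            solve-gap : ∀ t → pos 2 - t ≡ 0ℤ → pos 2 - 1ℤ - t ≡ -[1+ 0 ]
            solve-gap t eq = trans (ring t) (cong (_- 1ℤ) eq)
              where
              ring : ∀ t → pos 2 - 1ℤ - t ≡ pos 2 - t - 1ℤ
              ring = solve-∀

  two-missing-absurd : ⊥
  two-missing-absurd with Fin.any? (λ p → ∈? p C ×-dec (3 ℕ.≤? deg H p))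
  ... | no ¬p = Cycle.impossible (λ v v∈C → ℕ.≤-pred (ℕ.≰⇒> (λ le → ¬p (v , v∈C , le))))
  -- By `low-degree`, `p` is adjacent to all of `C`. Any other two vertices can then be removed
  -- without disconnecting `C`, as a star around `p` remains, so `pair-adjacent` applies to them.
  ... | yes (p , p∈C , 3≤p) = Complete.impossible complete
    where
    dominating : ∀ v → v ∈ C → v ≢ p → adj H p v ≡ true
    dominating v v∈C v≢p with adj H p v in pv
    ... | true  = refl
    ... | false = ⊥-elim (ℕ.<⇒≱ 3≤p (low-degree p∈C v∈C (v≢p ∘ sym) pv))
    complete : ∀ s t → s ∈ C → t ∈ C → s ≢ t → adj H s t ≡ true
    complete s t s∈C t∈C s≢t with s ≟ p | t ≟ p
    ... | yes refl | _        = dominating t t∈C (s≢t ∘ sym)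
    ... | no  s≢p  | yes refl = trans (adj-sym H s t) (dominating s s∈C s≢p)
    ... | no  s≢p  | no  t≢p  = pair-adjacent s∈C t∈C s≢t
        (conn-star {G = H} (∈-⊖ (C ⊖ s) (t≢p ∘ sym) (∈-⊖ C (s≢p ∘ sym) p∈C))
      (λ v v∈ v≢p → dominating v (⊖-⊆ C s v (⊖-⊆ (C ⊖ s) t v v∈)) v≢p))

-- Finite sequences of integers as polynomials

Σ< : ℕ → (ℕ → ℤ) → ℤ
Σ< zero    f = 0ℤ
Σ< (suc N) f = Σ< N f + f N

Σ<-cong : ∀ N {f g : ℕ → ℤ} → (∀ j → f j ≡ g j) → Σ< N f ≡ Σ< N g
Σ<-cong zero    eq = refl
Σ<-cong (suc N) eq = cong₂ _+_ (Σ<-cong N eq) (eq N)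

Vanishes≥ : ℕ → (ℕ → ℤ) → Set
Vanishes≥ N c = ∀ j → N ℕ.≤ j → c j ≡ 0ℤ

-- Multiplication and division by 1 − x.
Δ ∫ : (ℕ → ℤ) → ℕ → ℤ
Δ q zero    = q zero
Δ q (suc j) = q (suc j) - q j
∫ c j = Σ< (suc j) c

Δ-cong : ∀ {p q : ℕ → ℤ} → (∀ j → p j ≡ q j) → ∀ j → Δ p j ≡ Δ q j
Δ-cong eq zero    = eq zero
Δ-cong eq (suc j) = cong₂ _-_ (eq (suc j)) (eq j)

Δ∫ : ∀ c j → Δ (∫ c) j ≡ c j
Δ∫ c zero    = ℤ.+-identityˡ _
Δ∫ c (suc j) = ring (∫ c j) (c (suc j))
  where
  ring : ∀ x y → x + y - x ≡ y
  ring = solve-∀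

-- Exact division: the sum of the coefficients is the value at 1, and when it is zero the quotient
-- by 1 - x is a polynomial of degree one less.
∫-vanishes : ∀ N c → Vanishes≥ (suc N) c → Σ< (suc N) c ≡ 0ℤ → Vanishes≥ N (∫ c)
∫-vanishes N c van sum j N≤j = go (j ∸ N) j (ℕ.m∸n+n≡m N≤j)
  where
  go : ∀ d j → d ℕ.+ N ≡ j → ∫ c j ≡ 0ℤ
  go zero    j       refl = sum
  go (suc d) (suc j) eq   = cong₂ _+_ (go d j (ℕ.suc-injective eq))
    (van (suc j) (subst (suc N ℕ.≤_) eq (s≤s (ℕ.m≤n+m N d))))

summation-by-parts : ∀ N (c β : ℕ → ℤ) → Σ< N (λ j → ∫ c j * (β (suc j) - β j)) ≡ ∫ c N * β N - Σ< (suc N)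
    (λ j → c j * β j)
summation-by-parts zero c β = ring (c 0) (β 0)
  where
  ring : ∀ x y → 0ℤ ≡ (0ℤ + x) * y - (0ℤ + x * y)
  ring = solve-∀
summation-by-parts (suc N) c β = trans (cong (_+ ∫ c N * (β (suc N) - β N)) (summation-by-parts N c β))
    (ring (∫ c N) (β N) (Σ< (suc N) (λ j → c j * β j)) (β (suc N)) (c (suc N)))
  where
  ring : ∀ s b t b′ x → s * b - t + s * (b′ - b) ≡ (s + x) * b′ - (t + x * b′)
  ring = solve-∀

-- Division by 1 - x lowers the order of vanishing at 1 by one. In coefficients this is summation by
-- parts, with Pascal's rule for the differences of `binom j (suc i)` in `j`.
∫-moment : ∀ N c i → Σ< (suc N) c ≡ 0ℤ → Σ< (suc N) (λ j → c j * binom j (suc i)) ≡ 0ℤ →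
  Σ< N (λ j → ∫ c j * binom j i) ≡ 0ℤ
∫-moment N c i sum mom = trans (Σ<-cong N (λ j → cong (∫ c j *_) (pascal (binom j i) (binom j (suc i)))))
  (trans (summation-by-parts N c (λ j → binom j (suc i))) (cong₂ (λ a b → a * binom N (suc i) - b) sum mom))
  where
  pascal : ∀ x y → x ≡ x + y - y
  pascal = solve-∀

Δ^ : ℕ → (ℕ → ℤ) → ℕ → ℤ
Δ^ zero    q = q
Δ^ (suc e) q = Δ (Δ^ e q)

-- A polynomial of degree less than N + e whose coefficients are orthogonal to all
-- polynomials of degree less than e is a multiple of (1 − x)^e.
factorise : ∀ N e c → Vanishes≥ (e ℕ.+ N) c → (∀ i → i ℕ.< e → Σ< (e ℕ.+ N) (λ j → c j * binom j i) ≡ 0ℤ) →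
  ∃ λ q → Vanishes≥ N q × (∀ j → c j ≡ Δ^ e q j)
factorise N zero    c van mom = c , van , λ _ → refl
factorise N (suc e) c van mom = extract (factorise N e (∫ c) (∫-vanishes (e ℕ.+ N) c van sum)
    (λ i i<e → ∫-moment (e ℕ.+ N) c i sum (mom (suc i) (s≤s i<e))))
  where
  sum : Σ< (suc (e ℕ.+ N)) c ≡ 0ℤ
  sum = trans (Σ<-cong (suc (e ℕ.+ N)) (λ j → sym (ℤ.*-identityʳ (c j)))) (mom 0 (s≤s z≤n))
  extract : (∃ λ q → Vanishes≥ N q × (∀ j → ∫ c j ≡ Δ^ e q j)) → ∃ λ q → Vanishes≥ N q × (∀ j → c j ≡ Δ^ (suc e) q j)
  extract (q , van-q , eq) = q , van-q , λ j → trans (sym (Δ∫ c j)) (Δ-cong eq j)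

sgn : ℕ → ℤ
sgn zero    = 1ℤ
sgn (suc j) = - sgn j

sgn-bounds : ∀ j → (sgn j ≡ 1ℤ) ⊎ (sgn j ≡ -[1+ 0 ])
sgn-bounds zero = inj₁ refl
sgn-bounds (suc j) with sgn-bounds j
... | inj₁ eq = inj₂ (cong -_ eq)
... | inj₂ eq = inj₁ (cong -_ eq)

Δ-vanishes : ∀ {M q} → Vanishes≥ M q → Vanishes≥ (suc M) (Δ q)
Δ-vanishes van (suc j) (s≤s M≤j) = cong₂ _-_ (van (suc j) (ℕ.m≤n⇒m≤1+n M≤j)) (van j M≤j)

Δ^-vanishes : ∀ e {M q} → Vanishes≥ M q → Vanishes≥ (e ℕ.+ M) (Δ^ e q)
Δ^-vanishes zero    van = van
Δ^-vanishes (suc e) van = Δ-vanishes (Δ^-vanishes e van)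

-- Evaluation at −1.
alternating : ∀ M q → Vanishes≥ M q → Σ< (suc M) (λ j → sgn j * Δ q j) ≡ pos 2 * Σ< M (λ j → sgn j * q j)
alternating M q van = trans (go M) (trans (cong (λ t → pos 2 * Σ< M (λ j → sgn j * q j) + sgn M * t) (van M ℕ.≤-refl))
    (ring (pos 2 * Σ< M (λ j → sgn j * q j)) (sgn M)))
  where
  ring : ∀ x s → x + s * 0ℤ ≡ x
  ring = solve-∀
  step : ∀ x s a b → (pos 2 * x + s * a) + (- s) * (b - a) ≡ pos 2 * (x + s * a) + (- s) * b
  step = solve-∀
  go : ∀ M → Σ< (suc M) (λ j → sgn j * Δ q j) ≡ pos 2 * Σ< M (λ j → sgn j * q j) + sgn M * q M
  go zero    = refl
  go (suc M) = trans (cong (_+ (- sgn M) * (q (suc M) - q M)) (go M))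
      (step (Σ< M (λ j → sgn j * q j)) (sgn M) (q M) (q (suc M)))

2^ : ℕ → ℤ
2^ zero    = 1ℤ
2^ (suc e) = pos 2 * 2^ e

0≤2^ : ∀ e → 0ℤ ≤ 2^ e
0≤2^ zero    = +≤+ z≤n
0≤2^ (suc e) = 0≤* {pos 2} (+≤+ z≤n) (0≤2^ e)

-- Each factor 1 - x takes the value 2 at -1.
alternating^ : ∀ e M q → Vanishes≥ M q → Σ< (e ℕ.+ M) (λ j → sgn j * Δ^ e q j) ≡ 2^ e * Σ< M (λ j → sgn j * q j)
alternating^ zero    M q van = sym (ℤ.*-identityˡ _)
alternating^ (suc e) M q van = trans (alternating (e ℕ.+ M) (Δ^ e q) (Δ^-vanishes e van))
  (trans (cong (pos 2 *_) (alternating^ e M q van)) (sym (ℤ.*-assoc (pos 2) (2^ e) _)))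

-- The five lowest and two highest coefficients of (1 - x)^e times a quadratic polynomial, by
-- induction on `e`.
module Coefficients {q : ℕ → ℤ} (van : Vanishes≥ 3 q) where

  coeff-0 : ∀ e → Δ^ e q 0 ≡ q 0
  coeff-0 zero    = refl
  coeff-0 (suc e) = coeff-0 e

  coeff-1 : ∀ e → Δ^ e q 1 ≡ q 1 - pos e * q 0
  coeff-1 zero    = ring (q 1) (q 0)
    where
    ring : ∀ x y → x ≡ x - 0ℤ * y
    ring = solve-∀
  coeff-1 (suc e) = trans (cong₂ _-_ (coeff-1 e) (coeff-0 e)) (ring (pos e) (q 1) (q 0))
    where
    ring : ∀ e x y → x - e * y - y ≡ x - (1ℤ + e) * y
    ring = solve-∀

  coeff-2 : ∀ e → Δ^ e q 2 ≡ q 2 - pos e * q 1 + binom e 2 * q 0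
  coeff-2 zero    = ring (q 2) (q 1) (q 0)
    where
    ring : ∀ z x y → z ≡ z - 0ℤ * x + 0ℤ * y
    ring = solve-∀
  coeff-2 (suc e) = trans (cong₂ _-_ (coeff-2 e) (coeff-1 e)) (trans (ring (pos e) (binom e 2) (q 2) (q 1) (q 0))
      (cong (λ t → q 2 - pos (suc e) * q 1 + (t + binom e 2) * q 0) (sym (binom-1 e))))
    where
    ring : ∀ e t z x y → z - e * x + t * y - (x - e * y) ≡ z - (1ℤ + e) * x + (e + t) * y
    ring = solve-∀

  coeff-3 : ∀ e → Δ^ e q 3 ≡ - pos e * q 2 + binom e 2 * q 1 - binom e 3 * q 0
  coeff-3 zero    = trans (van 3 ℕ.≤-refl) (ring (q 2) (q 1) (q 0))
    where
    ring : ∀ z x y → 0ℤ ≡ - 0ℤ * z + 0ℤ * x - 0ℤ * y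
    ring = solve-∀
  coeff-3 (suc e) = trans (cong₂ _-_ (coeff-3 e) (coeff-2 e))
      (trans (ring (pos e) (binom e 2) (binom e 3) (q 2) (q 1) (q 0))
      (cong (λ t → - pos (suc e) * q 2 + (t + binom e 2) * q 1 - (binom e 2 + binom e 3) * q 0) (sym (binom-1 e))))
    where
    ring : ∀ e t u z x y → - e * z + t * x - u * y - (z - e * x + t * y) ≡ - (1ℤ + e) * z + (e + t) * x - (t + u) * y
    ring = solve-∀

  coeff-4 : ∀ e → Δ^ e q 4 ≡ binom e 2 * q 2 - binom e 3 * q 1 + binom e 4 * q 0
  coeff-4 zero    = trans (van 4 (s≤s (s≤s (s≤s z≤n)))) (ring (q 2) (q 1) (q 0))
    where
    ring : ∀ z x y → 0ℤ ≡ 0ℤ * z - 0ℤ * x + 0ℤ * y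
    ring = solve-∀
  coeff-4 (suc e) = trans (cong₂ _-_ (coeff-4 e) (coeff-3 e))
      (trans (ring (pos e) (binom e 2) (binom e 3) (binom e 4) (q 2) (q 1) (q 0))
      (cong (λ t → (t + binom e 2) * q 2 - (binom e 2 + binom e 3) * q 1 + (binom e 3 + binom e 4) * q 0)
          (sym (binom-1 e))))
    where
    ring : ∀ e t u w z x y → t * z - u * x + w * y - (- e * z + t * x - u * y) ≡ (e + t) * z - (t + u) * x + (u + w) *
        y
    ring = solve-∀

  coeff-top : ∀ e → Δ^ e q (e ℕ.+ 2) ≡ sgn e * q 2
  coeff-top zero    = sym (ℤ.*-identityˡ _)
  coeff-top (suc e) = trans (cong₂ _-_ (Δ^-vanishes e van (suc (e ℕ.+ 2)) (ℕ.≤-reflexive (ℕ.+-suc e 2)))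
      (coeff-top e)) (ring (sgn e) (q 2))
    where
    ring : ∀ s x → 0ℤ - s * x ≡ (- s) * x
    ring = solve-∀

  coeff-subtop : ∀ e → Δ^ e q (e ℕ.+ 1) ≡ sgn e * (q 1 - pos e * q 2)
  coeff-subtop zero    = ring (q 1) (q 2)
    where
    ring : ∀ x y → x ≡ 1ℤ * (x - 0ℤ * y)
    ring = solve-∀
  coeff-subtop (suc e) = trans (cong₂ _-_ (trans (cong (Δ^ e q) (sym (ℕ.+-suc e 1))) (coeff-top e)) (coeff-subtop e))
      (ring (sgn e) (pos e) (q 1) (q 2))
    where
    ring : ∀ s e x y → s * y - s * (x - e * y) ≡ (- s) * (x - (1ℤ + e) * y)
    ring = solve-∀

-- Degree lists

count : Graph n → ℕ → ℤ
count G j = ∑ (λ v → ind (deg G v ℕ.≟ j))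

0≤count : ∀ (G : Graph n) j → 0ℤ ≤ count G j
0≤count G j = ∑-nonneg (λ v → 0≤⟦⟧ (does (deg G v ℕ.≟ j)))

count-none : ∀ (G : Graph n) {j} → (∀ v → deg G v ≢ j) → count G j ≡ 0ℤ
count-none G {j} none = trans (∑-cong (λ v → ind-no (deg G v ℕ.≟ j) (none v))) ∑-0

count-three : ∀ (G : Graph n) {i j l} → i ≢ j → i ≢ l → j ≢ l → count G i + count G j + count G l ≤ pos n
count-three {n} G {i} {j} {l} i≢j i≢l j≢l = subst₂ _≤_ (trans (∑-+ _ _) (cong (_+ count G l) (∑-+ _ _))) (∑-1 n)
    (∑-mono le)
  where
  le : ∀ v → ind (deg G v ℕ.≟ i) + ind (deg G v ℕ.≟ j) + ind (deg G v ℕ.≟ l) ≤ 1ℤ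
  le v = by (deg G v) (deg G v ℕ.≟ i) (deg G v ℕ.≟ j) (deg G v ℕ.≟ l)
    where
    by : ∀ d (a : Dec (d ≡ i)) (b : Dec (d ≡ j)) (c : Dec (d ≡ l)) → ind a + ind b + ind c ≤ 1ℤ
    by d (yes refl) (yes eq)   c          = ⊥-elim (i≢j eq)
    by d (yes refl) (no _)     (yes eq)   = ⊥-elim (i≢l eq)
    by d (yes refl) (no _)     (no _)     = ℤ.≤-refl
    by d (no _)     (yes refl) (yes eq)   = ⊥-elim (j≢l eq)
    by d (no _)     (yes refl) (no _)     = ℤ.≤-refl
    by d (no _)     (no _)     (yes _)    = ℤ.≤-refl
    by d (no _)     (no _)     (no _)     = +≤+ z≤n

deg<n : ∀ (G : Graph n) v → deg G v ℕ.< n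
deg<n {n} G v = subst (ℕ._≤ n) (∣⊕∣ (nbrs G v) v (trans (mem-collect (adj G v) v) (adj-irrefl G v)))
    (size≤n (nbrs G v ⊕ v))

Σ<-∑ : ∀ N (g : ℕ → Fin n → ℤ) → Σ< N (λ j → ∑ (g j)) ≡ ∑ (λ v → Σ< N (λ j → g j v))
Σ<-∑ zero    g = sym ∑-0
Σ<-∑ (suc N) g = trans (cong (_+ ∑ (g N)) (Σ<-∑ N g)) (sym (∑-+ _ _))

Σ<-δ : ∀ N (f : ℕ → ℤ) d → d ℕ.< N → Σ< N (λ j → f j * ind (d ℕ.≟ j)) ≡ f d
Σ<-δ (suc N) f d (s≤s d≤N) with d ℕ.≟ N
... | yes refl = trans (cong₂ _+_ (before N ℕ.≤-refl)
    (trans (cong (f N *_) (ind-yes (N ℕ.≟ N) refl)) (ℤ.*-identityʳ (f N)))) (ℤ.+-identityˡ (f N))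
  where
  before : ∀ M → M ℕ.≤ N → Σ< M (λ j → f j * ind (N ℕ.≟ j)) ≡ 0ℤ
  before zero    _   = refl
  before (suc M) M<N = cong₂ _+_ (before M (ℕ.<⇒≤ M<N))
    (trans (cong (f M *_) (ind-no (N ℕ.≟ M) (λ { refl → ℕ.<-irrefl refl M<N }))) (ℤ.*-zeroʳ (f M)))
... | no d≢N = trans (cong₂ _+_ (Σ<-δ N f d (ℕ.≤∧≢⇒< d≤N d≢N))
    (trans (cong (f N *_) (ind-no (d ℕ.≟ N) d≢N)) (ℤ.*-zeroʳ (f N)))) (ℤ.+-identityʳ (f d))

degree-sum : ∀ (G : Graph n) (f : ℕ → ℤ) → Σ< n (λ j → f j * count G j) ≡ ∑ (λ v → f (deg G v))
degree-sum {n} G f = trans (Σ<-cong n (λ j → sym (∑-* (f j) _))) (trans (Σ<-∑ n (λ j v → f j * ind (deg G v ℕ.≟ j)))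
  (∑-cong (λ v → Σ<-δ n f (deg G v) (deg<n G v))))

module DegreeLists {e} {G H : Graph (e ℕ.+ 3)} (m : Matching e G H) (4≤e : 4 ℕ.≤ e) where

  diff : ℕ → ℤ
  diff j = count G j - count H j

  diff-sum : ∀ (f : ℕ → ℤ) → Σ< (e ℕ.+ 3) (λ j → f j * diff j) ≡ ∑ (λ v → f (deg G v)) - ∑ (λ v → f (deg H v))
  diff-sum f = trans (go (e ℕ.+ 3)) (cong₂ _-_ (degree-sum G f) (degree-sum H f))
    where
    ring : ∀ x y a g h → x - y + a * (g - h) ≡ x + a * g - (y + a * h)
    ring = solve-∀
    go : ∀ N → Σ< N (λ j → f j * diff j) ≡ Σ< N (λ j → f j * count G j) - Σ< N (λ j → f j * count H j)
    go zero    = refl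
    go (suc N) = trans (cong (_+ f N * diff N) (go N))
      (ring (Σ< N (λ j → f j * count G j)) (Σ< N (λ j → f j * count H j)) (f N) (count G N) (count H N))

  private
    beyond : ∀ (X : Graph (e ℕ.+ 3)) {j} → e ℕ.+ 3 ℕ.≤ j → count X j ≡ 0ℤ
    beyond X {j} n≤j = count-none X (λ v eq → ℕ.<⇒≱ (deg<n X v) (subst (e ℕ.+ 3 ℕ.≤_) (sym eq) n≤j))

    factors : ∃ λ q → Vanishes≥ 3 q × (∀ j → diff j ≡ Δ^ e q j)
    factors = factorise 3 e diff (λ j n≤j → cong₂ _-_ (beyond G n≤j) (beyond H n≤j))
      (λ i i<e → trans (Σ<-cong (e ℕ.+ 3) (λ j → ℤ.*-comm (diff j) (binom j i))) (trans (diff-sum (λ j → binom j i))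
        (trans (cong (_- ∑ (λ v → binom (deg H v) i)) (moments m (ℕ.m≤m+n e 3) i<e))
            (ℤ.+-inverseʳ (∑ (λ v → binom (deg H v) i))))))

    q = proj₁ factors
    van = proj₁ (proj₂ factors)
    expand = proj₂ (proj₂ factors)
    open Coefficients van

    -- The base case is 15 ≤ 16, belonging to seven vertices; from there the right side doubles
    -- while the left side grows by 2.
    2^-large : ∀ i → pos 2 * (pos i + pos 7) + 1ℤ ≤ 2^ (i ℕ.+ 4)
    2^-large zero    = +≤+ (ℕ.m≤m+n 15 1)
    2^-large (suc i) = ≤-from (0≤+ (0≤+ (gap (2^-large i)) (gap (2^-large i)))
        (0≤+ {pos 13} (+≤+ z≤n) (0≤+ {pos i} (+≤+ z≤n) (+≤+ z≤n))))
      (ring (pos i) (2^ (i ℕ.+ 4)))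
      where
      ring : ∀ x t → (t - (pos 2 * (x + pos 7) + 1ℤ)) + (t - (pos 2 * (x + pos 7) + 1ℤ)) + (pos 13 + (x + x)) ≡
        pos 2 * t - (pos 2 * (1ℤ + x + pos 7) + 1ℤ)
      ring = solve-∀

    large : pos 2 * pos (e ℕ.+ 3) + 1ℤ ≤ 2^ e
    large = subst (λ e → pos 2 * pos (e ℕ.+ 3) + 1ℤ ≤ 2^ e) (ℕ.m∸n+n≡m 4≤e)
      (subst (λ t → pos 2 * pos t + 1ℤ ≤ 2^ (e ∸ 4 ℕ.+ 4)) (sym (ℕ.+-assoc (e ∸ 4) 4 3)) (2^-large (e ∸ 4)))

    sgn-sum : ∀ (X : Graph (e ℕ.+ 3)) → ∑ (λ v → sgn (deg X v)) ≤ pos (e ℕ.+ 3) × - pos (e ℕ.+ 3) ≤ ∑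
        (λ v → sgn (deg X v))
    sgn-sum X = subst (∑ (λ v → sgn (deg X v)) ≤_) (∑-1 (e ℕ.+ 3)) (∑-mono (λ v → upper (deg X v))) ,
      subst (_≤ ∑ (λ v → sgn (deg X v))) (trans (∑-* -[1+ 0 ] (λ _ → 1ℤ))
          (trans (cong (-[1+ 0 ] *_) (∑-1 (e ℕ.+ 3))) (ℤ.-1*i≡-i _)))
        (∑-mono {f = λ _ → -[1+ 0 ] * 1ℤ} (λ v → lower (deg X v)))
      where
      upper : ∀ d → sgn d ≤ 1ℤ
      upper d with sgn-bounds d
      ... | inj₁ eq = ℤ.≤-reflexive eq
      ... | inj₂ eq = subst (_≤ 1ℤ) (sym eq) -≤+
      lower : ∀ d → -[1+ 0 ] ≤ sgn d
      lower d with sgn-bounds d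
      ... | inj₁ eq = subst (-[1+ 0 ] ≤_) (sym eq) -≤+
      ... | inj₂ eq = ℤ.≤-reflexive (sym eq)

    value : ℤ
    value = Σ< 3 (λ j → sgn j * q j)

    2^value : 2^ e * value ≡ ∑ (λ v → sgn (deg G v)) - ∑ (λ v → sgn (deg H v))
    2^value = trans (sym (alternating^ e 3 q van))
        (trans (Σ<-cong (e ℕ.+ 3) (λ j → cong (sgn j *_) (sym (expand j)))) (diff-sum sgn))

    -- Twice the number of vertices is less than 2^e, so the value at −1 vanishes.
    value≡0 : value ≡ 0ℤ
    value≡0 = by value 2^value
      where
      N = pos (e ℕ.+ 3)
      -- A nonzero integer `t` would make the left side at least 2^e in absolute value, while the
      -- right side is at most 2N; the two signs of `t` are treated separately.
      by : ∀ t → 2^ e * t ≡ ∑ (λ v → sgn (deg G v)) - ∑ (λ v → sgn (deg H v)) → t ≡ 0ℤ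
      by (pos 0) _ = refl
      by (pos (suc t)) eq = ⊥-elim (absurd-≤
          (0≤+ (0≤+ (0≤+ (gap (proj₁ (sgn-sum G))) (gap (proj₂ (sgn-sum H)))) (gap large))
          (0≤* {2^ e} {pos t} (0≤2^ e) (+≤+ z≤n)))
        (solve-gap (∑ (λ v → sgn (deg G v))) (∑ (λ v → sgn (deg H v))) N (2^ e) (pos t) eq))
        where
        solve-gap : ∀ g h N p t → p * (1ℤ + t) ≡ g - h → (N - g) + (h - - N) + (p - (pos 2 * N + 1ℤ)) + p * t ≡ -[1+ 0
            ]
        solve-gap g h N p t eq = trans (ring g h N p t) (trans (cong (λ x → (h - g) + x - 1ℤ) eq) (ring′ g h))
          where
          ring : ∀ g h N p t → (N - g) + (h - - N) + (p - (pos 2 * N + 1ℤ)) + p * t ≡ (h - g) + p * (1ℤ + t) - 1ℤ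
          ring = solve-∀
          ring′ : ∀ g h → (h - g) + (g - h) - 1ℤ ≡ -[1+ 0 ]
          ring′ = solve-∀
      by -[1+ t ] eq = ⊥-elim (absurd-≤ (0≤+
          (0≤+ (0≤+ (gap (proj₁ (sgn-sum H))) (gap (proj₂ (sgn-sum G)))) (gap large))
          (0≤* {2^ e} {pos t} (0≤2^ e) (+≤+ z≤n)))
        (solve-gap (∑ (λ v → sgn (deg G v))) (∑ (λ v → sgn (deg H v))) N (2^ e) (pos t) eq))
        where
        solve-gap : ∀ g h N p t → p * (- (1ℤ + t)) ≡ g - h → (N - h) + (g - - N) + (p - (pos 2 * N + 1ℤ)) + p * t ≡
            -[1+ 0 ]
        solve-gap g h N p t eq = trans (ring g h N p t) (trans (cong (λ x → (g - h) - x - 1ℤ) eq) (ring′ g h))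
          where
          ring : ∀ g h N p t → (N - h) + (g - - N) + (p - (pos 2 * N + 1ℤ)) + p * t ≡ (g - h) - p * (- (1ℤ + t)) - 1ℤ
          ring = solve-∀
          ring′ : ∀ g h → (g - h) - (g - h) - 1ℤ ≡ -[1+ 0 ]
          ring′ = solve-∀

  module Isolated (G₀ : count G 0 ≡ 0ℤ) (H₀ : count H 0 ≡ 1ℤ) where

    -- From q(0) = -1 and q(-1) = 0 it follows that q = -1 + (α - 1) x + α x².
    α : ℤ
    α = q 2

    private
      q₀ : q 0 ≡ -[1+ 0 ]
      q₀ = trans (sym (coeff-0 e)) (trans (sym (expand 0)) (cong₂ _-_ G₀ H₀))

      q₁ : q 1 ≡ α - 1ℤ
      q₁ = trans (ring (q 0) (q 1) (q 2)) (trans (cong₂ (λ x y → q 2 + x - y) q₀ value≡0) (ℤ.+-identityʳ _))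
        where
        ring : ∀ x y z → y ≡ z + x - (0ℤ + 1ℤ * x + (- 1ℤ) * y + (- - 1ℤ) * z)
        ring = solve-∀

    diff-1 : diff 1 ≡ (α - 1ℤ) - pos e * -[1+ 0 ]
    diff-1 = trans (expand 1) (trans (coeff-1 e) (cong₂ (λ x y → x - pos e * y) q₁ q₀))

    diff-2 : diff 2 ≡ α - pos e * (α - 1ℤ) + binom e 2 * -[1+ 0 ]
    diff-2 = trans (expand 2) (trans (coeff-2 e) (cong₂ (λ x y → q 2 - pos e * x + binom e 2 * y) q₁ q₀))

    diff-3 : diff 3 ≡ - pos e * α + binom e 2 * (α - 1ℤ) - binom e 3 * -[1+ 0 ]
    diff-3 = trans (expand 3) (trans (coeff-3 e)
        (cong₂ (λ x y → - pos e * q 2 + binom e 2 * x - binom e 3 * y) q₁ q₀))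

    diff-4 : diff 4 ≡ binom e 2 * α - binom e 3 * (α - 1ℤ) + binom e 4 * -[1+ 0 ]
    diff-4 = trans (expand 4) (trans (coeff-4 e)
        (cong₂ (λ x y → binom e 2 * q 2 - binom e 3 * x + binom e 4 * y) q₁ q₀))

    diff-top : diff (e ℕ.+ 2) ≡ sgn e * α
    diff-top = trans (expand (e ℕ.+ 2)) (coeff-top e)

    diff-subtop : diff (e ℕ.+ 1) ≡ sgn e * ((α - 1ℤ) - pos e * α)
    diff-subtop = trans (expand (e ℕ.+ 1)) (trans (coeff-subtop e) (cong (λ x → sgn e * (x - pos e * q 2)) q₁))

-- Excluding an isolated vertex by degree counts

-- Here e + 2 is n - 1: a vertex of this degree would be adjacent to the isolated one.
count-top : ∀ e {H : Graph (e ℕ.+ 3)} {x : Fin (e ℕ.+ 3)} → deg H x ≡ 0 → count H (e ℕ.+ 2) ≡ 0ℤ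
count-top e {H} {x} dx = count-none H λ v eq → by v eq (v ≟ x)
  where
  isolated : ∀ v → adj H v x ≡ false
  isolated v = trans (adj-sym H v x) (¬true (λ xv → ℕ.1+n≢0 (trans (∣⊖∣ (nbrs H x) v (∈-nbrs H xv)) dx)))
  by : ∀ v → deg H v ≡ e ℕ.+ 2 → Dec (v ≡ x) → ⊥
  by v eq (yes refl) = ℕ.1+n≢0 (sym (trans (trans (sym dx) eq) (ℕ.+-suc e 1)))
  by v eq (no v≢x) = ℕ.1+n≰n (subst₂ ℕ._≤_ (trans sz (cong (2 ℕ.+_) eq)) (ℕ.+-suc e 2) (size≤n (nbrs H v ⊕ v ⊕ x)))
    where
    v∉ : v ∉ nbrs H v
    v∉ = trans (mem-collect (adj H v) v) (adj-irrefl H v)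
    x∉ : x ∉ nbrs H v ⊕ v
    x∉ = trans (⊕-other (nbrs H v) (v≢x ∘ sym)) (trans (mem-collect (adj H v) x) (isolated v))
    sz : ∣ nbrs H v ⊕ v ⊕ x ∣ ≡ suc (suc (deg H v))
    sz = trans (∣⊕∣ (nbrs H v ⊕ v) x x∉) (cong suc (∣⊕∣ (nbrs H v) v v∉))

module _ {e} {G H : Graph (e ℕ.+ 3)} (m : Matching e G H) (4≤e : 4 ℕ.≤ e)
  (G₀ : count G 0 ≡ 0ℤ) (H₀ : count H 0 ≡ 1ℤ) (H-top : count H (e ℕ.+ 2) ≡ 0ℤ) where

  open DegreeLists m 4≤e
  open Isolated G₀ H₀

  private
    g h : ℕ → ℤ
    g = count G
    h = count H

    few : h 0 + h 2 + h (e ℕ.+ 1) ≤ pos (e ℕ.+ 3)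
    few = count-three H (λ ()) (λ eq → ℕ.1+n≢0 (sym (trans eq (ℕ.+-comm e 1))))
        (λ eq → ℕ.<⇒≢ (s≤s (ℕ.≤-trans (s≤s (s≤s z≤n)) 4≤e)) (trans eq (ℕ.+-comm e 1)))

    0≤top : 0ℤ ≤ sgn e * α
    0≤top = subst (0ℤ ≤_) (trans (sym (ℤ.+-identityʳ _)) (trans (cong (λ t → g (e ℕ.+ 2) - t) (sym H-top)) diff-top))
        (0≤count G (e ℕ.+ 2))

    0≤e-1 : 0ℤ ≤ pos e - 1ℤ
    0≤e-1 = gap (+≤+ (ℕ.≤-trans (s≤s z≤n) 4≤e))

    -- For even `e`, α is the number of vertices of degree n - 1 in `G`, hence nonnegative. As
    -- `diff 2` is e - C(e , 2) - (e - 1) α, the graph `H` has at least C(e , 2) - e ≥ n vertices of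
    -- degree 2, besides an isolated one.
    even : sgn e ≡ 1ℤ → pos 2 * pos e + pos 3 ≤ binom e 2 → ⊥
    even s large = absurd-≤ (0≤+ (0≤+ (0≤+ (0≤+ (gap few) (0≤count H (e ℕ.+ 1))) (0≤count G 2)) (gap large))
        (0≤* 0≤e-1 0≤α))
        (solve-gap (h 0) (h 2) (h (e ℕ.+ 1)) (g 2) (binom e 2) α (pos e) (pos (e ℕ.+ 3)) (ℤ.pos-+ e 3) H₀ diff-2)
      where
      0≤α : 0ℤ ≤ α
      0≤α = subst (0ℤ ≤_) (trans (cong (_* α) s) (ℤ.*-identityˡ α)) 0≤top
      solve-gap : ∀ h₀ h₂ h₃ g₂ T α e N → N ≡ e + pos 3 → h₀ ≡ 1ℤ → g₂ - h₂ ≡ α - e * (α - 1ℤ) + T * -[1+ 0 ] →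
        (N - (h₀ + h₂ + h₃)) + h₃ + g₂ + (T - (pos 2 * e + pos 3)) + (e - 1ℤ) * α ≡ -[1+ 0 ]
      solve-gap h₀ h₂ h₃ g₂ T α e N refl refl eq = trans (ring h₂ h₃ g₂ T α e)
          (trans (cong (λ d → e + pos 2 + d + (T - (pos 2 * e + pos 3)) + (e - 1ℤ) * α) eq) (ring′ T α e))
        where
        ring : ∀ h₂ h₃ g₂ T α e → ((e + pos 3) - (1ℤ + h₂ + h₃)) + h₃ + g₂ + (T - (pos 2 * e + pos 3)) + (e - 1ℤ) * α
            ≡
          e + pos 2 + (g₂ - h₂) + (T - (pos 2 * e + pos 3)) + (e - 1ℤ) * α
        ring = solve-∀
        ring′ : ∀ T α e → e + pos 2 + (α - e * (α - 1ℤ) + T * -[1+ 0 ]) + (T - (pos 2 * e + pos 3)) + (e - 1ℤ) * α ≡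
            -[1+ 0 ]
        ring′ = solve-∀

    -- For odd `e`, α cancels in the sum of `diff 2` and `diff (e + 1)`, which is e + 1 - C(e , 2).
    -- So `H` has at least n vertices of degree 2 or n - 2, besides an isolated one.
    odd : sgn e ≡ -[1+ 0 ] → pos 2 * pos e + pos 4 ≤ binom e 2 → ⊥
    odd s large = absurd-≤ (0≤+ (0≤+ (0≤+ (gap few) (0≤count G (e ℕ.+ 1))) (0≤count G 2)) (gap large))
        (solve-gap (h 0) (h 2) (h (e ℕ.+ 1)) (g 2) (g (e ℕ.+ 1)) (binom e 2) α (pos e) (pos (e ℕ.+ 3)) (ℤ.pos-+ e 3)
            H₀ diff-2
          (trans diff-subtop (cong (_* ((α - 1ℤ) - pos e * α)) s)))
      where
      solve-gap : ∀ h₀ h₂ h₃ g₂ g₃ T α e N → N ≡ e + pos 3 → h₀ ≡ 1ℤ → g₂ - h₂ ≡ α - e * (α - 1ℤ) + T * -[1+ 0 ] →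
        g₃ - h₃ ≡ -[1+ 0 ] * ((α - 1ℤ) - e * α) →
        (N - (h₀ + h₂ + h₃)) + g₃ + g₂ + (T - (pos 2 * e + pos 4)) ≡ -[1+ 0 ]
      solve-gap h₀ h₂ h₃ g₂ g₃ T α e N refl refl eq eq′ = trans (ring h₂ h₃ g₂ g₃ T e)
          (trans (cong₂ (λ d d′ → e + pos 2 + d + d′ + (T - (pos 2 * e + pos 4))) eq eq′) (ring′ T α e))
        where
        ring : ∀ h₂ h₃ g₂ g₃ T e → ((e + pos 3) - (1ℤ + h₂ + h₃)) + g₃ + g₂ + (T - (pos 2 * e + pos 4)) ≡
          e + pos 2 + (g₂ - h₂) + (g₃ - h₃) + (T - (pos 2 * e + pos 4))
        ring = solve-∀
        ring′ : ∀ T α e → e + pos 2 + (α - e * (α - 1ℤ) + T * -[1+ 0 ]) + -[1+ 0 ] * ((α - 1ℤ) - e * α) +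
          (T - (pos 2 * e + pos 4)) ≡ -[1+ 0 ]
        ring′ = solve-∀

  isolated-absurd-large : pos 2 * pos e + pos 3 ≤ binom e 2 → (sgn e ≡ -[1+ 0 ] → pos 2 * pos e + pos 4 ≤ binom e 2) →
      ⊥
  isolated-absurd-large large₁ large₂ with sgn-bounds e
  ... | inj₁ s = even s large₁
  ... | inj₂ s = odd s (large₂ s)

binom-2-large : ∀ i → pos 2 * pos (i ℕ.+ 7) + pos 4 ≤ binom (i ℕ.+ 7) 2
binom-2-large zero    = +≤+ (ℕ.m≤m+n 18 3)
binom-2-large (suc i) = ≤-from (0≤+ (gap (binom-2-large i))
    (gap (+≤+ {2} {i ℕ.+ 7} (ℕ.≤-trans (ℕ.m≤m+n 2 5) (ℕ.m≤n+m 7 i)))))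
  (trans (ring (pos (i ℕ.+ 7)) (binom (i ℕ.+ 7) 2))
    (cong (λ t → (t + binom (i ℕ.+ 7) 2) - (pos 2 * pos (suc i ℕ.+ 7) + pos 4)) (sym (binom-1 (i ℕ.+ 7)))))
  where
  ring : ∀ x t → t - (pos 2 * x + pos 4) + (x - pos 2) ≡ (x + t) - (pos 2 * (1ℤ + x) + pos 4)
  ring = solve-∀

module _ {G H : Graph 8} (m : Matching 5 G H) (G₀ : count G 0 ≡ 0ℤ) (H₀ : count H 0 ≡ 1ℤ) (H-top : count H 7 ≡ 0ℤ) where

  open DegreeLists m (ℕ.m≤m+n 4 1)
  open Isolated G₀ H₀

  private
    top : count G 7 ≡ -[1+ 0 ] * α
    top = trans (sym (ℤ.+-identityʳ _)) (trans (cong (λ t → count G 7 - t) (sym H-top)) diff-top)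

    by : ∀ a → α ≡ a → ⊥
    -- Now `diff 1` is 4 and `diff 4` is 5, so `G` would need nine vertices of degree 1 or 4.
    by (pos zero) α≡ = absurd-≤ (0≤+ (0≤+ (gap (count-three G {1} {4} {0} (λ ()) (λ ()) (λ ()))) (0≤count H 1))
        (0≤count H 4))
        (solve-gap (count G 0) (count G 1) (count G 4) (count H 1) (count H 4) α α≡ G₀ diff-1 diff-4)
      where
      solve-gap : ∀ g₀ g₁ g₄ h₁ h₄ α → α ≡ 0ℤ → g₀ ≡ 0ℤ → g₁ - h₁ ≡ (α - 1ℤ) - pos 5 * -[1+ 0 ] →
        g₄ - h₄ ≡ pos 10 * α - pos 10 * (α - 1ℤ) + pos 5 * -[1+ 0 ] → (pos 8 - (g₁ + g₄ + g₀)) + h₁ + h₄ ≡ -[1+ 0 ]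
      solve-gap g₀ g₁ g₄ h₁ h₄ α refl refl eq eq′ = trans (ring g₁ g₄ h₁ h₄) (cong₂ (λ d d′ → pos 8 - d - d′) eq eq′)
        where
        ring : ∀ g₁ g₄ h₁ h₄ → (pos 8 - (g₁ + g₄ + 0ℤ)) + h₁ + h₄ ≡ pos 8 - (g₁ - h₁) - (g₄ - h₄)
        ring = solve-∀
    by (pos (suc a)) α≡ = absurd-≤ (subst (0ℤ ≤_) (trans top (cong (-[1+ 0 ] *_) α≡)) (0≤count G 7)) refl
    -- With α = -(1 + a), `diff 3` and `diff 6` add up to -8 - 9a: `H` would have eight vertices of
    -- degree 3 or 6 besides the isolated one.
    by -[1+ a ] α≡ = absurd-≤ (0≤+ (0≤+ (0≤+ (gap (count-three H {0} {3} {6} (λ ()) (λ ()) (λ ()))) (0≤count G 3))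
        (0≤count G 6)) (0≤* {pos 9} {pos a} (+≤+ z≤n) (+≤+ z≤n)))
        (solve-gap (count H 0) (count G 3) (count G 6) (count H 3) (count H 6) α (pos a) α≡ H₀ diff-3 diff-subtop)
      where
      solve-gap : ∀ h₀ g₃ g₆ h₃ h₆ α a → α ≡ - (1ℤ + a) → h₀ ≡ 1ℤ → g₃ - h₃ ≡ - pos 5 * α + pos 10 * (α - 1ℤ) - pos 10
          * -[1+ 0 ] →
        g₆ - h₆ ≡ -[1+ 0 ] * ((α - 1ℤ) - pos 5 * α) → (pos 8 - (h₀ + h₃ + h₆)) + g₃ + g₆ + pos 9 * a ≡ -[1+ 0 ]
      solve-gap h₀ g₃ g₆ h₃ h₆ α a refl refl eq eq′ = trans (ring g₃ g₆ h₃ h₆ a)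
          (trans (cong₂ (λ d d′ → pos 7 + d + d′ + pos 9 * a) eq eq′) (ring′ a))
        where
        ring : ∀ g₃ g₆ h₃ h₆ a → (pos 8 - (1ℤ + h₃ + h₆)) + g₃ + g₆ + pos 9 * a ≡ pos 7 + (g₃ - h₃) + (g₆ - h₆) + pos
            9 * a
        ring = solve-∀
        ring′ : ∀ a → pos 7 + (- pos 5 * - (1ℤ + a) + pos 10 * (- (1ℤ + a) - 1ℤ) - pos 10 * -[1+ 0 ]) +
          -[1+ 0 ] * ((- (1ℤ + a) - 1ℤ) - pos 5 * - (1ℤ + a)) + pos 9 * a ≡ -[1+ 0 ]
        ring′ = solve-∀

  isolated-absurd-8 : ⊥
  isolated-absurd-8 = by α refl

module _ {G H : Graph 7} (m : Matching 4 G H) (G₀ : count G 0 ≡ 0ℤ) (H₀ : count H 0 ≡ 1ℤ) (H-top : count H 6 ≡ 0ℤ) where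

  open DegreeLists m (ℕ.m≤m+n 4 0)
  open Isolated G₀ H₀

  private
    top : count G 6 ≡ 1ℤ * α
    top = trans (sym (ℤ.+-identityʳ _)) (trans (cong (λ t → count G 6 - t) (sym H-top)) diff-top)

    by : ∀ a → α ≡ a → α ≡ 0ℤ
    by (pos zero) α≡ = α≡
    by -[1+ a ] α≡ = ⊥-elim (absurd-≤ (subst (0ℤ ≤_) (trans top (cong (1ℤ *_) α≡)) (0≤count G 6)) refl)
    -- With α = 1 + a, `diff 2` and `diff 5` add up to -9 - 6a: `H` would have nine vertices of
    -- degree 2 or 5.
    by (pos (suc a)) α≡ = ⊥-elim (absurd-≤
        (0≤+ (0≤+ (0≤+ (gap (count-three H {0} {2} {5} (λ ()) (λ ()) (λ ()))) (0≤count G 2)) (0≤count G 5))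
        (0≤* {pos 6} {pos a} (+≤+ z≤n) (+≤+ z≤n)))
        (solve-gap (count H 0) (count G 2) (count G 5) (count H 2) (count H 5) α (pos a) α≡ H₀ diff-2 diff-subtop))
      where
      solve-gap : ∀ h₀ g₂ g₅ h₂ h₅ α a → α ≡ 1ℤ + a → h₀ ≡ 1ℤ → g₂ - h₂ ≡ α - pos 4 * (α - 1ℤ) + pos 6 * -[1+ 0 ] →
        g₅ - h₅ ≡ 1ℤ * ((α - 1ℤ) - pos 4 * α) → (pos 7 - (h₀ + h₂ + h₅)) + g₂ + g₅ + pos 6 * a ≡ -[1+ 2 ]
      solve-gap h₀ g₂ g₅ h₂ h₅ α a refl refl eq eq′ = trans (ring g₂ g₅ h₂ h₅ a)
          (trans (cong₂ (λ d d′ → pos 6 + d + d′ + pos 6 * a) eq eq′) (ring′ a))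
        where
        ring : ∀ g₂ g₅ h₂ h₅ a → (pos 7 - (1ℤ + h₂ + h₅)) + g₂ + g₅ + pos 6 * a ≡ pos 6 + (g₂ - h₂) + (g₅ - h₅) + pos
            6 * a
        ring = solve-∀
        ring′ : ∀ a → pos 6 + ((1ℤ + a) - pos 4 * ((1ℤ + a) - 1ℤ) + pos 6 * -[1+ 0 ]) + 1ℤ *
            (((1ℤ + a) - 1ℤ) - pos 4 * (1ℤ + a)) + pos 6 * a ≡ -[1+ 2 ]
        ring′ = solve-∀

    α≡0 : α ≡ 0ℤ
    α≡0 = by α refl

  leaves-7 : count G 1 - count H 1 ≡ pos 3
  leaves-7 = trans diff-1 (cong (λ a → (a - 1ℤ) - pos 4 * -[1+ 0 ]) α≡0)

  hubs-7 : count G 4 - count H 4 ≡ pos 3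
  hubs-7 = trans diff-4 (cong (λ a → pos 6 * a - pos 4 * (a - 1ℤ) + 1ℤ * -[1+ 0 ]) α≡0)

-- Seven vertices

∑-pick-witness : ∀ {A : Set} ⦃ _ : Enum A ⦄ (p : A → Bool) t → 0ℤ ≤ t → 1ℤ + t ≤ ∑ (λ x → ⟦ p x ⟧) →
  ∃ λ a → p a ≡ true × t ≤ ∑ (λ x → ⟦ not (does (a ≟ x)) ∧ p x ⟧)
∑-pick-witness p t 0≤t le = extract (∑-witness p (ℤ.≤-trans (≤-from 0≤t (ring t)) le))
  where
  ring : ∀ t → t ≡ 1ℤ + t - 1ℤ
  ring = solve-∀
  extract : (∃ λ a → p a ≡ true) → ∃ λ a → p a ≡ true × t ≤ ∑ (λ x → ⟦ not (does (a ≟ x)) ∧ p x ⟧)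
  extract (a , pa) = a , pa , ≤-from (gap le)
      (trans (cong (_- (1ℤ + t)) total) (ring′ (∑ (λ x → ⟦ not (does (a ≟ x)) ∧ p x ⟧)) t))
    where
    ring′ : ∀ s t → 1ℤ + s - (1ℤ + t) ≡ s - t
    ring′ = solve-∀
    total : ∑ (λ x → ⟦ p x ⟧) ≡ 1ℤ + ∑ (λ x → ⟦ not (does (a ≟ x)) ∧ p x ⟧)
    total = trans (∑-pick a (λ x → ⟦ p x ⟧)) (cong₂ _+_ (cong ⟦_⟧ pa) (∑-cong (λ x →
      trans (cong (_* ⟦ p x ⟧) (sym (⟦⟧-not (does (a ≟ x))))) (sym (⟦⟧-∧ (not (does (a ≟ x))) (p x))))))

record ThreeWitnesses {A : Set} (P : A → Set) : Set where
  field
    {a b c}        : A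
    pa             : P a
    pb             : P b
    pc             : P c
    a≢b            : a ≢ b
    a≢c            : a ≢ c
    b≢c            : b ≢ c

three-witnesses : ∀ {A : Set} ⦃ _ : Enum A ⦄ {P : A → Set} (P? : ∀ a → Dec (P a)) → pos 3 ≤ ∑ (λ x → ind (P? x)) →
    ThreeWitnesses P
three-witnesses {A} {P} P? le = first (∑-pick-witness (does ∘ P?) (pos 2) (+≤+ z≤n) le)
  where
  distinct : ∀ {x y : A} {b} → not (does (x ≟ y)) ∧ b ≡ true → x ≢ y
  distinct {x} {y} eq x≡y = true≢false
      (trans (sym (true-does (x ≟ y) x≡y)) (not-true (proj₁ (∧-true {not (does (x ≟ y))} eq))))
  drop : ∀ {x y : A} {b} → not (does (x ≟ y)) ∧ b ≡ true → b ≡ true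
  drop {x} {y} eq = proj₂ (∧-true {not (does (x ≟ y))} eq)
  first : (∃ λ a → does (P? a) ≡ true × pos 2 ≤ ∑ (λ x → ⟦ not (does (a ≟ x)) ∧ does (P? x) ⟧)) → ThreeWitnesses P
  first (a , pa , le₂) = second (∑-pick-witness (λ x → not (does (a ≟ x)) ∧ does (P? x)) (pos 1) (+≤+ z≤n) le₂)
    where
    second : (∃ λ b → not (does (a ≟ b)) ∧ does (P? b) ≡ true ×
      pos 1 ≤ ∑ (λ y → ⟦ not (does (b ≟ y)) ∧ (not (does (a ≟ y)) ∧ does (P? y)) ⟧)) → ThreeWitnesses P
    second (b , pb , le₁) = third (∑-witness (λ y → not (does (b ≟ y)) ∧ (not (does (a ≟ y)) ∧ does (P? y))) le₁)
      where
      third : (∃ λ c → not (does (b ≟ c)) ∧ (not (does (a ≟ c)) ∧ does (P? c)) ≡ true) → ThreeWitnesses P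
      third (c , pc) = record
        { pa = does-true (P? a) pa ; pb = does-true (P? b) (drop pb) ; pc = does-true (P? c) (drop (drop pc))
        ; a≢b = distinct pb ; a≢c = distinct (drop pc) ; b≢c = distinct pc }

fromList : List (Fin n) → Subset n
fromList []       = none
fromList (x ∷ xs) = fromList xs ⊕ x

∉-fromList : ∀ {v : Fin n} {xs} → All (v ≢_) xs → v ∉ fromList xs
∉-fromList {v = v} []                     = ∉-none v
∉-fromList {xs = x ∷ xs} (v≢x ∷ v≢xs) = trans (⊕-other (fromList xs) v≢x) (∉-fromList v≢xs)

fromList-∉ : ∀ {v : Fin n} xs → v ∉ fromList xs → All (v ≢_) xs
fromList-∉ []       _  = []
fromList-∉ {v = v} (x ∷ xs) v∉ = v≢x ∷ fromList-∉ xs (trans (sym (⊕-other (fromList xs) v≢x)) v∉)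
  where
  v≢x : v ≢ x
  v≢x refl = ∈-∉ (fromList (v ∷ xs)) (⊕-self (fromList xs) v) v∉

fromList-∈ : ∀ {v : Fin n} xs → v ∈ fromList xs → v List.∈ xs
fromList-∈ {v = v} []       v∈ = ⊥-elim (∈-∉ none v∈ (∉-none v))
fromList-∈ {v = v} (x ∷ xs) v∈ with v ≟ x
... | yes v≡x = here v≡x
... | no  v≢x = there (fromList-∈ xs (trans (sym (⊕-other (fromList xs) v≢x)) v∈))

∣fromList∣ : ∀ {xs : List (Fin n)} → AllPairs _≢_ xs → ∣ fromList xs ∣ ≡ length xs
∣fromList∣ {n} []         = ∣none∣ {n}
∣fromList∣ {xs = x ∷ xs} (x≢ ∷ uniq) = trans (∣⊕∣ (fromList xs) x (∉-fromList x≢)) (cong suc (∣fromList∣ uniq))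

pairs-lookup : ∀ {R : Fin n → Fin n → Set} → (∀ {u v} → R u v → R v u) → ∀ {xs} → AllPairs R xs →
  ∀ {u v} → u List.∈ xs → v List.∈ xs → u ≢ v → R u v
pairs-lookup sym-R (r ∷ rs) (here refl) (here refl) u≢v = ⊥-elim (u≢v refl)
pairs-lookup sym-R (r ∷ rs) (here refl) (there v∈)  u≢v = All.lookup r v∈
pairs-lookup sym-R (r ∷ rs) (there u∈)  (here refl) u≢v = sym-R (All.lookup r u∈)
pairs-lookup sym-R (r ∷ rs) (there u∈)  (there v∈)  u≢v = pairs-lookup sym-R rs u∈ v∈ u≢v

∑-list : ∀ {xs : List (Fin n)} → AllPairs _≢_ xs → (∀ w → w List.∈ xs) → ∀ f → ∑ f ≡ ∑ᴸ xs f
∑-list {n} {xs} uniq cover f = begin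
  ∑ f                                                  ≡⟨ ∑-cong
      (λ w → trans (sym (ℤ.*-identityˡ (f w))) (cong (_* f w) (sym (once uniq (cover w))))) ⟩
  ∑ (λ w → ∑ᴸ xs (λ x → ind (x ≟ w)) * f w)            ≡⟨ spread xs ⟩
  ∑ᴸ xs f                                              ∎
  where
  open ≡-Reasoning
  absent : ∀ {w : Fin n} {ys} → All (w ≢_) ys → ∑ᴸ ys (λ x → ind (x ≟ w)) ≡ 0ℤ
  absent []                       = refl
  absent {w} {y ∷ ys} (w≢y ∷ rest) = cong₂ _+_ (ind-no (y ≟ w) (w≢y ∘ sym)) (absent rest)
  once : ∀ {w} {ys : List (Fin n)} → AllPairs _≢_ ys → w List.∈ ys → ∑ᴸ ys (λ x → ind (x ≟ w)) ≡ 1ℤ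
  once {w} (y≢ ∷ uniq) (here refl) = cong₂ _+_ (ind-yes (w ≟ w) refl) (absent y≢)
  once {w} {y ∷ ys} (y≢ ∷ uniq) (there w∈) = cong₂ _+_ (ind-no (y ≟ w) (All.lookup y≢ w∈)) (once uniq w∈)
  spread : ∀ ys → ∑ (λ w → ∑ᴸ ys (λ x → ind (x ≟ w)) * f w) ≡ ∑ᴸ ys f
  spread []       = ∑-0
  spread (y ∷ ys) = trans (∑-cong (λ w → ℤ.*-distribʳ-+ (f w) (ind (y ≟ w)) (∑ᴸ ys (λ x → ind (x ≟ w)))))
    (trans (∑-+ _ _) (cong₂ _+_ (∑-δ y f) (spread ys)))

∑-at-most-one : ∀ (p : Fin n → Bool) → (∀ v w → p v ≡ true → p w ≡ true → v ≡ w) → ∑ (λ v → ⟦ p v ⟧) ≤ 1ℤ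
∑-at-most-one p unique with Fin.any? (λ v → p v Bool.≟ true)
... | no ¬p = subst (_≤ 1ℤ) (sym (trans (∑-cong (λ v → cong ⟦_⟧ (¬true (λ pv → ¬p (v , pv))))) ∑-0)) (+≤+ z≤n)
... | yes (a , pa) = subst (∑ (λ v → ⟦ p v ⟧) ≤_) (∑-once a) (∑-mono le)
  where
  le : ∀ v → ⟦ p v ⟧ ≤ ind (a ≟ v)
  le v with p v in pv
  ... | false = 0≤⟦⟧ (does (a ≟ v))
  ... | true  = ℤ.≤-reflexive (sym (ind-yes (a ≟ v) (unique a v pa pv)))

Clique Independent : Graph n → Subset n → Set
Clique      G S = ∀ u v → u ∈ S → v ∈ S → u ≢ v → adj G u v ≡ true
Independent G S = ∀ u v → u ∈ S → v ∈ S → adj G u v ≡ false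

clique-Iso : ∀ {G H : Graph n} {S S′} → Iso G H S S′ → Clique G S → Clique H S′
clique-Iso {H = H} e c u v u∈ v∈ u≢v = trans
    (sym (trans (to-adj (from-∈ u∈) (from-∈ v∈)) (cong₂ (adj H) (to-from u∈) (to-from v∈))))
    (c (from u) (from v) (from-∈ u∈) (from-∈ v∈)
        (λ eq → u≢v (trans (sym (to-from u∈)) (trans (cong to eq) (to-from v∈)))))
  where open Iso e

independent-Iso : ∀ {G H : Graph n} {S S′} → Iso G H S S′ → Independent G S → Independent H S′
independent-Iso {H = H} e c u v u∈ v∈ = trans
    (sym (trans (to-adj (from-∈ u∈) (from-∈ v∈)) (cong₂ (adj H) (to-from u∈) (to-from v∈))))
    (c (from u) (from v) (from-∈ u∈) (from-∈ v∈))
  where open Iso e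

inner-clique : ∀ (G : Graph n) S {s} → Clique G S → ∣ S ∣ ≡ s → inner G S ≡ pos s * pos s - pos s
inner-clique G S {s} clique sz = trans (∑-cong (λ v → *-congʳ-on (mem S v) {degIn G S v} (λ v∈ →
    ∑-cong (λ w → *-congʳ-on (mem S w) {⟦ adj G v w ⟧} (λ w∈ → entry v w v∈ w∈)))))
  (trans (pairs (mem S)) (cong (λ t → t * t - t) (trans (sym (∣∣≡∑ S)) (cong pos sz))))
  where
  entry : ∀ v w → v ∈ S → w ∈ S → ⟦ adj G v w ⟧ ≡ 1ℤ - ind (v ≟ w)
  entry v w v∈ w∈ with v ≟ w
  ... | yes refl = cong ⟦_⟧ (adj-irrefl G v)
  ... | no  v≢w  = cong ⟦_⟧ (clique v w v∈ w∈ v≢w)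

-- A 4-clique and an independent 4-set cover all seven vertices, and then the three
-- vertices outside the clique send exactly three edges into it.
clique-independent-absurd : ∀ (H : Graph 7) {S I} → ∣ S ∣ ≡ 4 → ∣ I ∣ ≡ 4 → Clique H S → Independent H I →
  degsum H ≡ pos 18 → count H 0 ≡ 1ℤ → count H 1 ≡ 0ℤ → ⊥
clique-independent-absurd H {S} {I} ∣S∣ ∣I∣ clique indep D₁₈ H₀ H₁ =
  absurd-≤ (0≤+ (gap four≤) (gap four≤)) (solve-gap (boundary H S) (outer H S) _ (inner H S)
    (trans (sym (degsum-split H S)) D₁₈) (inner-clique H S clique ∣S∣) outer≡0 (degsum-outside H S))
  where
  meet≤1 : ∑ (λ v → ⟦ mem S v ∧ mem I v ⟧) ≤ 1ℤ
  meet≤1 = ∑-at-most-one (λ v → mem S v ∧ mem I v) λ v w pv pw → decidable-stable (v ≟ w) (λ v≢w → true≢false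
    (trans (sym (clique v w (proj₁ (∧-true {mem S v} pv)) (proj₁ (∧-true {mem S w} pw)) v≢w))
      (indep v w (proj₂ (∧-true {mem S v} pv)) (proj₂ (∧-true {mem S w} pw)))))
  uncovered : ∀ v → ⟦ not (mem S v) ⟧ * ⟦ not (mem I v) ⟧ ≡ 0ℤ
  uncovered = ∑-vanish (λ v → 0≤* (0≤⟦⟧ (not (mem S v))) (0≤⟦⟧ (not (mem I v)))) (≤-from (gap meet≤1) (sym total))
    where
    expand : ∀ v → ⟦ not (mem S v) ⟧ * ⟦ not (mem I v) ⟧ ≡ (1ℤ - ⟦ mem S v ⟧) - (⟦ mem I v ⟧ - ⟦ mem S v ∧ mem I v ⟧)
    expand v with mem S v | mem I v
    ... | true  | true  = refl
    ... | true  | false = refl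
    ... | false | true  = refl
    ... | false | false = refl
    total : 0ℤ - ∑ (λ v → ⟦ not (mem S v) ⟧ * ⟦ not (mem I v) ⟧) ≡ 1ℤ - ∑ (λ v → ⟦ mem S v ∧ mem I v ⟧)
    total = trans (cong (λ t → 0ℤ - t) (trans (∑-cong expand) (trans (∑-- _ _) (cong₂ _-_
        (trans (∑-- _ _) (cong₂ _-_ (∑-1 7) (trans (sym (∣∣≡∑ S)) (cong pos ∣S∣))))
        (trans (∑-- _ _) (cong (_- ∑ (λ v → ⟦ mem S v ∧ mem I v ⟧)) (trans (sym (∣∣≡∑ I)) (cong pos ∣I∣))))))))
      (ring (∑ (λ v → ⟦ mem S v ∧ mem I v ⟧)))
      where
      ring : ∀ x → 0ℤ - ((pos 7 - pos 4) - (pos 4 - x)) ≡ 1ℤ - x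
      ring = solve-∀
  cover : ∀ v → v ∉ S → v ∈ I
  cover v v∉S = ¬∉⇒∈ I (λ v∉I → 1≢0 (trans (sym (cong₂ (λ a b → ⟦ not a ⟧ * ⟦ not b ⟧) v∉S v∉I)) (uncovered v)))
    where
    1≢0 : 1ℤ ≢ 0ℤ
    1≢0 ()
  outer≡0 : outer H S ≡ 0ℤ
  outer≡0 = trans (∑-cong (λ v → trans (*-congʳ-on (not (mem S v)) {degOut H S v} {0ℤ} (λ v∉ →
      trans (∑-cong (λ w → trans (*-congʳ-on (not (mem S w)) {⟦ adj H v w ⟧} {0ℤ} (λ w∉ →
        cong ⟦_⟧ (indep v w (cover v (not-true v∉)) (cover w (not-true w∉))))) (ℤ.*-zeroʳ ⟦ not (mem S w) ⟧))) ∑-0))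
            (ℤ.*-zeroʳ ⟦ not (mem S v) ⟧))) ∑-0
  -- `H` has no vertex of degree 1, so outside the clique all degrees are at least 2, except for the
  -- isolated vertex. Subtracting 2 for it, wherever it lies, leaves 3 · 2 - 2 = 4, more than the
  -- three edges available.
  lower : ∑ (λ v → ⟦ not (mem S v) ⟧ * pos 2 - pos 2 * ind (deg H v ℕ.≟ 0)) ≤ ∑
      (λ v → ⟦ not (mem S v) ⟧ * pos (deg H v))
  lower = ∑-mono le
    where
    le : ∀ v → ⟦ not (mem S v) ⟧ * pos 2 - pos 2 * ind (deg H v ℕ.≟ 0) ≤ ⟦ not (mem S v) ⟧ * pos (deg H v)
    le v = by (not (mem S v)) (deg H v) (λ eq → one
        (trans (sym (ind-yes (deg H v ℕ.≟ 1) eq))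
        (∑-vanish (λ v → 0≤⟦⟧ (does (deg H v ℕ.≟ 1))) (ℤ.≤-reflexive H₁) v)))
      where
      one : 1ℤ ≡ 0ℤ → ⊥
      one ()
      by : ∀ b d → d ≢ 1 → ⟦ b ⟧ * pos 2 - pos 2 * ind (d ℕ.≟ 0) ≤ ⟦ b ⟧ * pos d
      by true  0 _  = ℤ.≤-refl
      by false 0 _  = -≤+
      by b     1 ≢1 = ⊥-elim (≢1 refl)
      by true  (suc (suc d)) _ = subst (pos 2 ≤_) (sym (ℤ.*-identityˡ (pos (suc (suc d))))) (+≤+ (s≤s (s≤s z≤n)))
      by false (suc (suc d)) _ = ℤ.≤-refl
  few : pos 4 ≤ ∑ (λ v → ⟦ not (mem S v) ⟧ * pos 2 - pos 2 * ind (deg H v ℕ.≟ 0))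
  few = ℤ.≤-reflexive (sym (trans (∑-- _ _)
      (cong₂ _-_ (trans (∑-*ʳ (λ v → ⟦ not (mem S v) ⟧) (pos 2))
      (cong (_* pos 2) (trans (#-complement S) (cong (λ s → pos 7 - pos s) ∣S∣))))
    (trans (∑-* (pos 2) _) (cong (pos 2 *_) H₀)))))
  four≤ : pos 4 ≤ ∑ (λ v → ⟦ not (mem S v) ⟧ * pos (deg H v))
  four≤ = ℤ.≤-trans few lower
  solve-gap : ∀ b o t i → i + b + (b + o) ≡ pos 18 → i ≡ pos 12 → o ≡ 0ℤ → t ≡ b + o → (t - pos 4) + (t - pos 4) ≡
      -[1+ 1 ]
  solve-gap b o t i eq refl refl refl = trans (ring b) (cong (_- pos 20) eq)
    where
    ring : ∀ b → (b + 0ℤ - pos 4) + (b + 0ℤ - pos 4) ≡ pos 12 + b + (b + 0ℤ) - pos 20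
    ring = solve-∀

module Seven {G H : Graph 7} (m : Matching 4 G H) (leaves : count G 1 - count H 1 ≡ pos 3)
    (hubs : count G 4 - count H 4 ≡ pos 3)
  (H₀ : count H 0 ≡ 1ℤ) where

  private
    at-least : ∀ g h → g - h ≡ pos 3 → 0ℤ ≤ h → pos 3 ≤ g
    at-least g h eq 0≤h = ≤-from 0≤h (trans (ring g h) (cong (λ t → g - t) eq))
      where
      ring : ∀ g h → h ≡ g - (g - h)
      ring = solve-∀

    row-sum : ∀ a b c → 0ℤ ≤ a → 0ℤ ≤ b → 0ℤ ≤ c → a + b + c ≤ 0ℤ → a ≡ 0ℤ × b ≡ 0ℤ × c ≡ 0ℤ
    row-sum a b c 0≤a 0≤b 0≤c le =
      ℤ.≤-antisym (≤-from (0≤+ (0≤+ (gap le) 0≤b) 0≤c) (ring₁ a b c)) 0≤a ,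
      ℤ.≤-antisym (≤-from (0≤+ (0≤+ (gap le) 0≤a) 0≤c) (ring₂ a b c)) 0≤b ,
      ℤ.≤-antisym (≤-from (0≤+ (0≤+ (gap le) 0≤a) 0≤b) (ring₃ a b c)) 0≤c
      where
      ring₁ : ∀ a b c → (0ℤ - (a + b + c)) + b + c ≡ 0ℤ - a
      ring₁ = solve-∀
      ring₂ : ∀ a b c → (0ℤ - (a + b + c)) + a + c ≡ 0ℤ - b
      ring₂ = solve-∀
      ring₃ : ∀ a b c → (0ℤ - (a + b + c)) + a + b ≡ 0ℤ - c
      ring₃ = solve-∀

    is-false : ∀ b → ⟦ b ⟧ ≡ 0ℤ → b ≡ false
    is-false false _ = refl

    is-true : ∀ b → 1ℤ - ⟦ b ⟧ ≡ 0ℤ → b ≡ true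
    is-true true _ = refl

  module Structure {z h₁ h₂ h₃ l₁ l₂ l₃ : Fin 7}
    (uniq : AllPairs _≢_ (z ∷ h₁ ∷ h₂ ∷ h₃ ∷ l₁ ∷ l₂ ∷ l₃ ∷ []))
    (cover : ∀ w → w List.∈ z ∷ h₁ ∷ h₂ ∷ h₃ ∷ l₁ ∷ l₂ ∷ l₃ ∷ [])
    (dh₁ : deg G h₁ ≡ 4) (dh₂ : deg G h₂ ≡ 4) (dh₃ : deg G h₃ ≡ 4)
    (dl₁ : deg G l₁ ≡ 1) (dl₂ : deg G l₂ ≡ 1) (dl₃ : deg G l₃ ≡ 1) where

    private
      a : Fin 7 → Fin 7 → ℤ
      a u v = ⟦ adj G u v ⟧

      a-sym : ∀ u v → a u v ≡ a v u
      a-sym u v = cong ⟦_⟧ (adj-sym G u v)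

      row : ∀ u {d} → deg G u ≡ d → a u z + (a u h₁ + (a u h₂ + (a u h₃ + (a u l₁ + (a u l₂ + (a u l₃ + 0ℤ)))))) ≡ pos
          d
      row u eq = trans (sym (∑-list uniq cover (a u))) (trans (sym (deg≡∑ G u)) (cong pos eq))

      out : Fin 7 → ℤ
      out h = a h l₁ + a h l₂ + a h l₃
      inn : Fin 7 → ℤ
      inn l = a l h₁ + a l h₂ + a l h₃

      double-count : (out h₁ + out h₂ + out h₃) ≡ (inn l₁ + inn l₂ + inn l₃)
      double-count = trans (ring (a h₁ l₁) (a h₁ l₂) (a h₁ l₃) (a h₂ l₁) (a h₂ l₂) (a h₂ l₃) (a h₃ l₁) (a h₃ l₂)
          (a h₃ l₃))
        (cong₂ _+_ (cong₂ _+_ (col l₁) (col l₂)) (col l₃))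
        where
        ring : ∀ a b c d e f g h i → a + b + c + (d + e + f) + (g + h + i) ≡ (a + d + g) + (b + e + h) + (c + f + i)
        ring = solve-∀
        col : ∀ l → a h₁ l + a h₂ l + a h₃ l ≡ inn l
        col l = cong₂ _+_ (cong₂ _+_ (a-sym h₁ l) (a-sym h₂ l)) (a-sym h₃ l)

      loop : ∀ u → a u u ≡ 0ℤ
      loop u = cong ⟦_⟧ (adj-irrefl G u)

      -- Besides the leaves, a hub of degree 4 has only three possible neighbours: the other two
      -- hubs and `z`. So its leaf neighbours exceed 1 by the number of these three that are
      -- missing; `s` is the loop entry.
      slack : ∀ x y w s l₁ l₂ l₃ → s ≡ 0ℤ → w + x + y + s + l₁ + l₂ + l₃ ≡ pos 4 →
        (l₁ + l₂ + l₃) - 1ℤ ≡ (1ℤ - x) + (1ℤ - y) + (1ℤ - w)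
      slack x y w s l₁ l₂ l₃ refl eq = trans (ring x y w l₁ l₂ l₃)
          (trans (cong (λ t → (t - 1ℤ) - x - y - w) eq) (ring′ x y w))
        where
        ring : ∀ x y w l₁ l₂ l₃ → (l₁ + l₂ + l₃) - 1ℤ ≡ ((w + x + y + 0ℤ + l₁ + l₂ + l₃) - 1ℤ) - x - y - w
        ring = solve-∀
        ring′ : ∀ x y w → (pos 4 - 1ℤ) - x - y - w ≡ (1ℤ - x) + (1ℤ - y) + (1ℤ - w)
        ring′ = solve-∀

      reorder : ∀ w p q r l₁ l₂ l₃ → w + (p + (q + (r + (l₁ + (l₂ + (l₃ + 0ℤ)))))) ≡ w + q + r + p + l₁ + l₂ + l₃
      reorder = solve-∀
      reorder′ : ∀ w p q r l₁ l₂ l₃ → w + (p + (q + (r + (l₁ + (l₂ + (l₃ + 0ℤ)))))) ≡ w + p + r + q + l₁ + l₂ + l₃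
      reorder′ = solve-∀
      reorder″ : ∀ w p q r l₁ l₂ l₃ → w + (p + (q + (r + (l₁ + (l₂ + (l₃ + 0ℤ)))))) ≡ w + p + q + r + l₁ + l₂ + l₃
      reorder″ = solve-∀

      hub-slack : Fin 7 → Fin 7 → Fin 7 → ℤ
      hub-slack h x y = (1ℤ - a h x) + (1ℤ - a h y) + (1ℤ - a h z)

      0≤hub : ∀ h x y → 0ℤ ≤ hub-slack h x y
      0≤hub h x y = 0≤+ (0≤+ (gap (⟦⟧≤1 (adj G h x))) (gap (⟦⟧≤1 (adj G h y)))) (gap (⟦⟧≤1 (adj G h z)))

      hub₁ : out h₁ - 1ℤ ≡ hub-slack h₁ h₂ h₃
      hub₁ = slack (a h₁ h₂) (a h₁ h₃) (a h₁ z) (a h₁ h₁) (a h₁ l₁) (a h₁ l₂) (a h₁ l₃) (loop h₁)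
        (trans (sym (reorder (a h₁ z) (a h₁ h₁) (a h₁ h₂) (a h₁ h₃) (a h₁ l₁) (a h₁ l₂) (a h₁ l₃))) (row h₁ dh₁))

      hub₂ : out h₂ - 1ℤ ≡ hub-slack h₂ h₁ h₃
      hub₂ = slack (a h₂ h₁) (a h₂ h₃) (a h₂ z) (a h₂ h₂) (a h₂ l₁) (a h₂ l₂) (a h₂ l₃) (loop h₂)
        (trans (sym (reorder′ (a h₂ z) (a h₂ h₁) (a h₂ h₂) (a h₂ h₃) (a h₂ l₁) (a h₂ l₂) (a h₂ l₃))) (row h₂ dh₂))

      hub₃ : out h₃ - 1ℤ ≡ hub-slack h₃ h₁ h₂
      hub₃ = slack (a h₃ h₁) (a h₃ h₂) (a h₃ z) (a h₃ h₃) (a h₃ l₁) (a h₃ l₂) (a h₃ l₃) (loop h₃)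
        (trans (sym (reorder″ (a h₃ z) (a h₃ h₁) (a h₃ h₂) (a h₃ h₃) (a h₃ l₁) (a h₃ l₂) (a h₃ l₃))) (row h₃ dh₃))

      leaf-rest : Fin 7 → ℤ
      leaf-rest l = a l l₁ + a l l₂ + a l l₃ + a l z

      0≤leaf : ∀ l → 0ℤ ≤ leaf-rest l
      0≤leaf l = 0≤+ (0≤+ (0≤+ (0≤⟦⟧ (adj G l l₁)) (0≤⟦⟧ (adj G l l₂))) (0≤⟦⟧ (adj G l l₃))) (0≤⟦⟧ (adj G l z))

      leaf : ∀ l → deg G l ≡ 1 → 1ℤ - inn l ≡ leaf-rest l
      leaf l dl = trans (cong (_- inn l) (sym (row l dl)))
          (ring (a l z) (a l h₁) (a l h₂) (a l h₃) (a l l₁) (a l l₂) (a l l₃))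
        where
        ring : ∀ w p q r x y t → w + (p + (q + (r + (x + (y + (t + 0ℤ)))))) - (p + q + r) ≡ x + y + t + w
        ring = solve-∀

      -- Every hub has at least one leaf and every leaf at most one hub.
      balance : (hub-slack h₁ h₂ h₃ + hub-slack h₂ h₁ h₃ + hub-slack h₃ h₁ h₂) +
          (leaf-rest l₁ + leaf-rest l₂ + leaf-rest l₃) ≡ 0ℤ
      balance = trans (cong₂ _+_ (cong₂ _+_ (cong₂ _+_ (sym hub₁) (sym hub₂)) (sym hub₃))
          (cong₂ _+_ (cong₂ _+_ (sym (leaf l₁ dl₁)) (sym (leaf l₂ dl₂))) (sym (leaf l₃ dl₃))))
        (cancel (out h₁) (out h₂) (out h₃) (inn l₁) (inn l₂) (inn l₃) double-count)
        where
        cancel : ∀ o₁ o₂ o₃ i₁ i₂ i₃ → o₁ + o₂ + o₃ ≡ i₁ + i₂ + i₃ → (o₁ - 1ℤ + (o₂ - 1ℤ) + (o₃ - 1ℤ)) +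
            (1ℤ - i₁ + (1ℤ - i₂) + (1ℤ - i₃)) ≡ 0ℤ
        cancel o₁ o₂ o₃ i₁ i₂ i₃ eq = trans (ring o₁ o₂ o₃ i₁ i₂ i₃)
            (trans (cong (_- (i₁ + i₂ + i₃)) eq) (ℤ.+-inverseʳ (i₁ + i₂ + i₃)))
          where
          ring : ∀ o₁ o₂ o₃ i₁ i₂ i₃ → (o₁ - 1ℤ + (o₂ - 1ℤ) + (o₃ - 1ℤ)) + (1ℤ - i₁ + (1ℤ - i₂) + (1ℤ - i₃)) ≡
              (o₁ + o₂ + o₃) - (i₁ + i₂ + i₃)
          ring = solve-∀

      hubs≡0 = row-sum (hub-slack h₁ h₂ h₃) (hub-slack h₂ h₁ h₃) (hub-slack h₃ h₁ h₂) (0≤hub h₁ h₂ h₃)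
          (0≤hub h₂ h₁ h₃) (0≤hub h₃ h₁ h₂)
        (≤-from (0≤+ (0≤+ (0≤leaf l₁) (0≤leaf l₂)) (0≤leaf l₃))
            (shift (hub-slack h₁ h₂ h₃ + hub-slack h₂ h₁ h₃ + hub-slack h₃ h₁ h₂)
            (leaf-rest l₁ + leaf-rest l₂ + leaf-rest l₃) balance))
        where
        shift : ∀ x y → x + y ≡ 0ℤ → y ≡ 0ℤ - x
        shift x y eq = trans (ring x y) (cong (_- x) eq)
          where
          ring : ∀ x y → y ≡ x + y - x
          ring = solve-∀

      leaves≡0 = row-sum (leaf-rest l₁) (leaf-rest l₂) (leaf-rest l₃) (0≤leaf l₁) (0≤leaf l₂) (0≤leaf l₃)
        (≤-from (0≤+ (0≤+ (0≤hub h₁ h₂ h₃) (0≤hub h₂ h₁ h₃)) (0≤hub h₃ h₁ h₂))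
            (shift (hub-slack h₁ h₂ h₃ + hub-slack h₂ h₁ h₃ + hub-slack h₃ h₁ h₂)
            (leaf-rest l₁ + leaf-rest l₂ + leaf-rest l₃) balance))
        where
        shift : ∀ x y → x + y ≡ 0ℤ → x ≡ 0ℤ - y
        shift x y eq = trans (ring x y) (cong (_- y) eq)
          where
          ring : ∀ x y → x ≡ x + y - y
          ring = solve-∀

      hub-adj : ∀ h x y → hub-slack h x y ≡ 0ℤ → adj G h x ≡ true × adj G h y ≡ true × adj G h z ≡ true
      hub-adj h x y eq with row-sum _ _ _ (gap (⟦⟧≤1 (adj G h x))) (gap (⟦⟧≤1 (adj G h y))) (gap (⟦⟧≤1 (adj G h z)))
          (ℤ.≤-reflexive eq)
      ... | p , q , r = is-true (adj G h x) p , is-true (adj G h y) q , is-true (adj G h z) r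

      leaf-adj : ∀ l → leaf-rest l ≡ 0ℤ → (adj G l l₁ ≡ false × adj G l l₂ ≡ false × adj G l l₃ ≡ false) × adj G l z ≡
          false
      leaf-adj l eq with row-sum (a l l₁ + a l l₂) (a l l₃) (a l z) (0≤+ (0≤⟦⟧ (adj G l l₁)) (0≤⟦⟧ (adj G l l₂)))
          (0≤⟦⟧ (adj G l l₃)) (0≤⟦⟧ (adj G l z)) (ℤ.≤-reflexive eq)
      ... | pq , r , t with row-sum (a l l₁) (a l l₂) 0ℤ (0≤⟦⟧ (adj G l l₁)) (0≤⟦⟧ (adj G l l₂)) ℤ.≤-refl
          (ℤ.≤-reflexive (trans (ℤ.+-identityʳ _) pq))
      ...   | p , q , _ = (is-false _ p , is-false _ q , is-false _ r) , is-false _ t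

      H₁ = hub-adj h₁ h₂ h₃ (proj₁ hubs≡0)
      H₂ = hub-adj h₂ h₁ h₃ (proj₁ (proj₂ hubs≡0))
      H₃ = hub-adj h₃ h₁ h₂ (proj₂ (proj₂ hubs≡0))
      L₁ = leaf-adj l₁ (proj₁ leaves≡0)
      L₂ = leaf-adj l₂ (proj₁ (proj₂ leaves≡0))
      L₃ = leaf-adj l₃ (proj₂ (proj₂ leaves≡0))

      adj-flip : ∀ {b u v} → adj G u v ≡ b → adj G v u ≡ b
      adj-flip {u = u} {v} = trans (adj-sym G v u)

      core rest : List (Fin 7)
      core = z ∷ h₁ ∷ h₂ ∷ h₃ ∷ []
      rest = z ∷ l₁ ∷ l₂ ∷ l₃ ∷ []

      core-clique : Clique G (fromList core)
      core-clique u v u∈ v∈ = pairs-lookup {R = λ u v → adj G u v ≡ true} adj-flip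
        ((adj-flip (proj₂ (proj₂ H₁)) ∷ adj-flip (proj₂ (proj₂ H₂)) ∷ adj-flip (proj₂ (proj₂ H₃)) ∷ []) ∷
         (proj₁ H₁ ∷ proj₁ (proj₂ H₁) ∷ []) ∷ (proj₁ (proj₂ H₂) ∷ []) ∷ [] ∷ [])
        (fromList-∈ core u∈) (fromList-∈ core v∈)

      rest-independent : Independent G (fromList rest)
      rest-independent u v u∈ v∈ with u ≟ v
      ... | yes refl = adj-irrefl G u
      ... | no u≢v   = pairs-lookup {R = λ u v → adj G u v ≡ false} adj-flip
        ((adj-flip (proj₂ L₁) ∷ adj-flip (proj₂ L₂) ∷ adj-flip (proj₂ L₃) ∷ []) ∷
         (proj₁ (proj₂ (proj₁ L₁)) ∷ proj₂ (proj₂ (proj₁ L₁)) ∷ []) ∷ (proj₂ (proj₂ (proj₁ L₂)) ∷ []) ∷ [] ∷ [])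
        (fromList-∈ rest u∈) (fromList-∈ rest v∈) u≢v

      core-unique : AllPairs _≢_ core
      core-unique = pick uniq
        where
        pick : AllPairs _≢_ (z ∷ h₁ ∷ h₂ ∷ h₃ ∷ l₁ ∷ l₂ ∷ l₃ ∷ []) → AllPairs _≢_ core
        pick ((a ∷ b ∷ c ∷ _) ∷ (d ∷ e ∷ _) ∷ (f ∷ _) ∷ _) = (a ∷ b ∷ c ∷ []) ∷ (d ∷ e ∷ []) ∷ (f ∷ []) ∷ [] ∷ []

      rest-unique : AllPairs _≢_ rest
      rest-unique = pick uniq
        where
        pick : AllPairs _≢_ (z ∷ h₁ ∷ h₂ ∷ h₃ ∷ l₁ ∷ l₂ ∷ l₃ ∷ []) → AllPairs _≢_ rest
        pick ((_ ∷ _ ∷ _ ∷ a) ∷ _ ∷ _ ∷ _ ∷ b) = a ∷ b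

      dz : deg G z ≡ 3
      dz = ℤ.+-injective (trans (deg≡∑ G z) (trans (∑-list uniq cover (a z)) (cong₂ _+_ (loop z)
        (cong₂ _+_ (on (adj-flip (proj₂ (proj₂ H₁))))
            (cong₂ _+_ (on (adj-flip (proj₂ (proj₂ H₂)))) (cong₂ _+_ (on (adj-flip (proj₂ (proj₂ H₃))))
        (cong₂ _+_ (on (adj-flip (proj₂ L₁)))
            (cong₂ _+_ (on (adj-flip (proj₂ L₂))) (cong₂ _+_ (on (adj-flip (proj₂ L₃))) (refl {x = 0ℤ}))))))))))
        where
        on : ∀ {u b} → adj G z u ≡ b → a z u ≡ ⟦ b ⟧
        on = cong ⟦_⟧

      over : ∀ (f : ℕ → ℤ) → ∑ (λ v → f (deg G v)) ≡ f 3 + (f 4 + (f 4 + (f 4 + (f 1 + (f 1 + (f 1 + 0ℤ))))))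
      over f = trans (∑-list uniq cover (λ v → f (deg G v)))
          (cong₂ _+_ (cong f dz) (cong₂ _+_ (cong f dh₁) (cong₂ _+_ (cong f dh₂)
        (cong₂ _+_ (cong f dh₃) (cong₂ _+_ (cong f dl₁)
            (cong₂ _+_ (cong f dl₂) (cong₂ _+_ (cong f dl₃) (refl {x = 0ℤ}))))))))

      -- The structure of `G` shows exactly three vertices of degree 1, and the difference `leaves`
      -- already accounts for all of them.
      no-H-leaf : count H 1 ≡ 0ℤ
      no-H-leaf = trans (ring (count G 1) (count H 1)) (cong₂ _-_ (over (λ d → ind (d ℕ.≟ 1))) leaves)
        where
        ring : ∀ g h → h ≡ g - (g - h)
        ring = solve-∀

    absurd : ⊥
    absurd = clique-independent-absurd H (to-size _ s) (to-size _ t) (clique-Iso (iso _ s) core-clique)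
        (independent-Iso (iso _ t) rest-independent)
        (trans (sym (degsum-eq m (ℕ.m≤m+n 4 3) (ℕ.m≤m+n 2 2))) (over pos)) H₀ no-H-leaf
      where
      open Matching m
      s = ∣fromList∣ core-unique
      t = ∣fromList∣ rest-unique

  private
    choose : ThreeWitnesses (λ v → deg G v ≡ 4) → ThreeWitnesses (λ v → deg G v ≡ 1) → ⊥
    choose h l = finish (∃-outside (fromList six) full
        (subst₂ ℕ._<_ (sym (∣fromList∣ six-unique)) (sym ∣full∣) ℕ.≤-refl))
      where
      module h = ThreeWitnesses h
      module l = ThreeWitnesses l
      six : List (Fin 7)
      six = h.a ∷ h.b ∷ h.c ∷ l.a ∷ l.b ∷ l.c ∷ []
      h≢l : ∀ {h l} → deg G h ≡ 4 → deg G l ≡ 1 → h ≢ l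
      h≢l p q h≡l = 4≢1 (trans (sym p) (trans (cong (deg G) h≡l) q))
        where
        4≢1 : 4 ≢ 1
        4≢1 ()
      six-unique : AllPairs _≢_ six
      six-unique = (h.a≢b ∷ h.a≢c ∷ h≢l h.pa l.pa ∷ h≢l h.pa l.pb ∷ h≢l h.pa l.pc ∷ []) ∷
        (h.b≢c ∷ h≢l h.pb l.pa ∷ h≢l h.pb l.pb ∷ h≢l h.pb l.pc ∷ []) ∷
        (h≢l h.pc l.pa ∷ h≢l h.pc l.pb ∷ h≢l h.pc l.pc ∷ []) ∷
        (l.a≢b ∷ l.a≢c ∷ []) ∷ (l.b≢c ∷ []) ∷ [] ∷ []
      finish : (∃ λ z → z ∈ full × z ∉ fromList six) → ⊥
      finish (z , _ , z∉) = Structure.absurd uniq cover h.pa h.pb h.pc l.pa l.pb l.pc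
        where
        uniq : AllPairs _≢_ (z ∷ six)
        uniq = fromList-∉ six z∉ ∷ six-unique
        cover : ∀ w → w List.∈ z ∷ six
        cover w = fromList-∈ (z ∷ six) (⊆-antisym-size {R = fromList (z ∷ six)} {full} (λ v _ → ∈-full v)
          (ℕ.≤-reflexive (trans ∣full∣ (sym (∣fromList∣ uniq)))) w (∈-full w))

  seven-absurd : ⊥
  seven-absurd = choose
    (three-witnesses (λ v → deg G v ℕ.≟ 4) (at-least (count G 4) (count H 4) hubs (0≤count H 4)))
    (three-witnesses (λ v → deg G v ℕ.≟ 1) (at-least (count G 1) (count H 1) leaves (0≤count H 1)))

-- Connectedness from the deck

has-neighbour : ∀ {X : Graph n} {S v y} → Conn X S → v ∈ S → y ∈ S → y ≢ v → deg X v ≢ 0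
has-neighbour {n} {X} {S} {v} {y} c v∈S y∈S y≢v dv = use (crossing {G = X} c (none ⊕ v) v∈S (⊕-self none v) y∈S
    (trans (⊕-other none y≢v) (∉-none y)))
  where
  use : (∃₂ λ p q → (p ∈ S × p ∈ none ⊕ v) × (q ∈ S × q ∉ none ⊕ v) × adj X p q ≡ true) → ⊥
  use (p , q , (_ , p∈) , _ , pq) = ℕ.1+n≢0
      (trans (∣⊖∣ (nbrs X v) q (∈-nbrs X (subst (λ p → adj X p q ≡ true) p≡v pq))) dv)
    where
    p≡v : p ≡ v
    p≡v = ∈-single p∈

-- The general estimate needs C(e , 2) ≥ 2e + 3, or 2e + 4 for odd `e`. This fails for 4 and 5,
-- which are treated separately; for 6 it holds with equality 15 = 15, and the odd condition is
-- vacuous there.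
isolated-absurd : ∀ e → 4 ℕ.≤ e → {G H : Graph (e ℕ.+ 3)} → Matching e G H →
  count G 0 ≡ 0ℤ → count H 0 ≡ 1ℤ → count H (e ℕ.+ 2) ≡ 0ℤ → ⊥
isolated-absurd 4 _ m G₀ H₀ H-top = Seven.seven-absurd m (leaves-7 m G₀ H₀ H-top) (hubs-7 m G₀ H₀ H-top) H₀
isolated-absurd 5 _ m G₀ H₀ H-top = isolated-absurd-8 m G₀ H₀ H-top
isolated-absurd 6 4≤e m G₀ H₀ H-top = isolated-absurd-large m 4≤e G₀ H₀ H-top ℤ.≤-refl (λ ())
isolated-absurd (suc (suc (suc (suc (suc (suc (suc i))))))) 4≤e m G₀ H₀ H-top =
  isolated-absurd-large m 4≤e G₀ H₀ H-top (ℤ.≤-trans (≤-from {e = 1ℤ} (+≤+ z≤n) (ring (pos 2 * pos (7 ℕ.+ i)))) bound)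
      (λ _ → bound)
  where
  bound : pos 2 * pos (7 ℕ.+ i) + pos 4 ≤ binom (7 ℕ.+ i) 2
  bound = subst (λ e → pos 2 * pos e + pos 4 ≤ binom e 2) (ℕ.+-comm i 7) (binom-2-large i)
  ring : ∀ x → 1ℤ ≡ x + pos 4 - (x + pos 3)
  ring = solve-∀
isolated-absurd 1 (s≤s ())
isolated-absurd 2 (s≤s (s≤s ()))
isolated-absurd 3 (s≤s (s≤s (s≤s ())))

-- Take a connected `S`, a vertex `a` outside adjacent to it, and grow `T` from `a` inside `S ⊕ a`;
-- containing `a` distinguishes `T` from `S`.
two-connected-sets : ∀ {e} {G : Graph (e ℕ.+ 3)} → 1 ℕ.≤ e → Conn G full →
  ∃₂ λ S T → (∣ S ∣ ≡ e × Conn G S) × (∣ T ∣ ≡ e × Conn G T) × S ≢ T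
two-connected-sets {suc e} {G} _ c = first
    (grow {G = G} c {none ⊕ zero} (λ x _ → ∈-full x) (conn-single {G = G} zero) (⊕-self none zero) {suc e}
    (subst (ℕ._≤ suc e) (sym (∣single∣ zero)) (s≤s z≤n)) (subst (suc e ℕ.≤_) (sym ∣full∣) (ℕ.m≤m+n (suc e) 3)))
  where
  Goal : Set
  Goal = ∃₂ λ S T → (∣ S ∣ ≡ suc e × Conn G S) × (∣ T ∣ ≡ suc e × Conn G T) × S ≢ T
  first : (∃ λ S → none ⊕ zero ⊆ S × S ⊆ full × Conn G S × ∣ S ∣ ≡ suc e) → Goal
  first (S , z⊆S , _ , cS , ∣S∣) = second
      (∃-outside S full (subst₂ ℕ._<_ (sym ∣S∣) (sym ∣full∣)
      (s≤s (ℕ.≤-trans (s≤s (ℕ.m≤m+n e 2)) (ℕ.≤-reflexive (sym (ℕ.+-suc e 2)))))))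
    where
    second : (∃ λ v → v ∈ full × v ∉ S) → Goal
    second (v , _ , v∉S) = third (crossing {G = G} c S (∈-full zero) (z⊆S zero (⊕-self none zero)) (∈-full v) v∉S)
      where
      third : (∃₂ λ p q → (p ∈ full × p ∈ S) × (q ∈ full × q ∉ S) × adj G p q ≡ true) → Goal
      third (p , a , (_ , p∈S) , (_ , a∉S) , pa) = fourth
          (grow {G = G} (conn-⊕ {G = G} cS p∈S a pa) {none ⊕ a} (single-⊆ (⊕-self S a)) (conn-single {G = G} a)
          (⊕-self none a) {suc e} (subst (ℕ._≤ suc e) (sym (∣single∣ a)) (s≤s z≤n))
              (subst (suc e ℕ.≤_) (sym (trans (∣⊕∣ S a a∉S) (cong suc ∣S∣))) (ℕ.n≤1+n (suc e))))
        where
        fourth : (∃ λ T → none ⊕ a ⊆ T × T ⊆ S ⊕ a × Conn G T × ∣ T ∣ ≡ suc e) → Goal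
        fourth (T , a⊆T , _ , cT , ∣T∣) = S , T , (∣S∣ , cS) , (∣T∣ , cT) , λ S≡T → ∈-∉ S
            (subst (a ∈_) (sym S≡T) (a⊆T a (⊕-self none a))) a∉S

module Contradiction {e} {G H : Graph (e ℕ.+ 3)} (m : Matching e G H) (4≤e : 4 ℕ.≤ e) (cG : Conn G full) (¬cH : ¬ Conn H full) where

  private
    n₀ = e ℕ.+ 3

    -- If `T` avoided `C`, then e + |C| ≤ e + 3 with |C| ≥ e would give e ≤ 3. A connected set
    -- meeting the closed set `C` stays inside it.
    meets : ∀ {C} → Conn H C → Closed H C → e ℕ.≤ ∣ C ∣ → ∀ T → Conn H T → ∣ T ∣ ≡ e → T ⊆ C
    meets {C} cC closed e≤C T cT ∣T∣ with Fin.any? (λ u → ∈? u T ×-dec ∈? u C)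
    ... | yes (u , u∈T , u∈C) = conn⊆closed {G = H} cT closed u∈T u∈C
    ... | no ¬meet = ⊥-elim (absurd-≤ (0≤+ (0≤+ (gap (+≤+ 4≤e)) (gap (+≤+ e≤C))) (gap disjoint))
        (solve-gap (pos e) (pos ∣ C ∣) _ (ℤ.pos-+ e 3)))
      where
      disjoint : pos e ≤ pos n₀ - pos ∣ C ∣
      disjoint = subst₂ _≤_ (trans (sym (∣∣≡∑ T)) (cong pos ∣T∣)) (#-complement C) (∑-mono le)
        where
        le : ∀ v → ⟦ mem T v ⟧ ≤ ⟦ not (mem C v) ⟧
        le v with mem T v in t | mem C v in c
        ... | true  | true  = ⊥-elim (¬meet (v , t , c))
        ... | true  | false = ℤ.≤-refl
        ... | false | b     = 0≤⟦⟧ (not b)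
      solve-gap : ∀ e c N → N ≡ e + pos 3 → (e - pos 4) + (c - e) + (N - c - e) ≡ -[1+ 0 ]
      solve-gap e c N refl = ring e c
        where
        ring : ∀ e c → (e - pos 4) + (c - e) + (e + pos 3 - c - e) ≡ -[1+ 0 ]
        ring = solve-∀

    not-full : ∀ {C} → Conn H C → ∣ C ∣ ≢ n₀
    not-full {C} cC eq = ¬cH (subst (Conn H) (⊆-antisym {R = C} {full} (λ v _ → ∈-full v)
      (⊆-antisym-size {R = C} {full} (λ v _ → ∈-full v) (ℕ.≤-reflexive (trans ∣full∣ (sym eq))))) cC)

    all-but-one : ∀ {C} → Conn H C → Closed H C → ∣ C ∣ ≡ e ℕ.+ 2 → ⊥
    all-but-one {C} cC closed ∣C∣ = use (∃-outside C full
        (subst₂ ℕ._<_ (sym ∣C∣) (sym ∣full∣) (ℕ.≤-reflexive (sym (ℕ.+-suc e 2)))))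
      where
      use : (∃ λ x → x ∈ full × x ∉ C) → ⊥
      use (x , _ , x∉C) = isolated-absurd e 4≤e m G₀ H₀ (count-top e {H} {x} dx)
        where
        only : ∀ v → v ≢ x → v ∈ C
        only v v≢x = trans (sym (⊕-other C v≢x)) (⊆-antisym-size {R = C ⊕ x} {full} (λ w _ → ∈-full w)
          (ℕ.≤-reflexive (trans ∣full∣ (sym (trans (∣⊕∣ C x x∉C) (trans (cong suc ∣C∣) (sym (ℕ.+-suc e 2))))))) v
              (∈-full v))
        dx : deg H x ≡ 0
        dx = ℤ.+-injective (trans (deg≡∑ H x) (trans (∑-cong (λ w → cong ⟦_⟧ (apart w (w ≟ x)))) ∑-0))
          where
          apart : ∀ w → Dec (w ≡ x) → adj H x w ≡ false
          apart w (yes refl) = adj-irrefl H w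
          apart w (no w≢x)   = trans (adj-sym H x w) (closed w x (only w w≢x) x∉C)
        others : ∀ v → v ≢ x → deg H v ≢ 0
        others v v≢x = has-neighbour {X = H} cC (only v v≢x) (proj₁ (proj₂ other)) (proj₂ (proj₂ other))
          where
          other = ∃-other C v (subst (2 ℕ.≤_) (sym ∣C∣) (ℕ.m≤n+m 2 e))
        H₀ : count H 0 ≡ 1ℤ
        H₀ = trans (∑-cong (λ v → ind-⇔ (deg H v ℕ.≟ 0) (x ≟ v)
            (λ d0 → sym (decidable-stable (v ≟ x) (λ v≢x → others v v≢x d0))) (λ { refl → dx }))) (∑-once x)
        G₀ : count G 0 ≡ 0ℤ
        G₀ = count-none G λ v → let other = ∃-other full v (subst (2 ℕ.≤_) (sym ∣full∣) (ℕ.m≤n⇒m≤o+n e (s≤s (s≤s z≤n)))) in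
          has-neighbour {X = G} cG (∈-full v) (∈-full (proj₁ other)) (proj₂ (proj₂ other))

    -- The number `e` is quantified afresh so that it can be split as `suc j`, where `j` is the size
    -- of the sets summed over in `TwoMissing`.
    all-but-two : ∀ e {G H : Graph (e ℕ.+ 3)} → Matching e G H → 4 ℕ.≤ e → Conn G full →
      ∀ {C} → Conn H C → Closed H C → ∣ C ∣ ≡ e ℕ.+ 1 → ⊥
    all-but-two (suc j) m (s≤s 3≤j) cG cC closed ∣C∣ =
      TwoMissing.two-missing-absurd m (cong suc (ℕ.+-comm j 3)) 3≤j cG cC closed (trans ∣C∣ (cong suc (ℕ.+-comm j 1)))

    by-size : ∀ {C} → Conn H C → Closed H C → (∣ C ∣ ≡ e → ⊥) → ∀ d → ∣ C ∣ ≡ e ℕ.+ d → d ℕ.≤ 3 → ⊥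
    by-size cC closed small 0 eq _ = small (trans eq (ℕ.+-identityʳ e))
    by-size cC closed small 1 eq _ = all-but-two e m 4≤e cG cC closed eq
    by-size cC closed small 2 eq _ = all-but-one cC closed eq
    by-size cC closed small 3 eq _ = not-full cC eq
    by-size cC closed small (suc (suc (suc (suc d)))) eq (s≤s (s≤s (s≤s ())))

    open Matching m

  contradiction : ⊥
  contradiction = use (two-connected-sets {G = G} (ℕ.≤-trans (s≤s z≤n) 4≤e) cG)
    where
    use : (∃₂ λ S T → (∣ S ∣ ≡ e × Conn G S) × (∣ T ∣ ≡ e × Conn G T) × S ≢ T) → ⊥
    use (S , T , (∣S∣ , cS) , (∣T∣ , cT) , S≢T) = start
        (∃-outside none (to S) (subst₂ ℕ._<_ (sym (∣none∣ {n₀})) (sym ∣S′∣) (ℕ.≤-trans (s≤s z≤n) 4≤e)))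
      where
      ∣S′∣ = to-size S ∣S∣
      ∣T′∣ = to-size T ∣T∣
      cS′ : Conn H (to S)
      cS′ = conn-Iso (iso S ∣S∣) cS
      cT′ : Conn H (to T)
      cT′ = conn-Iso (iso T ∣T∣) cT
      start : (∃ λ u → u ∈ to S × u ∉ none) → ⊥
      start (u , u∈ , _) = inside (component {G = H} cS′ u∈)
        where
        inside : (∃ λ C → to S ⊆ C × Conn H C × Closed H C) → ⊥
        inside (C , S⊆C , cC , closed) = by-size cC closed small (∣ C ∣ ∸ e) (sym (ℕ.m+[n∸m]≡n e≤C))
            (ℕ.≤-trans (ℕ.∸-monoˡ-≤ e (size≤n C)) (ℕ.≤-reflexive (ℕ.m+n∸m≡n e 3)))
          where
          e≤C : e ℕ.≤ ∣ C ∣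
          e≤C = subst (ℕ._≤ ∣ C ∣) ∣S′∣ (⊆-size {R = to S} S⊆C)
          -- The images of `S` and `T` both lie in `C` and have its size, so they coincide, against
          -- injectivity of the matching.
          small : ∣ C ∣ ≡ e → ⊥
          small ∣C∣ = S≢T (trans (sym (from-to S ∣S∣))
              (trans (cong from (trans (whole (to S) S⊆C ∣S′∣)
              (sym (whole (to T) (meets cC closed e≤C (to T) cT′ ∣T′∣) ∣T′∣)))) (from-to T ∣T∣)))
            where
            whole : ∀ R → R ⊆ C → ∣ R ∣ ≡ e → R ≡ C
            whole R R⊆C ∣R∣ = ⊆-antisym R⊆C (⊆-antisym-size {R = R} {C} R⊆C (ℕ.≤-reflexive (trans ∣C∣ (sym ∣R∣))))

connected-transfer : ∀ {e} {G H : Graph (e ℕ.+ 3)} → 4 ℕ.≤ e → Matching e G H → Connected G → Connected H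
connected-transfer {G = G} {H} 4≤e m cG = Conn⇒Connected {G = H} (decidable-stable (conn? H full)
  (λ ¬cH → Contradiction.contradiction m 4≤e (Connected⇒Conn {G = G} cG) ¬cH))

connectedness-determined : (n : ℕ) → 7 ℕ.≤ n → (G H : Graph n) → SameDeck (n ∸ 3) G H → Connected G ⇔ Connected H
connectedness-determined n 7≤n = subst (λ n → (G H : Graph n) → SameDeck (n ∸ 3) G H → Connected G ⇔ Connected H)
    (ℕ.m∸n+n≡m (ℕ.≤-trans (ℕ.m≤m+n 3 4) 7≤n)) (λ G H d → let m = SameDeck⇒Matching (subst (λ k → SameDeck k G H) (ℕ.m+n∸n≡m e 3) d) in
      mk⇔ (connected-transfer 4≤e m) (connected-transfer 4≤e (Matching-sym m)))
  where
  e = n ∸ 3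
  4≤e : 4 ℕ.≤ e
  4≤e = ℕ.∸-monoˡ-≤ 3 7≤n

-- The path on six vertices and the disjoint union of a 4-cycle and an edge

module Sharpness where

  matrix : Vec (Vec Bool 6) 6 → Fin 6 → Fin 6 → Bool
  matrix M u v = lookup (lookup M u) v

  private
    I O : Bool
    I = true
    O = false

  path-adj cycle-adj : Fin 6 → Fin 6 → Bool
  path-adj = matrix
    ( (O ∷ I ∷ O ∷ O ∷ O ∷ O ∷ [])
    ∷ (I ∷ O ∷ I ∷ O ∷ O ∷ O ∷ [])
    ∷ (O ∷ I ∷ O ∷ I ∷ O ∷ O ∷ [])
    ∷ (O ∷ O ∷ I ∷ O ∷ I ∷ O ∷ [])
    ∷ (O ∷ O ∷ O ∷ I ∷ O ∷ I ∷ [])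
    ∷ (O ∷ O ∷ O ∷ O ∷ I ∷ O ∷ [])
    ∷ [])
  cycle-adj = matrix
    ( (O ∷ I ∷ O ∷ I ∷ O ∷ O ∷ [])
    ∷ (I ∷ O ∷ I ∷ O ∷ O ∷ O ∷ [])
    ∷ (O ∷ I ∷ O ∷ I ∷ O ∷ O ∷ [])
    ∷ (I ∷ O ∷ I ∷ O ∷ O ∷ O ∷ [])
    ∷ (O ∷ O ∷ O ∷ O ∷ O ∷ I ∷ [])
    ∷ (O ∷ O ∷ O ∷ O ∷ I ∷ O ∷ [])
    ∷ [])

  path cycle : Graph 6
  path = record
    { adj = path-adj
    ; adj-sym = from-yes (Fin.all? (λ u → Fin.all? (λ v → path-adj u v Bool.≟ path-adj v u)))
    ; adj-irrefl = from-yes (Fin.all? (λ v → path-adj v v Bool.≟ false)) }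
  cycle = record
    { adj = cycle-adj
    ; adj-sym = from-yes (Fin.all? (λ u → Fin.all? (λ v → cycle-adj u v Bool.≟ cycle-adj v u)))
    ; adj-irrefl = from-yes (Fin.all? (λ v → cycle-adj v v Bool.≟ false)) }

  -- Cards that contain 3 and one of 0 and 4 are matched by the permutation (0 4)(1 5),
  -- which turns the edge 34 of the path into the edge 30 of the cycle.
  twisted : Subset 6 → Bool
  twisted S = lookup S (# 3) ∧ (lookup S (# 0) ∨ lookup S (# 4))

  π : Fin 6 → Fin 6
  π = lookup (# 4 ∷ # 5 ∷ # 2 ∷ # 3 ∷ # 0 ∷ # 1 ∷ [])

  ρ : Subset 6 → Fin 6 → Fin 6
  ρ S v = if twisted S then π v else v

  -- The preimage of `S` under `ρ S`, which is also its image since `ρ S` is an involution. As `π`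
  -- fixes 3 and exchanges 0 and 4, `σ S` is twisted exactly when `S` is, and `σ` is its own
  -- inverse.
  σ : Subset 6 → Subset 6
  σ S = Vec.tabulate (λ v → lookup S (ρ S v))

  for-all-subsets : ∀ {P : Subset 6 → Set} (P? : ∀ S → Dec (P S)) → Dec (∀ S → P S)
  for-all-subsets P? with anySubset? (λ S → ¬? (P? S))
  ... | yes (S , ¬p) = no (λ all → ¬p (all S))
  ... | no  ¬∃       = yes (λ S → decidable-stable (P? S) (λ ¬p → ¬∃ (S , ¬p)))

  σσ : ∀ S → σ (σ S) ≡ S
  σσ = from-yes (for-all-subsets (λ S → σ (σ S) ≟ S))

  size-σ : ∀ S → size (σ S) ≡ size S
  size-σ = from-yes (for-all-subsets (λ S → size (σ S) ℕ.≟ size S))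

  ρρ : ∀ S v → ρ S (ρ S v) ≡ v
  ρρ = from-yes (for-all-subsets (λ S → Fin.all? (λ v → ρ S (ρ S v) ≟ v)))

  σ-ρ : ∀ S v → lookup (σ S) (ρ S v) ≡ lookup S v
  σ-ρ S v = trans (Vec.lookup∘tabulate (λ v → lookup S (ρ S v)) (ρ S v)) (cong (lookup S) (ρρ S v))

  preserved : ∀ S → size S ≡ 3 → ∀ u v → lookup S u ≡ true → lookup S v ≡ true → path-adj u v ≡ cycle-adj (ρ S u)
      (ρ S v)
  preserved = from-yes (for-all-subsets (λ S → (size S ℕ.≟ 3) →-dec Fin.all? (λ u → Fin.all? (λ v →
    (lookup S u Bool.≟ true) →-dec ((lookup S v Bool.≟ true) →-dec
        (path-adj u v Bool.≟ cycle-adj (ρ S u) (ρ S v)))))))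

  same-deck : SameDeck 3 path cycle
  same-deck = record
    { matching = mk↔ₛ′ image image image-image image-image
    ; card-iso = λ { (S , sz) → record
        { vertices = mk↔ₛ′
            (λ { (v , p) → ρ S v , Vec.lookup⇒[]= (ρ S v) (σ S) (trans (σ-ρ S v) (Vec.[]=⇒lookup p)) })
            (λ { (v , p) → ρ S v , Vec.lookup⇒[]= (ρ S v) S
                (trans (sym (Vec.lookup∘tabulate (λ v → lookup S (ρ S v)) v)) (Vec.[]=⇒lookup p)) })
            (λ { (v , p) → vertex-≡ (ρρ S v) })
            (λ { (v , p) → vertex-≡ (ρρ S v) })
        ; preserves = λ { (u , p) (v , q) → preserved S sz u v (Vec.[]=⇒lookup p) (Vec.[]=⇒lookup q) } } }
    }
    where
    image : KSubset 6 3 → KSubset 6 3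
    image (S , sz) = σ S , trans (size-σ S) sz
    KSubset-≡ : ∀ {S T : KSubset 6 3} → proj₁ S ≡ proj₁ T → S ≡ T
    KSubset-≡ {S , p} {_ , q} refl = cong (S ,_) (uip p q)
    image-image : ∀ S → image (image S) ≡ S
    image-image (S , sz) = KSubset-≡ (σσ S)
    vertex-≡ : ∀ {R : Subset 6} {x y : Σ[ v ∈ Fin 6 ] R Vec.[ v ]= true} → proj₁ x ≡ proj₁ y → x ≡ y
    vertex-≡ {x = v , p} {_ , q} refl = cong (v ,_) (Vec.[]=-irrelevant p q)

  path-connected : Connected path
  path-connected u v = to-end u ◅◅ from-end v
    where
    Walk = Star (Adj path)
    to-end : ∀ u → Walk u (# 0)
    to-end zero = ε
    to-end (suc zero) = refl ◅ ε
    to-end (suc (suc zero)) = _◅_ {j = # 1} refl (refl ◅ ε)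
    to-end (suc (suc (suc zero))) = _◅_ {j = # 2} refl (_◅_ {j = # 1} refl (refl ◅ ε))
    to-end (suc (suc (suc (suc zero)))) = _◅_ {j = # 3} refl (_◅_ {j = # 2} refl (_◅_ {j = # 1} refl (refl ◅ ε)))
    to-end (suc (suc (suc (suc (suc zero))))) = _◅_ {j = # 4} refl
        (_◅_ {j = # 3} refl (_◅_ {j = # 2} refl (_◅_ {j = # 1} refl (refl ◅ ε))))
    reverse : ∀ {u v} → Walk u v → Walk v u
    reverse ε = ε
    reverse {u} (_◅_ {j = w} uw rest) = reverse rest ◅◅ (trans (adj-sym path w u) uw ◅ ε)
    from-end : ∀ v → Walk (# 0) v
    from-end v = reverse (to-end v)

  cycle-disconnected : ¬ Connected cycle
  cycle-disconnected c = true≢false (stays (c (# 0) (# 4)))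
    where
    side : Fin 6 → Bool
    side = lookup (I ∷ I ∷ I ∷ I ∷ O ∷ O ∷ [])
    step : ∀ u v → cycle-adj u v ≡ true → side u ≡ side v
    step = from-yes (Fin.all? (λ u → Fin.all? (λ v → (cycle-adj u v Bool.≟ true) →-dec (side u Bool.≟ side v))))
    stays : ∀ {u v} → Star (Adj cycle) u v → side u ≡ side v
    stays ε = refl
    stays {u} (_◅_ {j = w} uw rest) = trans (step u w uw) (stays rest)

theorem1p5 : ((n : ℕ) → 7 ℕ.≤ n → (G H : Graph n) → SameDeck (n ∸ 3) G H → Connected G ⇔ Connected H)
    × (Σ[ G ∈ Graph 6 ] Σ[ H ∈ Graph 6 ] (SameDeck 3 G H × Connected G × ¬ Connected H))
theorem1p5 = connectedness-determined , path , cycle , same-deck , path-connected , cycle-disconnected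
  where open Sharpness
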